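{- Let $t$, $\epsilon$, and $\epsilon'$ be positive constants. The (unbalanced) 3-HS Hypothesis implies that there exists no fully dynamic algorithm for $(2-\epsilon)$-approximate Radius on directed, unweighted graphs with $n$ vertices and $\tilde{O}(n)$ edges which has preprocessing time $p(n)=O(n^t)$, amortized update time $u(n)=O(n^{2-\epsilon'})$, and amortized query time $q(n)=O(n^{2-\epsilon'})$. The same result holds for the incremental and decremental settings, but for worst-case update and query times.
   Context: $\tilde{O}$ suppresses polylogarithmic factors. For a directed graph $G=(V,E)$, $d(u,v)$ is the length of a shortest path from $u$ to $v$ ($\infty$ if there is none); the eccentricity of $v$ is $\varepsilon(v)=\max_{u\in V}d(v,u)$; the radius is $\min_v\varepsilon(v)$. A fully dynamic algorithm preprocesses an initial graph and then supports edge insertions and edge deletions (updates) as well as queries asking for (an estimate of) the parameter of the current graph; in the incremental (decremental) setting only edge insertions (only edge deletions) are supported. An $\alpha$-approximation algorithm answers each query about a parameter with current value $P$ by a value $\hat P$ with $P\le \hat P\le \alpha P$ (equivalently, after rescaling, $P/\alpha\le\hat P\le P$). Unbalanced 3-HS is the problem: given $U,V,W\subseteq\{0,1\}^d$ with $|U|=n$, $|V|=n^a$, $|W|=n^b$ for constants $a,b>0$, decide whether there are $u\in U$, $w\in W$ such that for all $v\in V$, $u\cdot v\cdot w:=\sum_{i=1}^d u[i]v[i]w[i]\neq 0$. The unbalanced 3-HS Hypothesis is that unbalanced 3-HS requires $(|U|\cdot|V|\cdot|W|)^{1-o(1)}=n^{1+a+b-o(1)}$ time in the word-RAM model with $O(\log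 n)$-bit words, even for randomized algorithms. -}

module Defs where

open import Data.Bool.Base using (Bool; true; false; _∧_; _∨_; _xor_; if_then_else_)
open import Data.Fin.Base using (Fin; toℕ)
import Data.Fin.Properties as Fin
open import Data.Integer.Base using (+_; -[1+_])
open import Data.List.Base using (List; []; _∷_; _∷ʳ_; length; map; filter)
open import Data.List.Membership.Propositional using (_∈_; _∉_)
open import Data.List.Relation.Binary.Pointwise using (Pointwise)
open import Data.List.Relation.Unary.All using (All)
open import Data.List.Relation.Unary.Unique.Propositional using (Unique)
open import Data.Nat.Base
  using (ℕ; zero; suc; _+_; _*_; _∸_; _^_; _/_; _%_; _≤_; _<_; _≡ᵇ_; _<ᵇ_; ⌊_/2⌋; NonZero)
open import Data.Nat.ListAction using (sum)
open import Data.Nat.Logarithm using (⌊log₂_⌋)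
open import Data.Product.Base using (_×_; _,_; proj₁; proj₂; ∃; ∃-syntax)
open import Data.Product.Properties using (≡-dec)
open import Data.Rational.Base as ℚ using (ℚ; mkℚ; 0ℚ; 1ℚ)
open import Data.Vec.Base as Vec using (Vec)
open import Function.Bundles using (_⇔_)
open import Relation.Binary.Construct.Add.Supremum.NonStrict (_≤_) using (_≤⁺_)
open import Relation.Binary.Definitions using (DecidableEquality)
open import Relation.Binary.PropositionalEquality.Core using (_≡_; _≢_)
open import Relation.Nullary.Construct.Add.Supremum using (_⁺; [_]; ⊤⁺)
open import Relation.Nullary.Decidable using (¬?)
open import Relation.Nullary.Negation using (¬_)

------------------------------------------------------------------------
-- Growth rates

-- m ≤ C^(1/y) · n^e for n ≥ 1, where y is the denominator of e; both
-- sides are raised to the power y, and a negative power of n is moved to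
-- the left.
AtMostPow : (m C n : ℕ) (e : ℚ) → Set
AtMostPow m C n (mkℚ (+ x)    y-1 _) = m ^ suc y-1 ≤ C * n ^ x
AtMostPow m C n (mkℚ -[1+ x ] y-1 _) = m ^ suc y-1 * n ^ suc x ≤ C

-- f(n) = O(n^e).
_isO[n^_] : (ℕ → ℕ) → ℚ → Set
f isO[n^ e ] = ∃[ C ] ∀ n .{{_ : NonZero n}} → AtMostPow (f n) C n e

-- m = ⌊n^e⌋.
IsFloorPow : (m n : ℕ) (e : ℚ) → Set
IsFloorPow m n e = AtMostPow m 1 n e × ¬ AtMostPow (suc m) 1 n e

-- The k-th polylogarithm.  Whenever it is used k is universally
-- quantified, so that a leading constant can be absorbed into k.
polylog : (k n : ℕ) → ℕ
polylog k n = suc ⌊log₂ n ⌋ ^ k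

------------------------------------------------------------------------
-- The word-RAM

-- A program uses finitely many registers and finitely many arrays, each
-- array being indexed by words.  A run is relative to a word length w and
-- to a sequence of random bits ρ, which the program may access in any
-- order (the number of random bits made available, 2 ^ w, is the number
-- of addressable cells).

Reg Arr : Set
Reg = ℕ
Arr = ℕ

record State : Set where
  constructor ⟨_,_⟩
  field
    reg : Reg → ℕ
    arr : Arr → ℕ → ℕ

open State public

update : {A : Set} → (ℕ → A) → ℕ → A → (ℕ → A)
update f i a j = if i ≡ᵇ j then a else f j

setReg : Reg → ℕ → State → State
setReg x v ⟨ r , a ⟩ = ⟨ update r x v , a ⟩

setCell : Arr → ℕ → ℕ → State → State
setCell A i v ⟨ r , a ⟩ = ⟨ r , update a A (update (a A) i v) ⟩

bit : Bool → ℕ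
bit b = if b then 1 else 0

data BinOp : Set where
  add sub mul div mod and or xor shl shr lt eq : BinOp

-- The first argument of bitwise f bounds the number of binary digits.
bitwise : (Bool → Bool → Bool) → ℕ → ℕ → ℕ → ℕ
bitwise f zero    m n = 0
bitwise f (suc l) m n = bit (f (odd m) (odd n)) + 2 * bitwise f l ⌊ m /2⌋ ⌊ n /2⌋
  where
  odd : ℕ → Bool
  odd i = i % 2 ≡ᵇ 1

shiftRight : ℕ → ℕ → ℕ
shiftRight m zero    = m
shiftRight m (suc n) = shiftRight ⌊ m /2⌋ n

⟦_⟧ : BinOp → ℕ → ℕ → ℕ
⟦ add ⟧ m n       = m + n
⟦ sub ⟧ m n       = m ∸ n
⟦ mul ⟧ m n       = m * n
⟦ div ⟧ m zero    = 0
⟦ div ⟧ m (suc n) = m / suc n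
⟦ mod ⟧ m zero    = 0
⟦ mod ⟧ m (suc n) = m % suc n
⟦ and ⟧ m n       = bitwise _∧_ (m + n) m n
⟦ or  ⟧ m n       = bitwise _∨_ (m + n) m n
⟦ xor ⟧ m n       = bitwise _xor_ (m + n) m n
⟦ shl ⟧ m n       = m * 2 ^ n
⟦ shr ⟧ m n       = shiftRight m n
⟦ lt  ⟧ m n       = bit (m <ᵇ n)
⟦ eq  ⟧ m n       = bit (m ≡ᵇ n)

infixr 5 _⨾_

data Program : Set where
  skip         : Program
  const        : Reg → ℕ → Program
  op           : BinOp → Reg → Reg → Reg → Program
  load         : Reg → Arr → Reg → Program
  store        : Arr → Reg → Reg → Program
  coin         : Reg → Reg → Program
  _⨾_          : Program → Program → Program
  ifNZ_then_else_ : Reg → Program → Program → Program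
  whileNZ_loop_  : Reg → Program → Program

-- Eval p s t s′: run from the state s, the program p halts after t steps
-- in the state s′.  Every instruction and every test takes one step.  There
-- is no rule for an operation whose result does not fit into a word, or for
-- the use of a random bit beyond 2 ^ w: a program that attempts it does not
-- halt.
module _ (w : ℕ) (ρ : ℕ → Bool) where

  data Eval : Program → State → ℕ → State → Set where
    skip   : ∀ {s} → Eval skip s 1 s
    const  : ∀ {s x v} → v < 2 ^ w → Eval (const x v) s 1 (setReg x v s)
    op     : ∀ {s o x y z} → let v = ⟦ o ⟧ (reg s y) (reg s z) in
             v < 2 ^ w → Eval (op o x y z) s 1 (setReg x v s)
    load   : ∀ {s x A i} →
             Eval (load x A i) s 1 (setReg x (arr s A (reg s i)) s)
    store  : ∀ {s A i x} →
             Eval (store A i x) s 1 (setCell A (reg s i) (reg s x) s)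
    coin   : ∀ {s x i} → reg s i < 2 ^ w → bit (ρ (reg s i)) < 2 ^ w →
             Eval (coin x i) s 1 (setReg x (bit (ρ (reg s i))) s)
    _⨾_    : ∀ {p q s s′ s″ t t′} → Eval p s t s′ → Eval q s′ t′ s″ →
             Eval (p ⨾ q) s (t + t′) s″
    ifTrue : ∀ {x p q s s′ t} → reg s x ≢ 0 → Eval p s t s′ →
             Eval (ifNZ x then p else q) s (suc t) s′
    ifFalse : ∀ {x p q s s′ t} → reg s x ≡ 0 → Eval q s t s′ →
             Eval (ifNZ x then p else q) s (suc t) s′
    whileTrue : ∀ {x p s s′ s″ t t′} → reg s x ≢ 0 → Eval p s t s′ →
             Eval (whileNZ x loop p) s′ t′ s″ →
             Eval (whileNZ x loop p) s (suc (t + t′)) s″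
    whileFalse : ∀ {x p s} → reg s x ≡ 0 → Eval (whileNZ x loop p) s 1 s

-- Words of O(log n) bits.
wordLength : (c n : ℕ) → ℕ
wordLength c n = c * suc ⌊log₂ n ⌋

cells : {A : Set} → A → List A → ℕ → A
cells a []       i       = a
cells a (x ∷ xs) zero    = x
cells a (x ∷ xs) (suc i) = cells a xs i

Tape : ℕ → Set
Tape w = Vec Bool (2 ^ w)

bits : ∀ {N} → Vec Bool N → ℕ → Bool
bits ρ = cells false (Vec.toList ρ)

-- For ρ uniformly random, P ρ fails with probability at most 1/y.
-- The distinct bit vectors listed need not be all those satisfying P, so that P
-- need not be decidable.
ErrorAtMost1/ : ℕ → ∀ {N} → (Vec Bool N → Set) → Set
ErrorAtMost1/ y {N} P =
  ∃[ L ] Unique L × All P L × y * 2 ^ N ≤ y * length L + 2 ^ N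

------------------------------------------------------------------------
-- Unbalanced 3-HS

record Instance (a b : ℚ) (d n : ℕ) : Set where
  field
    {∣V∣ ∣W∣} : ℕ
    ∣V∣-size  : IsFloorPow ∣V∣ n a
    ∣W∣-size  : IsFloorPow ∣W∣ n b
    U         : Vec (Vec Bool d) n
    V         : Vec (Vec Bool d) ∣V∣
    W         : Vec (Vec Bool d) ∣W∣
    U-unique  : Unique (Vec.toList U)
    V-unique  : Unique (Vec.toList V)
    W-unique  : Unique (Vec.toList W)

tripleProduct : ∀ {d} → Vec Bool d → Vec Bool d → Vec Bool d → ℕ
tripleProduct u v w =
  Vec.sum (Vec.tabulate λ i →
    bit (Vec.lookup u i) * bit (Vec.lookup v i) * bit (Vec.lookup w i))

HasHittingPair : ∀ {a b d n} → Instance a b d n → Set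
HasHittingPair I = ∃[ i ] ∃[ k ] ∀ j →
  tripleProduct (Vec.lookup U i) (Vec.lookup V j) (Vec.lookup W k) ≢ 0
  where open Instance I

-- Registers 0-3 hold n, |V|, |W| and d; arrays 0-2 hold U, V and W, vector
-- after vector, with one coordinate per cell.  All other cells are 0.
input3HS : ∀ {a b d n} → Instance a b d n → State
input3HS {d = d} {n} I =
  ⟨ cells 0 (n ∷ ∣V∣ ∷ ∣W∣ ∷ d ∷ [])
  , cells (λ _ → 0) (coordinates U ∷ coordinates V ∷ coordinates W ∷ []) ⟩
  where
  open Instance I
  coordinates : ∀ {m} → Vec (Vec Bool d) m → ℕ → ℕ
  coordinates S = cells 0 (Vec.toList (Vec.map bit (Vec.concat S)))

-- "Yes" is signalled by register 0 being nonzero.  Monte Carlo algorithms: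
-- the running time is bounded for all random bits.
record Solves3HS (a b : ℚ) (k : ℕ) (p : Program) (c : ℕ) (T : ℕ → ℕ) : Set where
  field
    halts : ∀ n .{{_ : NonZero n}} d → d ≤ polylog k n → (I : Instance a b d n) →
      (ρ : Tape (wordLength c n)) →
      ∃[ t ] ∃[ s ] Eval (wordLength c n) (bits ρ) p (input3HS I) t s × t ≤ T n
    correct : ∀ n .{{_ : NonZero n}} d → d ≤ polylog k n → (I : Instance a b d n) →
      ErrorAtMost1/ 3 λ (ρ : Tape (wordLength c n)) →
        ∃[ t ] ∃[ s ] Eval (wordLength c n) (bits ρ) p (input3HS I) t s ×
          (reg s 0 ≢ 0 ⇔ HasHittingPair I)

Solvable3HS : (a b e : ℚ) (k : ℕ) → Set
Solvable3HS a b e k = ∃[ p ] ∃[ c ] ∃[ T ] T isO[n^ e ] × Solves3HS a b k p c T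

-- No exponent below 1 + a + b is achievable for all polylogarithmic
-- dimensions.
Unbalanced3HSHypothesis : Set
Unbalanced3HSHypothesis = ∀ a b δ → 0ℚ ℚ.< a → 0ℚ ℚ.< b → 0ℚ ℚ.< δ →
  ¬ (∀ k → Solvable3HS a b (1ℚ ℚ.+ a ℚ.+ b ℚ.- δ) k)

------------------------------------------------------------------------
-- Radius of directed graphs

Edge : ℕ → Set
Edge n = Fin n × Fin n

_≟ᴱ_ : ∀ {n} → DecidableEquality (Edge n)
_≟ᴱ_ = ≡-dec Fin._≟_ Fin._≟_

-- The directed graph with vertex set Fin n and the listed edges.
Graph : ℕ → Set
Graph n = List (Edge n)

module _ {n : ℕ} (G : Graph n) where

  data Walk : Fin n → Fin n → ℕ → Set where
    []  : ∀ {u} → Walk u u 0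
    _∷_ : ∀ {u v x l} → (u , v) ∈ G → Walk v x l → Walk u x (suc l)

  data IsDistance (u v : Fin n) : ℕ ⁺ → Set where
    shortest    : ∀ {l} → Walk u v l → (∀ {m} → Walk u v m → l ≤ m) →
                  IsDistance u v [ l ]
    unreachable : (∀ {m} → ¬ Walk u v m) → IsDistance u v ⊤⁺

  IsEccentricity : Fin n → ℕ ⁺ → Set
  IsEccentricity v e =
    (∃[ u ] IsDistance v u e) × (∀ u d → IsDistance v u d → d ≤⁺ e)

  IsRadius : ℕ ⁺ → Set
  IsRadius r =
    (∃[ v ] IsEccentricity v r) × (∀ v e → IsEccentricity v e → r ≤⁺ e)

fromℕ : ℕ → ℚ
fromℕ m = + m ℚ./ 1

-- P ≤ P̂ ≤ α P.
data Approximates (α : ℚ) : (P P̂ : ℕ ⁺) → Set where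
  finite   : ∀ {m m̂} → m ≤ m̂ → fromℕ m̂ ℚ.≤ α ℚ.* fromℕ m →
             Approximates α [ m ] [ m̂ ]
  infinite : Approximates α ⊤⁺ ⊤⁺

------------------------------------------------------------------------
-- Dynamic algorithms

data Setting : Set where
  fullyDynamic incremental decremental : Setting

data SupportsInsertions : Setting → Set where
  fullyDynamic : SupportsInsertions fullyDynamic
  incremental  : SupportsInsertions incremental

data SupportsDeletions : Setting → Set where
  fullyDynamic : SupportsDeletions fullyDynamic
  decremental  : SupportsDeletions decremental

data Request (n : ℕ) : Set where
  insert delete : Edge n → Request n
  query         : Request n

-- Starting with G, the requests rs lead to G′, and no graph on the way has
-- more than M edges.
data Legal (σ : Setting) {n : ℕ} (M : ℕ) :
           (G : Graph n) (rs : List (Request n)) (G′ : Graph n) → Set where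
  []     : ∀ {G} → Legal σ M G [] G
  insert : ∀ {G G′ e rs} → SupportsInsertions σ → e ∉ G →
           length (e ∷ G) ≤ M → Legal σ M (e ∷ G) rs G′ →
           Legal σ M G (insert e ∷ rs) G′
  delete : ∀ {G G′ e rs} → SupportsDeletions σ → e ∈ G →
           Legal σ M (filter (λ e′ → ¬? (e′ ≟ᴱ e)) G) rs G′ →
           Legal σ M G (delete e ∷ rs) G′
  query  : ∀ {G G′ rs} → Legal σ M G rs G′ → Legal σ M G (query ∷ rs) G′

record Algorithm : Set where
  field
    preprocessing insertion deletion querying : Program

-- Registers 0 and 1 hold the numbers of vertices and edges; arrays 0 and 1
-- hold the tails and heads of the edges.
inputGraph : ∀ {n} → Graph n → State
inputGraph {n} G =
  ⟨ cells 0 (n ∷ length G ∷ [])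
  , cells (λ _ → 0) ( cells 0 (map (λ e → toℕ (proj₁ e)) G)
                    ∷ cells 0 (map (λ e → toℕ (proj₂ e)) G) ∷ []) ⟩

inputEdge : ∀ {n} → Edge n → State → State
inputEdge (u , v) s = setReg 1 (toℕ v) (setReg 0 (toℕ u) s)

-- The answer to a query is left in register 0, with 0 standing for ∞ and
-- 1 + m for m.
answer : State → ℕ ⁺
answer s with reg s 0
... | zero  = ⊤⁺
... | suc m = [ m ]

module _ (A : Algorithm) (w : ℕ) (ρ : ℕ → Bool) where
  open Algorithm A

  Serve : ∀ {n} → Request n → State → ℕ → State → Set
  Serve (insert e) s = Eval w ρ insertion (inputEdge e s)
  Serve (delete e) s = Eval w ρ deletion (inputEdge e s)
  Serve query      s = Eval w ρ querying s

  -- The list records the time taken by each request.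
  data ServeAll {n : ℕ} : List (Request n) → State → List ℕ → State → Set where
    []  : ∀ {s} → ServeAll [] s [] s
    _∷_ : ∀ {r rs s s′ s″ t ts} → Serve r s t s′ → ServeAll rs s′ ts s″ →
          ServeAll (r ∷ rs) s (t ∷ ts) s″

data Timing : Set where
  amortized worstCase : Timing

Within : Timing → (times bounds : List ℕ) → Set
Within amortized ts bs = sum ts ≤ sum bs
Within worstCase ts bs = Pointwise _≤_ ts bs

requestBound : (u q : ℕ → ℕ) → ∀ {n} → Request n → ℕ
requestBound u q {n} (insert _) = u n
requestBound u q {n} (delete _) = u n
requestBound u q {n} query      = q n

-- The algorithm A, with words of wordLength c n bits, α-approximates the
-- radius of graphs with n vertices and at most n · polylog k n edges, during
-- up to n ^ l requests.  It may be randomized: for every sequence of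
-- requests, fixed in advance, each query is answered correctly except with
-- probability at most n ^ - h, while the time bounds p, u and q hold
-- for all random bits.
record ApproximatesRadius
         (σ : Setting) (τ : Timing) (α : ℚ) (k l h : ℕ)
         (A : Algorithm) (c : ℕ) (p u q : ℕ → ℕ) : Set where
  open Algorithm A
  field
    preprocessingTime :
      ∀ n .{{_ : NonZero n}} (G : Graph n) → Unique G → length G ≤ n * polylog k n →
      (ρ : Tape (wordLength c n)) →
      ∃[ t ] ∃[ s ]
        Eval (wordLength c n) (bits ρ) preprocessing (inputGraph G) t s × t ≤ p n
    requestTime :
      ∀ n .{{_ : NonZero n}} (G : Graph n) → Unique G → length G ≤ n * polylog k n →
      ∀ rs G′ → Legal σ (n * polylog k n) G rs G′ → length rs ≤ n ^ l →
      (ρ : Tape (wordLength c n)) →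
      ∃[ t ] ∃[ s ] ∃[ ts ] ∃[ s′ ]
        Eval (wordLength c n) (bits ρ) preprocessing (inputGraph G) t s ×
        ServeAll A (wordLength c n) (bits ρ) rs s ts s′ ×
        Within τ ts (map (requestBound u q) rs)
    correct :
      ∀ n .{{_ : NonZero n}} (G : Graph n) → Unique G → length G ≤ n * polylog k n →
      ∀ rs G′ → Legal σ (n * polylog k n) G rs G′ → length (rs ∷ʳ query) ≤ n ^ l →
      ErrorAtMost1/ (n ^ h) λ (ρ : Tape (wordLength c n)) →
        ∃[ t ] ∃[ s ] ∃[ ts ] ∃[ s′ ]
          Eval (wordLength c n) (bits ρ) preprocessing (inputGraph G) t s ×
          ServeAll A (wordLength c n) (bits ρ) (rs ∷ʳ query) s ts s′ ×
          ∃[ P ] IsRadius G′ P × Approximates α P (answer s′)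

-- All of Õ(n) edges, polynomially long sequences of requests and
-- correctness with high probability: for every k, l and h there is
-- an algorithm with preprocessing time O(n^t) and update and query
-- time O(n^e).
SparseRadiusApproximable : Setting → Timing → (α t e : ℚ) → Set
SparseRadiusApproximable σ τ α t e = ∀ k l h →
  ∃[ A ] ∃[ c ] ∃[ p ] ∃[ u ] ∃[ q ]
    p isO[n^ t ] × u isO[n^ e ] × q isO[n^ e ] ×
    ApproximatesRadius σ τ α k l h A c p u q

{-# OPTIONS --safe #-}

-- For a fixed w ∈ W, a directed graph with Õ(n) edges encodes which u hit
-- which v: coordinates i with w i = 1 are opened by one edge each, and a hit
-- gives a path of length 3.  The vertices v start lines of length L, and any
-- detour between two vertices u also takes a line of length L, so the radius
-- is at most L + 3 if some u hits all v and at least 2 L otherwise; for large L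
-- a (2 - ε)-approximation separates the two cases.  The 3-HS algorithm
-- preprocesses the graph without w and then, for each w ∈ W, makes d updates
-- and one query, and returns to the preprocessed state.  As this rollback is
-- done by the simulation and not by further updates, only insertions (or only
-- deletions) are needed, and amortized bounds suffice, because each w uses
-- them for one sequence starting with the initial graph.  Taking |V| = n and
-- |W| = n^b with b ≥ t makes the preprocessing time negligible.

module Submission where

-- Restoring the memory by copying could cost as much per phase as the preprocessing; with version
-- numbers the rollback is a single assignment. All phases share one random tape. This is sound
-- because the request sequences depend on the instance alone: with error probability
-- `N ^ - (β + 1)` per sequence, a union bound over the `n ^ β` vectors w leaves 1/3. The simulated
-- algorithm runs on N vertices, so its words and its tape are embedded in longer ones. Not every
-- vertex is a candidate for a centre: once a path has left the hub and the lines of U it cannot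
-- return, so all other vertices have infinite eccentricity. The middle line only serves to bring
-- the coordinates within distance `L + 3`. Constants: if ε has denominator q, then ε ≥ 1/q, and
-- `L = 8 q` makes `(2 - 1/q) (L + 3) < 2 L`. If ε′ has denominator q′, a phase saves a factor of
-- about `n ^ (1/q′)` over `n ^ 2`; one half of this saving absorbs all polylogarithms, the other
-- half contradicts the hypothesis. Distances are shown to exist only up to double negation, which
-- suffices because the final inequalities between numbers are decidable.

module Development where

  open import Defs
  open import Data.Bool.Base using (Bool; true; false; if_then_else_; T; _∧_; not)
  import Data.Bool.Properties as Bool
  open import Data.Empty using (⊥; ⊥-elim)
  open import Data.Fin.Base as Fin
    using (Fin; zero; suc; toℕ; fromℕ<; inject₁; _↑ˡ_; _↑ʳ_; combine; remQuot; splitAt)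
  open import Data.Fin.Induction using (<-weakInduction)
  import Data.Fin.Properties as Fin
  open import Data.Fin.Relation.Unary.Top using (view; ‵fromℕ; ‵inj₁)
  open import Data.Integer.Base as ℤ using (ℤ)
  import Data.Integer.Properties as ℤ
  import Data.Integer.Tactic.RingSolver as ℤ
  open import Data.List.Base as List
    using (List; []; _∷_; _∷ʳ_; length; map; _++_; filter; take; cartesianProductWith)
  open import Data.List.Membership.Propositional using (_∈_; _∉_)
  open import Data.List.Membership.Propositional.Properties
  import Data.List.Properties as List
  open import Data.List.Relation.Binary.Pointwise using (Pointwise; []; _∷_)
  open import Data.List.Relation.Unary.All as All using (All; []; _∷_)
  import Data.List.Relation.Unary.All.Properties as All
  open import Data.List.Relation.Unary.AllPairs using ([]; _∷_)
  open import Data.List.Relation.Unary.Any using (here; there)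
  open import Data.List.Relation.Unary.Unique.Propositional using (Unique)
  import Data.List.Relation.Unary.Unique.Propositional.Properties as Unique
  open import Data.Nat.Base
  open import Data.Nat.Coprimality using (Coprime; 1-coprimeTo) renaming (sym to coprime-sym)
  open import Data.Nat.DivMod using ([m+kn]%n≡m%n; m<n⇒m%n≡m)
  open import Data.Nat.Induction using (<-rec)
  open import Data.Nat.ListAction using (sum)
  open import Data.Nat.Logarithm
  open import Data.Nat.Properties
  open import Data.Nat.Tactic.RingSolver using (solve-∀)
  open import Data.Product.Base using (_×_; _,_; proj₁; proj₂; ∃-syntax; Σ)
  open import Data.Rational.Base as ℚ using (ℚ; mkℚ; 0ℚ; 1ℚ; toℚᵘ; ↧ₙ_)
  import Data.Rational.Properties as ℚ
  open import Data.Rational.Unnormalised.Base as ℚᵘ using (ℚᵘ; mkℚᵘ; *≤*)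
  import Data.Rational.Unnormalised.Properties as ℚᵘ
  open import Data.Sum.Base using (_⊎_; inj₁; inj₂)
  open import Data.Unit.Base using (⊤; tt)
  open import Data.Vec.Base as Vec using (Vec; []; _∷_)
  import Data.Vec.Properties as Vec
  open import Function.Base using (_∘_)
  open import Function.Bundles using (_⇔_; mk⇔; Equivalence)
  open import Relation.Binary.Construct.Add.Supremum.NonStrict (_≤_) using (_≤⁺_; [_])
  open import Relation.Binary.PropositionalEquality hiding (J; [_])
  open import Relation.Nullary.Construct.Add.Supremum using ([_]; ⊤⁺)
  open import Relation.Nullary.Decidable using (Dec; yes; no; ¬?; _×-dec_; decidable-stable)
  open import Relation.Nullary.Negation using (¬_; contradiction)
  open import Relation.Unary using (Decidable)

  -- The word-RAM

  Arrays : Set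
  Arrays = Arr → ℕ → ℕ

  ≡ᵇ-refl : ∀ i → (i ≡ᵇ i) ≡ true
  ≡ᵇ-refl zero    = refl
  ≡ᵇ-refl (suc i) = ≡ᵇ-refl i

  ≢⇒≡ᵇ : ∀ {i j} → i ≢ j → (i ≡ᵇ j) ≡ false
  ≢⇒≡ᵇ {i} {j} i≢j with i ≡ᵇ j in equ
  ... | false = refl
  ... | true  = contradiction (≡ᵇ⇒≡ i j (subst T (sym equ) tt)) i≢j

  update-same : ∀ {A : Set} (f : ℕ → A) i a → update f i a i ≡ a
  update-same f i a rewrite ≡ᵇ-refl i = refl

  update-other : ∀ {A : Set} (f : ℕ → A) {i j} a → i ≢ j → update f i a j ≡ f j
  update-other f {i} {j} a i≢j rewrite ≢⇒≡ᵇ i≢j = refl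

  reg-set : ∀ S x v → reg (setReg x v S) x ≡ v
  reg-set S x v = update-same (reg S) x v

  reg-set-other : ∀ S {x r} v → x ≢ r → reg (setReg x v S) r ≡ reg S r
  reg-set-other S v x≢r = update-other (reg S) v x≢r

  -- The specification of a dynamic algorithm supplies separate runs for preprocessing time, request
  -- time and correctness. Determinism identifies the states that occur in them.
  Eval-deterministic : ∀ {w ρ p s t₁ s₁ t₂ s₂} →
    Eval w ρ p s t₁ s₁ → Eval w ρ p s t₂ s₂ → t₁ ≡ t₂ × s₁ ≡ s₂
  Eval-deterministic skip       skip       = refl , refl
  Eval-deterministic (const _)  (const _)  = refl , refl
  Eval-deterministic (op _)     (op _)     = refl , refl
  Eval-deterministic load       load       = refl , refl
  Eval-deterministic store      store      = refl , refl
  Eval-deterministic (coin _ _) (coin _ _) = refl , refl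
  Eval-deterministic (d ⨾ e) (d′ ⨾ e′)
    with refl , refl ← Eval-deterministic d d′
    with refl , refl ← Eval-deterministic e e′ = refl , refl
  Eval-deterministic (ifTrue _ d)   (ifTrue _ d′)
    with refl , refl ← Eval-deterministic d d′ = refl , refl
  Eval-deterministic (ifTrue x≢0 _) (ifFalse x≡0 _) = contradiction x≡0 x≢0
  Eval-deterministic (ifFalse x≡0 _) (ifTrue x≢0 _) = contradiction x≡0 x≢0
  Eval-deterministic (ifFalse _ d) (ifFalse _ d′)
    with refl , refl ← Eval-deterministic d d′ = refl , refl
  Eval-deterministic (whileTrue _ d e) (whileTrue _ d′ e′)
    with refl , refl ← Eval-deterministic d d′
    with refl , refl ← Eval-deterministic e e′ = refl , refl
  Eval-deterministic (whileTrue x≢0 _ _) (whileFalse x≡0) = contradiction x≡0 x≢0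
  Eval-deterministic (whileFalse x≡0) (whileTrue x≢0 _ _) = contradiction x≡0 x≢0
  Eval-deterministic (whileFalse _) (whileFalse _) = refl , refl

  cells-∷ʳ : ∀ (ℓ : List ℕ) v → cells 0 (ℓ ∷ʳ v) (length ℓ) ≡ v
  cells-∷ʳ []      v = refl
  cells-∷ʳ (x ∷ ℓ) v = cells-∷ʳ ℓ v

  cells-++ˡ : ∀ {A : Set} {a : A} (xs ys : List A) {i} → i < length xs →
              cells a (xs ++ ys) i ≡ cells a xs i
  cells-++ˡ (x ∷ xs) ys {zero}  _         = refl
  cells-++ˡ (x ∷ xs) ys {suc i} (s≤s i<l) = cells-++ˡ xs ys i<l

  sumUpTo : (ℕ → ℕ) → ℕ → ℕ
  sumUpTo f zero    = 0
  sumUpTo f (suc m) = f 0 + sumUpTo (λ i → f (suc i)) m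

  -- Arithmetic expressions over registers and over the input arrays 0-2

  data Arith : Set where
    plus times minus : Arith

  opcode : Arith → BinOp
  opcode plus  = add
  opcode times = mul
  opcode minus = sub

  data Expr : Set where
    var  : Reg → Expr
    lit  : ℕ → Expr
    bin  : Arith → Expr → Expr → Expr
    cell : Arr → Expr → Expr

  -- Temporaries live in the registers from 64 on.
  temporary : ℕ → Reg
  temporary k = 64 + k

  place : Expr → ℕ → Reg
  place (var r) k = r
  place e       k = temporary k

  mutual
    assign : Reg → Expr → ℕ → Program
    -- The machine has no move instruction, so a register is copied by adding zero.
    assign x (var r)     k = const (temporary k) 0 ⨾ op add x r (temporary k)
    assign x (lit c)     k = const x c
    assign x (bin o a b) k = operand a k ⨾ operand b (suc k) ⨾ op (opcode o) x (place a k) (place b (suc k))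
    assign x (cell A e)  k = operand e k ⨾ load x A (place e k)

    operand : Expr → ℕ → Program
    operand (var r)       k = skip
    operand e@(lit _)     k = assign (temporary k) e k
    operand e@(bin _ _ _) k = assign (temporary k) e k
    operand e@(cell _ _)  k = assign (temporary k) e k

  size : Expr → ℕ
  size (var r)     = 2
  size (lit c)     = 1
  size (bin o a b) = size a + (size b + 1)
  size (cell A e)  = size e + 1

  varsBelow : ℕ → Expr → Bool
  varsBelow m (var r)     = r <ᵇ m
  varsBelow m (lit c)     = true
  varsBelow m (bin o a b) = varsBelow m a ∧ varsBelow m b
  varsBelow m (cell A e)  = (A <ᵇ 3) ∧ varsBelow m e

  -- An exponent: if all variables are at most B, where B ≥ 2, the value is at most `B ^ deg e`. A
  -- literal counts as itself because `c ≤ 2 ^ c`. A cell holds 0 or 1, but it keeps the degree of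
  -- its index, which has to fit into a word as well.
  deg : Expr → ℕ
  deg (var r)     = 1
  deg (lit c)     = c
  deg (bin o a b) = suc (deg a + deg b)
  deg (cell A e)  = deg e

  T-∧ : ∀ a {b} → T (a ∧ b) → T a × T b
  T-∧ true t = tt , t

  module Expressions (input : Arrays) where

    val : (Reg → ℕ) → Expr → ℕ
    val env (var r)     = env r
    val env (lit c)     = c
    val env (bin o a b) = ⟦ opcode o ⟧ (val env a) (val env b)
    val env (cell A e)  = input A (val env e)

    module Bounds (B : ℕ) (2≤B : 2 ≤ B) (input≤1 : ∀ A i → input A i ≤ 1) where

      private
        instance
          B≢0 : NonZero B
          B≢0 = >-nonZero (≤-trans (s≤s z≤n) 2≤B)

        1≤B^ : ∀ n → 1 ≤ B ^ n
        1≤B^ n = m^n>0 B n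

      lit≤B^ : ∀ c → c ≤ B ^ c
      lit≤B^ zero    = z≤n
      lit≤B^ (suc c) = begin
        suc c          ≡⟨ +-comm 1 c ⟩
        c + 1          ≤⟨ +-mono-≤ (lit≤B^ c) (1≤B^ c) ⟩
        B ^ c + B ^ c  ≡⟨ cong (B ^ c +_) (+-identityʳ _) ⟨
        2 * B ^ c      ≤⟨ *-monoˡ-≤ (B ^ c) 2≤B ⟩
        B ^ suc c      ∎
        where open ≤-Reasoning

      bin≤B^ : ∀ o {x y} a b → x ≤ B ^ a → y ≤ B ^ b → ⟦ opcode o ⟧ x y ≤ B ^ suc (a + b)
      bin≤B^ plus {x} {y} a b x≤ y≤ = begin
        x + y                      ≤⟨ +-mono-≤ x≤ y≤ ⟩
        B ^ a + B ^ b              ≤⟨ +-mono-≤ (^-monoʳ-≤ B (m≤m+n a b)) (^-monoʳ-≤ B (m≤n+m b a)) ⟩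
        B ^ (a + b) + B ^ (a + b)  ≡⟨ cong (B ^ (a + b) +_) (+-identityʳ _) ⟨
        2 * B ^ (a + b)            ≤⟨ *-monoˡ-≤ (B ^ (a + b)) 2≤B ⟩
        B ^ suc (a + b)            ∎
        where open ≤-Reasoning
      bin≤B^ times {x} {y} a b x≤ y≤ = begin
        x * y            ≤⟨ *-mono-≤ x≤ y≤ ⟩
        B ^ a * B ^ b    ≡⟨ ^-distribˡ-+-* B a b ⟨
        B ^ (a + b)      ≤⟨ ^-monoʳ-≤ B (n≤1+n (a + b)) ⟩
        B ^ suc (a + b)  ∎
        where open ≤-Reasoning
      bin≤B^ minus {x} {y} a b x≤ y≤ = begin
        x ∸ y            ≤⟨ m∸n≤m x y ⟩
        x                ≤⟨ x≤ ⟩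
        B ^ a            ≤⟨ ^-monoʳ-≤ B (≤-trans (m≤m+n a b) (n≤1+n _)) ⟩
        B ^ suc (a + b)  ∎
        where open ≤-Reasoning

      val≤B^deg : ∀ env e → (∀ r → env r ≤ B) → val env e ≤ B ^ deg e
      val≤B^deg env (var r)     small = ≤-trans (small r) (≤-reflexive (sym (*-identityʳ B)))
      val≤B^deg env (lit c)     small = lit≤B^ c
      val≤B^deg env (bin o a b) small =
        bin≤B^ o (deg a) (deg b) (val≤B^deg env a small) (val≤B^deg env b small)
      val≤B^deg env (cell A e)  small = ≤-trans (input≤1 A _) (1≤B^ (deg e))

  -- Register 32 is shared by nested loops. It is computed afresh after each round, so a loop inside
  -- the body may overwrite it; only the counter k has to survive the body.
  for : Reg → Reg → Program → Program
  for k m body = const k 0 ⨾ op lt 32 k m ⨾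
    whileNZ 32 loop (body ⨾ const 32 1 ⨾ op add k k 32 ⨾ op lt 32 k m)

  -- A Hoare logic in which the precondition and the postcondition of a program
  -- list the values of the first registers and constrain the arrays.
  module Logic (input : Arrays) (w : ℕ) (ρ : ℕ → Bool) (1<2^w : 1 < 2 ^ w) where

    open Expressions input public

    HasInput : Arrays → Set
    HasInput a = ∀ A i → A < 3 → a A i ≡ input A i

    Agree : ℕ → (Reg → ℕ) → State → Set
    Agree m env S = ∀ r → r < m → reg S r ≡ env r

    Holds : List ℕ → State → Set
    Holds ℓ = Agree (length ℓ) (cells 0 ℓ)

    record Triple (ℓ : List ℕ) (P : Arrays → Set) (p : Program) (c : ℕ)
                  (ℓ′ : List ℕ) (Q : Arrays → Set) : Set where
      constructor triple
      field
        run : ∀ S → Holds ℓ S → HasInput (arr S) → P (arr S) →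
          ∃[ t ] ∃[ S′ ] Eval w ρ p S t S′ × t ≤ c ×
            Holds ℓ′ S′ × HasInput (arr S′) × Q (arr S′)

    open Triple public

    seqT : ∀ {ℓ P p c ℓ′ Q q c′ ℓ″ R} → Triple ℓ P p c ℓ′ Q → Triple ℓ′ Q q c′ ℓ″ R →
           Triple ℓ P (p ⨾ q) (c + c′) ℓ″ R
    seqT f g .run S h i x =
      let t , S′ , e , t≤ , h′ , i′ , y = f .run S h i x
          t′ , S″ , e′ , t′≤ , h″ , i″ , z = g .run S′ h′ i′ y
      in t + t′ , S″ , e ⨾ e′ , +-mono-≤ t≤ t′≤ , h″ , i″ , z

    weakenT : ∀ {ℓ P p c c′ ℓ′ Q P′ Q′} → (∀ a → P′ a → P a) → (∀ a → Q a → Q′ a) → c ≤ c′ →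
              Triple ℓ P p c ℓ′ Q → Triple ℓ P′ p c′ ℓ′ Q′
    weakenT pre post c≤ f .run S h i x =
      let t , S′ , e , t≤ , h′ , i′ , y = f .run S h i (pre _ x)
      in t , S′ , e , ≤-trans t≤ c≤ , h′ , i′ , post _ y

    Holds-pop : ∀ ℓ v {S} → Holds (ℓ ∷ʳ v) S → Holds ℓ S
    Holds-pop ℓ v h r r<l =
      trans (h r (≤-trans r<l (≤-trans (m≤m+n _ 1) (≤-reflexive (sym (List.length-++ ℓ))))))
            (cells-++ˡ ℓ (v ∷ []) r<l)

    Holds-push : ∀ ℓ {v S} → Holds ℓ S → reg S (length ℓ) ≡ v → Holds (ℓ ∷ʳ v) S
    Holds-push ℓ {v} h equ r r< with m≤n⇒m<n∨m≡n (s≤s⁻¹ (subst (r <_) (trans (List.length-++ ℓ) (+-comm _ 1)) r<))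
    ... | inj₁ r<l  = trans (h r r<l) (sym (cells-++ˡ ℓ (v ∷ []) r<l))
    ... | inj₂ refl = trans equ (sym (cells-∷ʳ ℓ v))

    popT : ∀ {ℓ P p c ℓ′ Q v} → Triple ℓ P p c (ℓ′ ∷ʳ v) Q → Triple ℓ P p c ℓ′ Q
    popT {ℓ′ = ℓ′} {v = v} f .run S h i x =
      let t , S′ , e , t≤ , h′ , i′ , y = f .run S h i x
      in t , S′ , e , t≤ , Holds-pop ℓ′ v {S′} h′ , i′ , y

    -- No evaluation rule applies to a result that is too large for a word, so every intermediate
    -- value is included.
    Fits : (Reg → ℕ) → Expr → Set
    Fits env e@(var r)     = env r < 2 ^ w
    Fits env e@(lit c)     = c < 2 ^ w
    Fits env e@(bin o a b) = Fits env a × Fits env b × val env e < 2 ^ w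
    Fits env e@(cell A a)  = Fits env a

    place-frame : ∀ {m} e k → T (varsBelow m e) → m ≤ 64 → place e k < 64 + suc k
    place-frame {m} (var r) k r<m m≤64 = ≤-trans (<ᵇ⇒< r m r<m) (≤-trans m≤64 (m≤m+n 64 (suc k)))
    place-frame (lit _)     k _ _ = ≤-reflexive (sym (+-suc 64 k))
    place-frame (bin _ _ _) k _ _ = ≤-reflexive (sym (+-suc 64 k))
    place-frame (cell _ _)  k _ _ = ≤-reflexive (sym (+-suc 64 k))

    Outcome : Program → ℕ → Reg → ℕ → ℕ → (Reg → Set) → State → Set
    Outcome p c x v k free S = ∃[ t ] ∃[ S′ ] Eval w ρ p S t S′ × t ≤ c × reg S′ x ≡ v ×
      (∀ r → r < 64 + k → free r → reg S′ r ≡ reg S r) × arr S′ ≡ arr S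

    Any : Reg → Set
    Any r = ⊤

    module _ {m} {env : Reg → ℕ} (m≤64 : m ≤ 64) where

      agree-after : ∀ k {S S′} → (∀ r → r < 64 + k → Any r → reg S′ r ≡ reg S r) →
                    Agree m env S → Agree m env S′
      agree-after k same ag r r<m =
        trans (same r (≤-trans r<m (≤-trans m≤64 (m≤m+n 64 k))) tt) (ag r r<m)

      mutual
        -- The temporaries form a stack: evaluation at depth k leaves the registers below `64 + k`
        -- alone, except for the target x. Hence the first operand, stored at depth k, survives the
        -- evaluation of the second one at depth `suc k`.
        assign-run : ∀ x e k S → T (varsBelow m e) → Fits env e → Agree m env S → HasInput (arr S) →
                     Outcome (assign x e k) (size e) x (val env e) k (x ≢_) S
        assign-run x (var r) k S r<m fits ag inp =
          2 , setReg x _ S₀ , const (<-trans z<s 1<2^w) ⨾ op (subst (_< 2 ^ w) (sym value) fits) ,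
          ≤-refl , trans (reg-set S₀ x _) value ,
          (λ q q< x≢q → trans (reg-set-other S₀ _ x≢q) (reg-set-other S 0 (>⇒≢ q<))) , refl
          where
          r< = <ᵇ⇒< r m r<m
          S₀ = setReg (64 + k) 0 S
          value : reg S₀ r + reg S₀ (64 + k) ≡ env r
          value = trans (cong₂ _+_
            (trans (reg-set-other S 0 (>⇒≢ (≤-trans r< (≤-trans m≤64 (m≤m+n 64 k))))) (ag r r<))
            (reg-set S (64 + k) 0)) (+-identityʳ _)
        assign-run x (lit c) k S _ fits ag inp =
          1 , _ , const fits , ≤-refl , reg-set S x c ,
          (λ q q< x≢q → reg-set-other S c x≢q) , refl
        assign-run x (bin o a b) k S below (fa , fb , fab) ag inp
          with ba , bb ← T-∧ (varsBelow m a) below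
          with t₁ , S₁ , e₁ , t₁≤ , v₁ , same₁ , arr₁ ← operand-run a k S ba fa ag inp
          with t₂ , S₂ , e₂ , t₂≤ , v₂ , same₂ , arr₂ ←
                 operand-run b (suc k) S₁ bb fb (agree-after k {S} {S₁} same₁ ag) (subst HasInput (sym arr₁) inp)
          = t₁ + (t₂ + 1) , _ , e₁ ⨾ e₂ ⨾ op (subst (_< 2 ^ w) (sym value) fab) ,
            +-mono-≤ t₁≤ (+-mono-≤ t₂≤ ≤-refl) ,
            trans (reg-set S₂ x _) value ,
            (λ q q< x≢q → trans (reg-set-other S₂ _ x≢q)
               (trans (same₂ q (≤-trans q< (+-monoʳ-≤ 64 (n≤1+n k))) tt) (same₁ q q< tt))) ,
            trans arr₂ arr₁
          where
          value : ⟦ opcode o ⟧ (reg S₂ (place a k)) (reg S₂ (place b (suc k))) ≡ val env (bin o a b)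
          value = cong₂ ⟦ opcode o ⟧ (trans (same₂ (place a k) (place-frame a k ba m≤64) tt) v₁) v₂
        assign-run x (cell A e) k S below fits ag inp
          with bA , be ← T-∧ (A <ᵇ 3) below
          with t₁ , S₁ , e₁ , t₁≤ , v₁ , same₁ , arr₁ ← operand-run e k S be fits ag inp
          = t₁ + 1 , _ , e₁ ⨾ load , +-mono-≤ t₁≤ ≤-refl ,
            trans (reg-set S₁ x _) (trans (cong₂ (λ a i → a A i) arr₁ v₁) (inp A _ (<ᵇ⇒< A 3 bA))) ,
            (λ q q< x≢q → trans (reg-set-other S₁ _ x≢q) (same₁ q q< tt)) , arr₁

        operand-run : ∀ e k S → T (varsBelow m e) → Fits env e → Agree m env S → HasInput (arr S) →
                      Outcome (operand e k) (size e) (place e k) (val env e) k Any S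
        operand-run (var r) k S r<m fits ag inp =
          1 , S , skip , s≤s z≤n , ag r (<ᵇ⇒< r m r<m) , (λ _ _ _ → refl) , refl
        operand-run e@(lit _)     k S = fresh e k S
        operand-run e@(bin _ _ _) k S = fresh e k S
        operand-run e@(cell _ _)  k S = fresh e k S

        private
          fresh : ∀ e k S → T (varsBelow m e) → Fits env e → Agree m env S → HasInput (arr S) →
                  Outcome (assign (temporary k) e k) (size e) (temporary k) (val env e) k Any S
          fresh e k S be fits ag inp
            with t , S′ , ev , t≤ , v , same , ar ← assign-run (temporary k) e k S be fits ag inp
            = t , S′ , ev , t≤ , v , (λ r r< _ → same r r< (>⇒≢ r<)) , ar

    letT : ∀ ℓ P e → length ℓ ≤ 64 → T (varsBelow (length ℓ) e) → Fits (cells 0 ℓ) e →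
           Triple ℓ P (assign (length ℓ) e 0) (size e) (ℓ ∷ʳ val (cells 0 ℓ) e) P
    letT ℓ P e ≤64 below fits .run S h i x
      with t , S′ , ev , t≤ , v , same , ar ← assign-run {length ℓ} {cells 0 ℓ} ≤64 (length ℓ) e 0 S below fits h i
      = t , S′ , ev , t≤ ,
        Holds-push ℓ {S = S′} (λ r r< → trans (same r (≤-trans r< ≤64) (>⇒≢ r<)) (h r r<)) v ,
        subst HasInput (sym ar) i , subst P (sym ar) x

    bit<2^w : ∀ b → bit b < 2 ^ w
    bit<2^w true  = 1<2^w
    bit<2^w false = <-trans z<s 1<2^w

    module _ (ℓ : List ℕ) (m : Reg) (I : ℕ → Arrays → Set) (body : Program) (c : ℕ → ℕ)
             (ℓ<32 : length ℓ < 32) (m<ℓ : m < length ℓ)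
             (M<2^w : cells 0 ℓ m < 2 ^ w)
             (bodyT : ∀ i → i < cells 0 ℓ m → Triple (ℓ ∷ʳ i) (I i) body (c i) (ℓ ∷ʳ i) (I (suc i)))
             where

      private
        M k : ℕ
        M = cells 0 ℓ m
        k = length ℓ

        holds-set : ∀ {S} x v → length ℓ ≤ x → Holds ℓ S → Holds ℓ (setReg x v S)
        holds-set {S} x v k≤x h r r<k = trans (reg-set-other S v (>⇒≢ (≤-trans r<k k≤x))) (h r r<k)

        test-holds : ∀ {S} i → Holds ℓ S → reg S k ≡ i → ⟦ lt ⟧ (reg S k) (reg S m) ≡ bit (i <ᵇ M)
        test-holds i h k≡ = cong₂ (λ x y → bit (x <ᵇ y)) k≡ (h m m<ℓ)

        bit≢0 : ∀ {i} → i < M → bit (i <ᵇ M) ≢ 0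
        bit≢0 {i} i<M equ with i <ᵇ M | <⇒<ᵇ i<M
        bit≢0 {i} i<M () | true | _

        bit≡0 : ∀ {i} → M ≤ i → bit (i <ᵇ M) ≡ 0
        bit≡0 {i} M≤i with i <ᵇ M in equ
        ... | false = refl
        ... | true  = contradiction (<ᵇ⇒< i M (subst T (sym equ) tt)) (≤⇒≯ M≤i)

        loop : Program
        loop = whileNZ 32 loop (body ⨾ const 32 1 ⨾ op add k k 32 ⨾ op lt 32 k m)

        iterate : ∀ n i → i + n ≡ M → ∀ S → Holds ℓ S → HasInput (arr S) → I i (arr S) →
          reg S k ≡ i → reg S 32 ≡ bit (i <ᵇ M) →
          ∃[ t ] ∃[ S′ ] Eval w ρ loop S t S′ × t ≤ 1 + sumUpTo (λ j → c (i + j) + 4) n ×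
            Holds ℓ S′ × HasInput (arr S′) × I M (arr S′)
        iterate zero i equ S h inp x k≡ test =
          1 , S , whileFalse (trans test (bit≡0 (≤-reflexive (trans (sym equ) (+-identityʳ i))))) ,
          ≤-refl , h , inp , subst (λ j → I j (arr S)) (trans (sym (+-identityʳ i)) equ) x
        iterate (suc n) i equ S h inp x k≡ test
          with i<M ← subst (i <_) equ (m<m+n i z<s)
          with t₁ , S₁ , e₁ , t₁≤ , h₁ , inp₁ , x₁ ← bodyT i i<M .run S (Holds-push ℓ {S = S} h k≡) inp x
          = 1 + (t₁ + 3 + t₂) , S₂ ,
            whileTrue (λ z → bit≢0 i<M (trans (sym test) z))
              (e₁ ⨾ const 1<2^w ⨾ op (subst (_< 2 ^ w) (sym sum≡) (≤-trans (s≤s i<M) M<2^w)) ⨾ op (bit<2^w _)) e₂ ,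
            s≤s time ,
            h₂ , inp₂ , x₂
          where
          Sₐ Sᵦ S₃ : State
          Sₐ = setReg 32 1 S₁
          Sᵦ = setReg k (reg Sₐ k + reg Sₐ 32) Sₐ
          S₃ = setReg 32 (⟦ lt ⟧ (reg Sᵦ k) (reg Sᵦ m)) Sᵦ
          hᵦ : Holds ℓ Sᵦ
          hᵦ = holds-set {Sₐ} k _ ≤-refl (holds-set {S₁} 32 1 (<⇒≤ ℓ<32) (Holds-pop ℓ i {S₁} h₁))
          sum≡ : reg Sₐ k + reg Sₐ 32 ≡ suc i
          sum≡ = trans (cong (_+ 1) (trans (reg-set-other S₁ 1 (>⇒≢ ℓ<32))
                   (trans (h₁ k (≤-reflexive (sym (trans (List.length-++ ℓ) (+-comm _ 1))))) (cells-∷ʳ ℓ i))))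
                   (+-comm i 1)
          kᵦ : reg Sᵦ k ≡ suc i
          kᵦ = trans (reg-set Sₐ k _) sum≡
          rest = iterate n (suc i) (trans (sym (+-suc i n)) equ) S₃
            (holds-set {Sᵦ} 32 _ (<⇒≤ ℓ<32) hᵦ) inp₁ x₁
            (trans (reg-set-other Sᵦ _ (>⇒≢ ℓ<32)) kᵦ)
            (test-holds {Sᵦ} (suc i) hᵦ kᵦ)
          t₂ = proj₁ rest
          S₂ = proj₁ (proj₂ rest)
          e₂ = proj₁ (proj₂ (proj₂ rest))
          t₂≤ = proj₁ (proj₂ (proj₂ (proj₂ rest)))
          h₂ = proj₁ (proj₂ (proj₂ (proj₂ (proj₂ rest))))
          inp₂ = proj₁ (proj₂ (proj₂ (proj₂ (proj₂ (proj₂ rest)))))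
          x₂ = proj₂ (proj₂ (proj₂ (proj₂ (proj₂ (proj₂ rest)))))
          sumUpTo-cong : ∀ {f g : ℕ → ℕ} n → (∀ j → f j ≡ g j) → sumUpTo f n ≡ sumUpTo g n
          sumUpTo-cong zero    f≡g = refl
          sumUpTo-cong (suc n) f≡g = cong₂ _+_ (f≡g 0) (sumUpTo-cong n (λ j → f≡g (suc j)))
          time : t₁ + 3 + t₂ ≤ c (i + 0) + 4 + sumUpTo (λ j → c (i + suc j) + 4) n
          time = begin
            t₁ + 3 + t₂         ≤⟨ +-mono-≤ (+-monoˡ-≤ 3 t₁≤) t₂≤ ⟩
            c i + 3 + (1 + sumUpTo (λ j → c (suc i + j) + 4) n)
              ≡⟨ (let r = sumUpTo (λ j → c (suc i + j) + 4) n in assoc (c i) r) ⟩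
            c i + 4 + sumUpTo (λ j → c (suc i + j) + 4) n
              ≡⟨ cong₂ (λ x y → c x + 4 + y) (+-identityʳ i)
                   (sumUpTo-cong n (λ j → cong (λ x → c x + 4) (+-suc i j))) ⟨
            c (i + 0) + 4 + sumUpTo (λ j → c (i + suc j) + 4) n ∎
            where
            open ≤-Reasoning
            assoc : ∀ x r → x + 3 + (1 + r) ≡ x + 4 + r
            assoc = solve-∀

      -- In each round the test and three instructions are added to the body. The constant 3 pays
      -- for the initial counter, the first comparison and the failing test.
      forT : Triple ℓ (I 0) (for (length ℓ) m body) (3 + sumUpTo (λ j → c j + 4) M) ℓ (I M)
      forT .run S h inp x =
        let S₁ = setReg k 0 S
            h₁ = holds-set {S} k 0 ≤-refl h
            k₁ = reg-set S k 0
            S₂ = setReg 32 (⟦ lt ⟧ (reg S₁ k) (reg S₁ m)) S₁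
            t , S₃ , e , t≤ , rest = iterate M 0 refl S₂ (holds-set {S₁} 32 _ (<⇒≤ ℓ<32) h₁) inp x
              (trans (reg-set-other S₁ _ (>⇒≢ ℓ<32)) k₁) (test-holds {S₁} 0 h₁ k₁)
        in _ , S₃ , const (<-trans z<s 1<2^w) ⨾ op (bit<2^w _) ⨾ e , s≤s (s≤s t≤) , rest

  -- Simulation with versioned memory

  -- The simulated registers and arrays are both kept in arrays, a register
  -- being an array of which only cell 0 is used.  Each of these has a base
  -- version, an overlay, and a stamp saying in which phase the overlay was
  -- written.  Incrementing the phase number thus undoes all changes.
  data Kind : Set where
    register array : Kind

  offset : Kind → ℕ
  offset register = 0
  offset array    = 3

  -- Three versions for each of two kinds give six interleaved families, told apart modulo 6. Arrays
  -- 0 to 3 stay free for the input and for the accumulated answer.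
  slot : ℕ → ℕ → Arr
  slot c x = 4 + (c + x * 6)

  stamp overlay base : Kind → ℕ → Arr
  stamp   κ x = slot (offset κ) x
  overlay κ x = slot (1 + offset κ) x
  base    κ x = slot (2 + offset κ) x

  slot-injective : ∀ c c′ {x x′} → c < 6 → c′ < 6 → slot c x ≡ slot c′ x′ → c ≡ c′ × x ≡ x′
  slot-injective c c′ {x} {x′} c<6 c′<6 eq₀
    with eq₁ ← +-cancelˡ-≡ 4 (c + x * 6) (c′ + x′ * 6) eq₀
    with refl ← trans (sym (m<n⇒m%n≡m c<6)) (trans (sym ([m+kn]%n≡m%n c x 6))
                  (trans (cong (_% 6) eq₁) (trans ([m+kn]%n≡m%n c′ x′ 6) (m<n⇒m%n≡m c′<6))))
    = refl , *-cancelʳ-≡ x x′ 6 (+-cancelˡ-≡ c _ _ eq₁)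

  -- The version register is register 13.
  look : ℕ → Arrays → Kind → ℕ → ℕ → ℕ
  look J a κ x i = if a (stamp κ x) i ≡ᵇ J then a (overlay κ x) i else a (base κ x) i

  Represents : ℕ → State → Arrays → Set
  Represents J s a = (∀ x → reg s x ≡ look J a register x 0) ×
                     (∀ A i → arr s A i ≡ look J a array A i)

  -- Calling convention: register 41 passes the index, register 42 the value to be written, and
  -- register 40 is scratch.
  read : Kind → ℕ → Reg → Program
  read κ x v = load 40 (stamp κ x) 41 ⨾ op eq 40 40 13 ⨾
    ifNZ 40 then load v (overlay κ x) 41 else load v (base κ x) 41

  -- Preprocessing writes to the base, so its effect is permanent. Requests write to the overlay,
  -- where the stamp limits the effect to the current phase.
  writeOverlay writeBase : Kind → ℕ → Program
  writeOverlay κ x = store (overlay κ x) 41 42 ⨾ store (stamp κ x) 41 13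
  writeBase    κ x = store (base κ x) 41 42

  module _ (write : Kind → ℕ → Program) where

    readRegister : Reg → Reg → Program
    readRegister x v = const 41 0 ⨾ read register x v

    translate : Program → Program
    translate skip         = skip
    translate (const x v)  = const 42 v ⨾ const 41 0 ⨾ write register x
    translate (op o x y z) = readRegister y 42 ⨾ readRegister z 43 ⨾ op o 42 42 43 ⨾ write register x
    translate (load x A i) = readRegister i 41 ⨾ read array A 42 ⨾ const 41 0 ⨾ write register x
    translate (store A i x) = readRegister x 42 ⨾ readRegister i 41 ⨾ write array A
    translate (coin x i) = readRegister i 42 ⨾ coin 42 42 ⨾ write register x
    translate (p ⨾ q) = translate p ⨾ translate q
    translate (ifNZ x then p else q) = readRegister x 42 ⨾ ifNZ 42 then translate p else translate q
    translate (whileNZ x loop p) =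
      readRegister x 42 ⨾ whileNZ 42 loop (translate p ⨾ readRegister x 42)

  setCellA : Arr → ℕ → ℕ → Arrays → Arrays
  setCellA A i v a = update a A (update (a A) i v)

  setCellA-same : ∀ a A i v → setCellA A i v a A i ≡ v
  setCellA-same a A i v = trans (cong (λ f → f i) (update-same a A _)) (update-same (a A) i v)

  setCellA-other : ∀ a A i v A′ i′ → A ≢ A′ → setCellA A i v a A′ i′ ≡ a A′ i′
  setCellA-other a A i v A′ i′ A≢A′ = cong (λ f → f i′) (update-other a _ A≢A′)

  setCellA-other-index : ∀ a A i v i′ → i ≢ i′ → setCellA A i v a A i′ ≡ a A i′
  setCellA-other-index a A i v i′ i≢i′ =
    trans (cong (λ f → f i′) (update-same a A _)) (update-other (a A) v i≢i′)

  put : (κ : Kind) (x i v : ℕ) → (Kind → ℕ → ℕ → ℕ) → (Kind → ℕ → ℕ → ℕ)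
  put register x i v m register x′ i′ = update (m register) x (update (m register x) i v) x′ i′
  put register x i v m array    x′ i′ = m array x′ i′
  put array    x i v m array    x′ i′ = update (m array) x (update (m array x) i v) x′ i′
  put array    x i v m register x′ i′ = m register x′ i′

  put-same : ∀ κ x i v m → put κ x i v m κ x i ≡ v
  put-same register x i v m = setCellA-same (m register) x i v
  put-same array    x i v m = setCellA-same (m array) x i v

  put-other : ∀ κ x i v m κ′ x′ i′ → ¬ (κ ≡ κ′ × x ≡ x′ × i ≡ i′) → put κ x i v m κ′ x′ i′ ≡ m κ′ x′ i′
  put-other register x i v m array    x′ i′ ne = refl
  put-other array    x i v m register x′ i′ ne = refl
  put-other register x i v m register x′ i′ ne with x ≟ x′
  ... | no x≢ = setCellA-other (m register) x i v x′ i′ x≢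
  ... | yes refl = setCellA-other-index (m register) x i v i′ (λ i≡ → ne (refl , refl , i≡))
  put-other array x i v m array x′ i′ ne with x ≟ x′
  ... | no x≢ = setCellA-other (m array) x i v x′ i′ x≢
  ... | yes refl = setCellA-other-index (m array) x i v i′ (λ i≡ → ne (refl , refl , i≡))

  offset≤3 : ∀ κ → offset κ ≤ 3
  offset≤3 register = z≤n
  offset≤3 array    = ≤-refl

  offset-injective : ∀ c → c ≤ 2 → ∀ c′ → c′ ≤ 2 → ∀ κ κ′ → c + offset κ ≡ c′ + offset κ′ → c ≡ c′ × κ ≡ κ′
  offset-injective c _ c′ _ register register e = trans (sym (+-identityʳ c)) (trans e (+-identityʳ c′)) , refl
  offset-injective c _ c′ _ array array e = +-cancelʳ-≡ 3 c c′ e , refl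
  offset-injective c c≤ c′ _ register array e =
    contradiction (subst (3 ≤_) (trans (sym e) (+-identityʳ c)) (m≤n+m 3 c′)) (<⇒≱ (s≤s c≤))
  offset-injective c _ c′ c′≤ array register e =
    contradiction (subst (3 ≤_) (trans e (+-identityʳ c′)) (m≤n+m 3 c)) (<⇒≱ (s≤s c′≤))

  -- The c-th version (0 stamp, 1 overlay, 2 base) of a simulated array.
  version : ℕ → Kind → ℕ → Arr
  version c κ x = slot (c + offset κ) x

  version-injective : ∀ c → c ≤ 2 → ∀ c′ → c′ ≤ 2 → ∀ {κ κ′ x x′} → version c κ x ≡ version c′ κ′ x′ →
                      c ≡ c′ × κ ≡ κ′ × x ≡ x′
  version-injective c c≤ c′ c′≤ {κ} {κ′} e
    with e₁ , e₂ ← slot-injective (c + offset κ) (c′ + offset κ′)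
                     (s≤s (+-mono-≤ c≤ (offset≤3 κ))) (s≤s (+-mono-≤ c′≤ (offset≤3 κ′))) e
    with refl , refl ← offset-injective c c≤ c′ c′≤ κ κ′ e₁ = refl , refl , e₂

  version≥4 : ∀ c κ x {A} → A < 4 → version c κ x ≢ A
  version≥4 c κ x A<4 refl = <⇒≱ A<4 (m≤m+n 4 _)

  _≟κ_ : (κ κ′ : Kind) → Dec (κ ≡ κ′)
  register ≟κ register = yes refl
  register ≟κ array    = no λ ()
  array    ≟κ register = no λ ()
  array    ≟κ array    = yes refl

  cell? : ∀ (κ κ′ : Kind) (x x′ i i′ : ℕ) → Dec (κ ≡ κ′ × x ≡ x′ × i ≡ i′)
  cell? κ κ′ x x′ i i′ = (κ ≟κ κ′) ×-dec (x ≟ x′) ×-dec (i ≟ i′)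

  setVersion-other : ∀ a c → c ≤ 2 → ∀ κ x i v c′ → c′ ≤ 2 → ∀ κ′ x′ i′ →
    ¬ (c ≡ c′ × κ ≡ κ′ × x ≡ x′ × i ≡ i′) →
    setCellA (version c κ x) i v a (version c′ κ′ x′) i′ ≡ a (version c′ κ′ x′) i′
  setVersion-other a c c≤ κ x i v c′ c′≤ κ′ x′ i′ ne with version c κ x ≟ version c′ κ′ x′
  ... | no ≢ = setCellA-other a (version c κ x) i v (version c′ κ′ x′) i′ ≢
  ... | yes e with refl , refl , refl ← version-injective c c≤ c′ c′≤ {κ} {κ′} {x} {x′} e =
    setCellA-other-index a (version c κ x) i v i′ λ i≡i′ → ne (refl , refl , refl , i≡i′)

  overlayEffect baseEffect : ℕ → Arrays → Kind → ℕ → ℕ → ℕ → Arrays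
  overlayEffect J a κ x i v = setCellA (stamp κ x) i J (setCellA (overlay κ x) i v a)
  baseEffect    J a κ x i v = setCellA (base κ x) i v a

  stamp-overlayEffect : ∀ J a κ x i v κ′ x′ i′ → ¬ (κ ≡ κ′ × x ≡ x′ × i ≡ i′) →
    overlayEffect J a κ x i v (stamp κ′ x′) i′ ≡ a (stamp κ′ x′) i′
  stamp-overlayEffect J a κ x i v κ′ x′ i′ ne = trans
    (setVersion-other (setCellA (overlay κ x) i v a) 0 z≤n κ x i J 0 z≤n κ′ x′ i′ λ (_ , n) → ne n)
    (setVersion-other a 1 (s≤s z≤n) κ x i v 0 z≤n κ′ x′ i′ λ ())

  base-overlayEffect : ∀ J a κ x i v κ′ x′ i′ →
    overlayEffect J a κ x i v (base κ′ x′) i′ ≡ a (base κ′ x′) i′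
  base-overlayEffect J a κ x i v κ′ x′ i′ = trans
    (setVersion-other (setCellA (overlay κ x) i v a) 0 z≤n κ x i J 2 ≤-refl κ′ x′ i′ λ ())
    (setVersion-other a 1 (s≤s z≤n) κ x i v 2 ≤-refl κ′ x′ i′ λ ())

  look-overlayEffect : ∀ J a κ x i v κ′ x′ i′ →
    look J (overlayEffect J a κ x i v) κ′ x′ i′ ≡ put κ x i v (look J a) κ′ x′ i′
  look-overlayEffect J a κ x i v κ′ x′ i′ with cell? κ κ′ x x′ i i′
  ... | yes (refl , refl , refl)
    rewrite setCellA-same (setCellA (overlay κ x) i v a) (stamp κ x) i J
          | ≡ᵇ-refl J
          | setVersion-other (setCellA (overlay κ x) i v a) 0 z≤n κ x i J 1 (s≤s z≤n) κ x i (λ ())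
          | setCellA-same a (overlay κ x) i v = sym (put-same κ x i v (look J a))
  ... | no ne
    rewrite stamp-overlayEffect J a κ x i v κ′ x′ i′ ne
          | setVersion-other (setCellA (overlay κ x) i v a) 0 z≤n κ x i J 1 (s≤s z≤n) κ′ x′ i′ (λ ())
          | setVersion-other a 1 (s≤s z≤n) κ x i v 1 (s≤s z≤n) κ′ x′ i′ (λ (_ , n) → ne n)
          | base-overlayEffect J a κ x i v κ′ x′ i′ = sym (put-other κ x i v (look J a) κ′ x′ i′ ne)

  stamp-baseEffect : ∀ J a κ x i v κ′ x′ i′ →
    baseEffect J a κ x i v (stamp κ′ x′) i′ ≡ a (stamp κ′ x′) i′
  stamp-baseEffect J a κ x i v κ′ x′ i′ = setVersion-other a 2 ≤-refl κ x i v 0 z≤n κ′ x′ i′ λ ()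

  Unstamped : ℕ → Arrays → Set
  Unstamped J a = ∀ κ x i → (a (stamp κ x) i ≡ᵇ J) ≡ false

  look-unstamped : ∀ J a → Unstamped J a → ∀ κ x i → look J a κ x i ≡ a (base κ x) i
  look-unstamped J a un κ x i rewrite un κ x i = refl

  unstamped-baseEffect : ∀ J a κ x i v → Unstamped J a → Unstamped J (baseEffect J a κ x i v)
  unstamped-baseEffect J a κ x i v un κ′ x′ i′ =
    trans (cong (_≡ᵇ J) (stamp-baseEffect J a κ x i v κ′ x′ i′)) (un κ′ x′ i′)

  look-baseEffect : ∀ J a κ x i v → Unstamped J a → ∀ κ′ x′ i′ →
    look J (baseEffect J a κ x i v) κ′ x′ i′ ≡ put κ x i v (look J a) κ′ x′ i′
  look-baseEffect J a κ x i v un κ′ x′ i′ =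
    trans (look-unstamped J (baseEffect J a κ x i v) (unstamped-baseEffect J a κ x i v un) κ′ x′ i′)
      (effect (cell? κ κ′ x x′ i i′))
    where
    effect : Dec (κ ≡ κ′ × x ≡ x′ × i ≡ i′) →
             baseEffect J a κ x i v (base κ′ x′) i′ ≡ put κ x i v (look J a) κ′ x′ i′
    effect (yes (refl , refl , refl)) =
      trans (setCellA-same a (base κ x) i v) (sym (put-same κ x i v (look J a)))
    effect (no ne) = trans
      (setVersion-other a 2 ≤-refl κ x i v 2 ≤-refl κ′ x′ i′ λ (_ , n) → ne n)
      (sym (trans (put-other κ x i v (look J a) κ′ x′ i′ ne) (look-unstamped J a un κ′ x′ i′)))

  -- Abstracts from the two ways of writing, so that one simulation proof serves preprocessing and
  -- requests alike. The program may depend on the memory only through `look`.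
  record Writer (J : ℕ) : Set₁ where
    field
      write     : Kind → ℕ → Program
      effect    : Arrays → Kind → ℕ → ℕ → ℕ → Arrays
      Inv       : Arrays → Set
      Inv-write : ∀ a κ x i v → Inv a → Inv (effect a κ x i v)
      look-write : ∀ a κ x i v → Inv a → ∀ κ′ x′ i′ →
        look J (effect a κ x i v) κ′ x′ i′ ≡ put κ x i v (look J a) κ′ x′ i′
      write-run : ∀ {w ρ} κ x S → reg S 13 ≡ J →
        ∃[ t ] Eval w ρ (write κ x) S t ⟨ reg S , effect (arr S) κ x (reg S 41) (reg S 42) ⟩ × t ≤ 2

  Represents-setReg : ∀ {J s a a′ x v} → Represents J s a →
    (∀ κ′ x′ i′ → look J a′ κ′ x′ i′ ≡ put register x 0 v (look J a) κ′ x′ i′) →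
    Represents J (setReg x v s) a′
  Represents-setReg {J} {s} {a} {a′} {x} {v} (rr , ra) eff = rr′ , λ A i → trans (ra A i) (sym (eff array A i))
    where
    rr′ : ∀ x′ → reg (setReg x v s) x′ ≡ look J a′ register x′ 0
    rr′ x′ with x ≟ x′
    ... | yes refl = trans (reg-set s x v) (sym (trans (eff register x 0) (put-same register x 0 v (look J a))))
    ... | no x≢x′ = trans (reg-set-other s v x≢x′) (trans (rr x′)
      (sym (trans (eff register x′ 0) (put-other register x 0 v (look J a) register x′ 0 λ (_ , e , _) → x≢x′ e))))

  Represents-setCell : ∀ {J s a a′ A i v} → Represents J s a →
    (∀ κ′ x′ i′ → look J a′ κ′ x′ i′ ≡ put array A i v (look J a) κ′ x′ i′) →
    Represents J (setCell A i v s) a′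
  Represents-setCell {J} {s} {a} {a′} {A} {i} {v} (rr , ra) eff =
    (λ x → trans (rr x) (sym (eff register x 0))) , ra′
    where
    ra′ : ∀ A′ i′ → setCellA A i v (arr s) A′ i′ ≡ look J a′ array A′ i′
    ra′ A′ i′ with A ≟ A′ | i ≟ i′
    ... | yes refl | yes refl =
      trans (setCellA-same (arr s) A i v) (sym (trans (eff array A i) (put-same array A i v (look J a))))
    ... | no A≢A′ | _ = trans (setCellA-other (arr s) A i v A′ i′ A≢A′) (trans (ra A′ i′)
      (sym (trans (eff array A′ i′) (put-other array A i v (look J a) array A′ i′ λ (_ , e , _) → A≢A′ e))))
    ... | yes refl | no i≢i′ = trans (setCellA-other-index (arr s) A i v i′ i≢i′) (trans (ra A i′)
      (sym (trans (eff array A i′) (put-other array A i v (look J a) array A i′ λ (_ , _ , e) → i≢i′ e))))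

  -- The simulating machine may have longer words: a result that fits into w bits fits into w′ bits,
  -- and a halting run reads only random bits below `2 ^ w`, where both tapes agree.
  module Simulation {J : ℕ} (W : Writer J) {w w′ : ℕ} {ρ ρ′ : ℕ → Bool}
    (w≤w′ : 2 ^ w ≤ 2 ^ w′) (1<2^w′ : 1 < 2 ^ w′) (ρ≡ρ′ : ∀ i → i < 2 ^ w → ρ i ≡ ρ′ i) where

    open Writer W

    -- The registers below 32 belong to the simulating program.
    _≈_ : State → State → Set
    S ≈ S′ = ∀ r → r < 32 → reg S′ r ≡ reg S r

    ≈-trans : ∀ {S S′ S″} → S ≈ S′ → S′ ≈ S″ → S ≈ S″
    ≈-trans p q r r< = trans (q r r<) (p r r<)

    Simulates : State → State → Set
    Simulates s S = Represents J s (arr S) × Inv (arr S) × reg S 13 ≡ J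

    0<2^w′ : 0 < 2 ^ w′
    0<2^w′ = <-trans z<s 1<2^w′

    ≈-set : ∀ {S S′} x v → 32 ≤ x → S ≈ S′ → S ≈ setReg x v S′
    ≈-set {S} {S′} x v 32≤x p r r<32 = trans (reg-set-other S′ v (>⇒≢ (≤-trans r<32 32≤x))) (p r r<32)

    bit<2^w′ : ∀ b → bit b < 2 ^ w′
    bit<2^w′ true  = 1<2^w′
    bit<2^w′ false = 0<2^w′

    afterRead : Kind → ℕ → Reg → State → State
    afterRead κ x v S = setReg v (look J (arr S) κ x (reg S 41))
      (setReg 40 (bit (arr S (stamp κ x) (reg S 41) ≡ᵇ J)) (setReg 40 (arr S (stamp κ x) (reg S 41)) S))

    read-run : ∀ κ x v S → reg S 13 ≡ J →
               ∃[ t ] Eval w′ ρ′ (read κ x v) S t (afterRead κ x v S) × t ≤ 4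
    read-run κ x v S refl = 4 , load ⨾ op (bit<2^w′ _) ⨾ select _ _ refl , ≤-refl
      where
      select : ∀ b S → reg S 40 ≡ bit b →
        Eval w′ ρ′ (ifNZ 40 then load v (overlay κ x) 41 else load v (base κ x) 41) S 2
          (setReg v (if b then arr S (overlay κ x) (reg S 41) else arr S (base κ x) (reg S 41)) S)
      select true  S e = ifTrue (λ z → contradiction (trans (sym e) z) λ ()) load
      select false S e = ifFalse e load

    afterReadRegister : ℕ → Reg → State → State
    afterReadRegister x v S = afterRead register x v (setReg 41 0 S)

    readRegister-run : ∀ x v S → reg S 13 ≡ J →
      ∃[ t ] Eval w′ ρ′ (readRegister write x v) S t (afterReadRegister x v S) × t ≤ 5
    readRegister-run x v S j =
      let t , e , t≤ = read-run register x v (setReg 41 0 S) j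
      in 1 + t , const 0<2^w′ ⨾ e , s≤s t≤

    afterRead-≈ : ∀ κ x v S → 32 ≤ v → S ≈ afterRead κ x v S
    afterRead-≈ κ x v S 32≤v = ≈-set {S} {S₂} v _ 32≤v
      (≈-set {S} {S₁} 40 _ (m≤m+n 32 8) (≈-set {S} {S} 40 _ (m≤m+n 32 8) (λ _ _ → refl)))
      where
      S₁ = setReg 40 (arr S (stamp κ x) (reg S 41)) S
      S₂ = setReg 40 (bit (arr S (stamp κ x) (reg S 41) ≡ᵇ J)) S₁

    afterReadRegister-≈ : ∀ x v S → 32 ≤ v → S ≈ afterReadRegister x v S
    afterReadRegister-≈ x v S 32≤v = ≈-trans {S} {S₁} {afterReadRegister x v S}
      (≈-set {S} {S} 41 0 (m≤m+n 32 9) (λ _ _ → refl)) (afterRead-≈ register x v S₁ 32≤v)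
      where S₁ = setReg 41 0 S

    Simulated : Program → State → State → ℕ → State → Set
    Simulated p s S t s′ = ∃[ t′ ] ∃[ S′ ] Eval w′ ρ′ p S t′ S′ × Simulates s′ S′ × S ≈ S′ × t′ ≤ 20 * t

    -- All simulated assignments end by writing register 42 to a simulated register.
    finish-register : ∀ {s S₀ S x} → Represents J s (arr S) → Inv (arr S) → reg S 13 ≡ J →
      reg S 41 ≡ 0 → S₀ ≈ S →
      ∃[ t ] ∃[ S′ ] Eval w′ ρ′ (write register x) S t S′ × Simulates (setReg x (reg S 42) s) S′ ×
        S₀ ≈ S′ × t ≤ 2
    finish-register {s} {S₀} {S} {x} rep inv j zero₁ near =
      let t , e , t≤ = write-run register x S j
      in t , _ , e ,
         (Represents-setReg {J} {s} {arr S} {effect (arr S) register x (reg S 41) (reg S 42)} rep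
            (λ κ′ x′ i′ → trans (look-write (arr S) register x (reg S 41) (reg S 42) inv κ′ x′ i′)
               (cong (λ i → put register x i (reg S 42) (look J (arr S)) κ′ x′ i′) zero₁)) ,
          Inv-write (arr S) register x (reg S 41) (reg S 42) inv , j) , near , t≤

    branch-time : ∀ {t₁ t₂} t → t₁ ≤ 5 → t₂ ≤ 20 * t → t₁ + suc t₂ ≤ 20 * suc t
    branch-time t p q = ≤-trans (+-mono-≤ p (s≤s q))
      (≤-trans (+-monoˡ-≤ (20 * t) (m≤m+n 6 14)) (≤-reflexive (sym (*-suc 20 t))))

    -- The costliest instruction is `op`: two register reads of five steps, the operation and a
    -- write make 13. The factor 20 is a round bound that also covers the tests of branches and
    -- loops.
    simulate : ∀ {p s t s′} → Eval w ρ p s t s′ → ∀ {S} → Simulates s S →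
               Simulated (translate write p) s S t s′
    simulate skip {S} sim = 1 , S , skip , sim , (λ _ _ → refl) , s≤s z≤n
    simulate {s = s} (const {x = x} {v = v} v<) {S} (rep , inv , j) =
      let S₁ = setReg 42 v S
          S₂ = setReg 41 0 S₁
          t , S′ , e , sim , near , t≤ = finish-register {s} {S} {S₂} {x} rep inv j refl
            (≈-set {S} {S₁} 41 0 (m≤m+n 32 9) (≈-set {S} {S} 42 v (m≤m+n 32 10) (λ _ _ → refl)))
      in _ , S′ , const (<-≤-trans v< w≤w′) ⨾ const 0<2^w′ ⨾ e , sim , near ,
         ≤-trans (s≤s (s≤s t≤)) (m≤m+n 4 16)
    simulate {s = s} (op {o = o} {x} {y} {z} v<) {S} (rep , inv , j) =
      let S₁ = afterReadRegister y 42 S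
          S₂ = afterReadRegister z 43 S₁
          t₁ , e₁ , t₁≤ = readRegister-run y 42 S j
          t₂ , e₂ , t₂≤ = readRegister-run z 43 S₁ j
          same = cong₂ ⟦ o ⟧ (proj₁ rep y) (proj₁ rep z)
          v = ⟦ o ⟧ (look J (arr S) register y 0) (look J (arr S) register z 0)
          S₃ = setReg 42 v S₂
          t₃ , S′ , e₃ , sim , near , t₃≤ = finish-register {s} {S} {S₃} {x} rep inv j refl
            (≈-set {S} {S₂} 42 v (m≤m+n 32 10) (≈-trans {S} {S₁} {S₂}
               (afterReadRegister-≈ y 42 S (m≤m+n 32 10)) (afterReadRegister-≈ z 43 S₁ (m≤m+n 32 11))))
      in _ , S′ , e₁ ⨾ e₂ ⨾ op (<-≤-trans (subst (_< 2 ^ w) same v<) w≤w′) ⨾ e₃ ,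
         subst (λ u → Simulates (setReg x u s) S′) (sym same) sim , near ,
         ≤-trans (+-mono-≤ t₁≤ (+-mono-≤ t₂≤ (s≤s t₃≤))) (m≤m+n 13 7)
    simulate {s = s} (load {x = x} {A} {i}) {S} (rep , inv , j) =
      let S₁ = afterReadRegister i 41 S
          S₂ = afterRead array A 42 S₁
          S₃ = setReg 41 0 S₂
          t₁ , e₁ , t₁≤ = readRegister-run i 41 S j
          t₂ , e₂ , t₂≤ = read-run array A 42 S₁ j
          t₃ , S′ , e₃ , sim , near , t₃≤ = finish-register {s} {S} {S₃} {x} rep inv j refl
            (≈-set {S} {S₂} 41 0 (m≤m+n 32 9) (≈-trans {S} {S₁} {S₂}
               (afterReadRegister-≈ i 41 S (m≤m+n 32 9)) (afterRead-≈ array A 42 S₁ (m≤m+n 32 10))))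
          same = trans (proj₂ rep A (reg s i)) (cong (look J (arr S) array A) (proj₁ rep i))
      in _ , S′ , e₁ ⨾ e₂ ⨾ const 0<2^w′ ⨾ e₃ ,
         subst (λ u → Simulates (setReg x u s) S′) (sym same) sim , near ,
         ≤-trans (+-mono-≤ t₁≤ (+-mono-≤ t₂≤ (s≤s t₃≤))) (m≤m+n 12 8)
    simulate {s = s} (store {A = A} {i} {x}) {S} (rep , inv , j) =
      let S₁ = afterReadRegister x 42 S
          S₂ = afterReadRegister i 41 S₁
          t₁ , e₁ , t₁≤ = readRegister-run x 42 S j
          t₂ , e₂ , t₂≤ = readRegister-run i 41 S₁ j
          t₃ , e₃ , t₃≤ = write-run array A S₂ j
          a′ = effect (arr S) array A (reg S₂ 41) (reg S₂ 42)
          rep′ = Represents-setCell {J} {s} {arr S} {a′} {A} {reg s i} {reg s x} rep λ κ′ x′ i′ →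
            trans (look-write (arr S) array A (reg S₂ 41) (reg S₂ 42) inv κ′ x′ i′)
              (cong₂ (λ k v → put array A k v (look J (arr S)) κ′ x′ i′) (sym (proj₁ rep i)) (sym (proj₁ rep x)))
      in _ , _ , e₁ ⨾ e₂ ⨾ e₃ , (rep′ , Inv-write (arr S) array A (reg S₂ 41) (reg S₂ 42) inv , j) ,
         ≈-trans {S} {S₁} {S₂} (afterReadRegister-≈ x 42 S (m≤m+n 32 10))
           (afterReadRegister-≈ i 41 S₁ (m≤m+n 32 9)) ,
         ≤-trans (+-mono-≤ t₁≤ (+-mono-≤ t₂≤ t₃≤)) (m≤m+n 12 8)
    simulate {s = s} (coin {x = x} {i} i< b<) {S} (rep , inv , j) =
      let S₁ = afterReadRegister i 42 S
          t₁ , e₁ , t₁≤ = readRegister-run i 42 S j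
          same = proj₁ rep i
          v = look J (arr S) register i 0
          v< = subst (_< 2 ^ w) same i<
          S₂ = setReg 42 (bit (ρ′ v)) S₁
          t₂ , S′ , e₂ , sim , near , t₂≤ = finish-register {s} {S} {S₂} {x} rep inv j refl
            (≈-set {S} {S₁} 42 _ (m≤m+n 32 10) (afterReadRegister-≈ i 42 S (m≤m+n 32 10)))
      in _ , S′ , e₁ ⨾ coin (<-≤-trans v< w≤w′) (bit<2^w′ _) ⨾ e₂ ,
         subst (λ u → Simulates (setReg x (bit u) s) S′)
           (sym (trans (cong ρ same) (ρ≡ρ′ v v<))) sim , near ,
         ≤-trans (+-mono-≤ t₁≤ (s≤s t₂≤)) (m≤m+n 8 12)
    simulate (_⨾_ {t = t} {t′} d e) {S} sim =
      let t₁ , S₁ , e₁ , sim₁ , near₁ , t₁≤ = simulate d sim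
          t₂ , S₂ , e₂ , sim₂ , near₂ , t₂≤ = simulate e sim₁
      in _ , S₂ , e₁ ⨾ e₂ , sim₂ , ≈-trans {S} {S₁} {S₂} near₁ near₂ ,
         ≤-trans (+-mono-≤ t₁≤ t₂≤) (≤-reflexive (sym (*-distribˡ-+ 20 t t′)))
    simulate (ifTrue {x = x} {t = t} x≢0 d) {S} (rep , inv , j) =
      let S₁ = afterReadRegister x 42 S
          t₁ , e₁ , t₁≤ = readRegister-run x 42 S j
          t₂ , S₂ , e₂ , sim₂ , near₂ , t₂≤ = simulate d {S₁} (rep , inv , j)
      in _ , S₂ , e₁ ⨾ ifTrue (λ z → x≢0 (trans (proj₁ rep x) z)) e₂ , sim₂ ,
         ≈-trans {S} {S₁} {S₂} (afterReadRegister-≈ x 42 S (m≤m+n 32 10)) near₂ ,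
         branch-time t t₁≤ t₂≤
    simulate (ifFalse {x = x} {t = t} x≡0 d) {S} (rep , inv , j) =
      let S₁ = afterReadRegister x 42 S
          t₁ , e₁ , t₁≤ = readRegister-run x 42 S j
          t₂ , S₂ , e₂ , sim₂ , near₂ , t₂≤ = simulate d {S₁} (rep , inv , j)
      in _ , S₂ , e₁ ⨾ ifFalse (trans (sym (proj₁ rep x)) x≡0) e₂ , sim₂ ,
         ≈-trans {S} {S₁} {S₂} (afterReadRegister-≈ x 42 S (m≤m+n 32 10)) near₂ ,
         branch-time t t₁≤ t₂≤
    simulate (whileTrue {x = x} {t = t} {t′} x≢0 d e) {S} (rep , inv , j)
      with t₁ , e₁ , t₁≤ ← readRegister-run x 42 S j
      with t₂ , S₂ , e₂ , sim₂ , near₂ , t₂≤ ← simulate d {afterReadRegister x 42 S} (rep , inv , j)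
      -- The simulation of the remaining rounds starts by reading the loop register in `e₃`. This
      -- read is regrouped as the end of the round just executed.
      with _ , S₃ , (e₃ ⨾ e₄) , sim₃ , near₃ , t₃≤ ← simulate e sim₂
      = _ , S₃ , e₁ ⨾ whileTrue (λ z → x≢0 (trans (proj₁ rep x) z)) (e₂ ⨾ e₃) e₄ , sim₃ ,
        ≈-trans {S} {S₁} {S₃} (afterReadRegister-≈ x 42 S (m≤m+n 32 10)) (≈-trans {S₁} {S₂} {S₃} near₂ near₃) ,
        time t₁≤ t₂≤ t₃≤
      where
      S₁ = afterReadRegister x 42 S
      time : ∀ {t₁ t₂ u v} → t₁ ≤ 5 → t₂ ≤ 20 * t → u + v ≤ 20 * t′ →
             t₁ + suc ((t₂ + u) + v) ≤ 20 * suc (t + t′)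
      time {t₁} {t₂} {u} {v} p q r = begin
        t₁ + suc ((t₂ + u) + v)      ≡⟨ cong (λ z → t₁ + suc z) (+-assoc t₂ u v) ⟩
        t₁ + suc (t₂ + (u + v))      ≤⟨ +-mono-≤ p (s≤s (+-mono-≤ q r)) ⟩
        6 + (20 * t + 20 * t′)       ≤⟨ +-monoˡ-≤ (20 * t + 20 * t′) (m≤m+n 6 14) ⟩
        20 + (20 * t + 20 * t′)      ≡⟨ cong (20 +_) (*-distribˡ-+ 20 t t′) ⟨
        20 + 20 * (t + t′)           ≡⟨ *-suc 20 (t + t′) ⟨
        20 * suc (t + t′)            ∎
        where open ≤-Reasoning
    simulate (whileFalse {x = x} x≡0) {S} (rep , inv , j) =
      let S₁ = afterReadRegister x 42 S
          t₁ , e₁ , t₁≤ = readRegister-run x 42 S j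
      in _ , S₁ , e₁ ⨾ whileFalse (trans (sym (proj₁ rep x)) x≡0) , (rep , inv , j) ,
         afterReadRegister-≈ x 42 S (m≤m+n 32 10) , ≤-trans (+-mono-≤ t₁≤ (s≤s z≤n)) (m≤m+n 6 14)

  -- The invariant lists what outlives the phase: the arrays below 4 and all base versions are those
  -- of `a₀`, and no stamp exceeds J, so a later version finds no valid overlay.
  overlayWriter : (J : ℕ) (a₀ : Arrays) → Writer J
  overlayWriter J a₀ = record
    { write      = writeOverlay
    ; effect     = overlayEffect J
    ; Inv        = λ a → (∀ A i → A < 4 → a A i ≡ a₀ A i) ×
                         (∀ κ x i → a (base κ x) i ≡ a₀ (base κ x) i) ×
                         (∀ κ x i → a (stamp κ x) i ≤ J)
    ; Inv-write  = λ a κ x i v (own , bases , stamps) →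
        (λ A i′ A<4 → trans (setCellA-other (setCellA (overlay κ x) i v a) (stamp κ x) i J A i′ (version≥4 0 κ x A<4))
           (trans (setCellA-other a (overlay κ x) i v A i′ (version≥4 1 κ x A<4)) (own A i′ A<4))) ,
        (λ κ′ x′ i′ → trans (base-overlayEffect J a κ x i v κ′ x′ i′) (bases κ′ x′ i′)) ,
        (λ κ′ x′ i′ → stamps′ a κ x i v stamps κ′ x′ i′ (cell? κ κ′ x x′ i i′))
    ; look-write = λ a κ x i v _ → look-overlayEffect J a κ x i v
    ; write-run  = λ where κ x S refl → 2 , store ⨾ store , ≤-refl
    }
    where
    stamps′ : ∀ a κ x i v → (∀ κ x i → a (stamp κ x) i ≤ J) → ∀ κ′ x′ i′ →
              Dec (κ ≡ κ′ × x ≡ x′ × i ≡ i′) → overlayEffect J a κ x i v (stamp κ′ x′) i′ ≤ J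
    stamps′ a κ x i v st κ′ x′ i′ (yes (refl , refl , refl)) =
      ≤-reflexive (setCellA-same (setCellA (overlay κ x) i v a) (stamp κ x) i J)
    stamps′ a κ x i v st κ′ x′ i′ (no ne) =
      ≤-trans (≤-reflexive (stamp-overlayEffect J a κ x i v κ′ x′ i′ ne)) (st κ′ x′ i′)

  -- All stamps are 0 during preprocessing. Reading with version 1 therefore always falls through to
  -- the base, which is where this writer puts its values.
  baseWriter : (a₀ : Arrays) → Writer 1
  baseWriter a₀ = record
    { write      = writeBase
    ; effect     = baseEffect 1
    ; Inv        = λ a → (∀ A i → A < 4 → a A i ≡ a₀ A i) × (∀ κ x i → a (stamp κ x) i ≡ 0)
    ; Inv-write  = λ a κ x i v (own , stamps) →
        (λ A i′ A<4 → trans (setCellA-other a (base κ x) i v A i′ (version≥4 2 κ x A<4)) (own A i′ A<4)) ,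
        (λ κ′ x′ i′ → trans (stamp-baseEffect 1 a κ x i v κ′ x′ i′) (stamps κ′ x′ i′))
    ; look-write = λ a κ x i v (_ , stamps) →
        look-baseEffect 1 a κ x i v λ κ′ x′ i′ → cong (_≡ᵇ 1) (stamps κ′ x′ i′)
    ; write-run  = λ κ x S _ → 1 , store , s≤s z≤n
    }

  -- Emission of the edges of a graph

  data Gen : Set where
    emit  : Expr → Expr → Gen
    loop  : Reg → Gen → Gen
    guard : Expr → Gen → Gen
    _▹_   : Gen → Gen → Gen

  infixr 5 _▹_

  -- The edges go to the base versions of arrays 0 and 1, and their number to
  -- that of register 1.
  compile : ℕ → Gen → Program
  compile k (emit s t) = assign 50 s 0 ⨾ assign 51 t 0 ⨾ const 52 0 ⨾ load 53 (base register 1) 52 ⨾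
    store (base array 0) 53 50 ⨾ store (base array 1) 53 51 ⨾
    const 54 1 ⨾ op add 53 53 54 ⨾ store (base register 1) 52 53
  compile k (loop b g)  = for k b (compile (suc k) g)
  compile k (guard e g) = assign 50 e 0 ⨾ ifNZ 50 then compile k g else skip
  compile k (g ▹ h)     = compile k g ⨾ compile k h

  -- Register 2 is excluded as a loop bound because it holds the number of phases, which the bound M
  -- on the other parameters does not cover. Degrees stay below 65 because `B ^ 64` fits into a
  -- word.
  wellFormed : ℕ → Gen → Bool
  wellFormed k (emit s t)  = (varsBelow k s ∧ (deg s <ᵇ 65)) ∧ (varsBelow k t ∧ (deg t <ᵇ 65))
  wellFormed k (loop b g)  = ((k <ᵇ 32) ∧ (b <ᵇ k)) ∧ (not (b ≡ᵇ 2) ∧ wellFormed (suc k) g)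
  wellFormed k (guard e g) = (varsBelow k e ∧ (deg e <ᵇ 65)) ∧ wellFormed k g
  wellFormed k (g ▹ h)     = wellFormed k g ∧ wellFormed k h

  genCost : ℕ → Gen → ℕ
  genCost M (emit s t)  = size s + (size t + 7)
  genCost M (loop b g)  = 3 + M * (genCost M g + 4)
  genCost M (guard e g) = size e + suc (genCost M g + 1)
  genCost M (g ▹ h)     = genCost M g + genCost M h

  -- The recursion splits off the last index, as a loop appends the edges of each round at the end.
  -- The loop invariant after i rounds is then given by `gather i f`.
  gather : ∀ {A : Set} (m : ℕ) → (ℕ → List A) → List A
  gather zero    f = []
  gather (suc m) f = gather m f ++ f m

  gather-length-mono : ∀ {A : Set} {m n} (f : ℕ → List A) → m ≤ n → length (gather m f) ≤ length (gather n f)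
  gather-length-mono {m = m} {zero}  f z≤n = z≤n
  gather-length-mono {m = m} {suc n} f m≤1+n with m≤n⇒m<n∨m≡n m≤1+n
  ... | inj₂ refl = ≤-refl
  ... | inj₁ m<1+n = ≤-trans (gather-length-mono f (s≤s⁻¹ m<1+n))
    (≤-trans (m≤m+n _ _) (≤-reflexive (sym (List.length-++ (gather n f)))))

  sumUpTo-const : ∀ c m → sumUpTo (λ _ → c) m ≡ m * c
  sumUpTo-const c zero    = refl
  sumUpTo-const c (suc m) = cong (c +_) (sumUpTo-const c m)

  cells-snoc : ∀ (xs : List ℕ) v i → cells 0 (xs ++ v ∷ []) i ≡ update (cells 0 xs) (length xs) v i
  cells-snoc []       v zero    = refl
  cells-snoc []       v (suc i) = refl
  cells-snoc (x ∷ xs) v zero    = refl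
  cells-snoc (x ∷ xs) v (suc i) = cells-snoc xs v i

  cells-∷ʳ-cases : ∀ (ℓ : List ℕ) v r → cells 0 (ℓ ∷ʳ v) r ≡ cells 0 ℓ r ⊎ cells 0 (ℓ ∷ʳ v) r ≡ v
  cells-∷ʳ-cases []      v zero    = inj₂ refl
  cells-∷ʳ-cases []      v (suc r) = inj₁ refl
  cells-∷ʳ-cases (x ∷ ℓ) v zero    = inj₁ refl
  cells-∷ʳ-cases (x ∷ ℓ) v (suc r) = cells-∷ʳ-cases ℓ v r

  cells-∷ʳ-≤ : ∀ {X} (ℓ : List ℕ) v r → cells 0 ℓ r ≤ X → v ≤ X → cells 0 (ℓ ∷ʳ v) r ≤ X
  cells-∷ʳ-≤ ℓ v r p q with cells-∷ʳ-cases ℓ v r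
  ... | inj₁ e = ≤-trans (≤-reflexive e) p
  ... | inj₂ e = ≤-trans (≤-reflexive e) q

  module Meaning (input : Arrays) where

    open Expressions input

    ⟦_⟧ᵍ : Gen → List ℕ → List (ℕ × ℕ)
    ⟦ emit s t ⟧ᵍ  ℓ = (val (cells 0 ℓ) s , val (cells 0 ℓ) t) ∷ []
    ⟦ loop b g ⟧ᵍ  ℓ = gather (cells 0 ℓ b) (λ i → ⟦ g ⟧ᵍ (ℓ ∷ʳ i))
    ⟦ guard e g ⟧ᵍ ℓ = if val (cells 0 ℓ) e ≡ᵇ 0 then [] else ⟦ g ⟧ᵍ ℓ
    ⟦ g ▹ h ⟧ᵍ     ℓ = ⟦ g ⟧ᵍ ℓ ++ ⟦ h ⟧ᵍ ℓ

  module Generation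
    (input : Arrays) (w : ℕ) (ρ : ℕ → Bool) (1<2^w : 1 < 2 ^ w)
    (B : ℕ) (2≤B : 2 ≤ B) (B^64<2^w : B ^ 64 < 2 ^ w) (input≤1 : ∀ A i → input A i ≤ 1)
    where

    open Logic input w ρ 1<2^w public
    open Bounds B 2≤B input≤1
    open Meaning input

    instance
      B-nonZero : NonZero B
      B-nonZero = >-nonZero (≤-trans (s≤s z≤n) 2≤B)

    Small : List ℕ → Set
    Small ℓ = ∀ r → cells 0 ℓ r ≤ B

    Small-push : ∀ ℓ {v} → Small ℓ → v ≤ B → Small (ℓ ∷ʳ v)
    Small-push ℓ small v≤B r = cells-∷ʳ-≤ ℓ _ r (small r) v≤B

    <2^w : ∀ {d} → d ≤ 64 → B ^ d < 2 ^ w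
    <2^w d≤64 = ≤-<-trans (^-monoʳ-≤ B d≤64) B^64<2^w

    ≤B⇒<2^w : ∀ {v} → v ≤ B → v < 2 ^ w
    ≤B⇒<2^w v≤B = ≤-<-trans (≤-trans v≤B (≤-reflexive (sym (*-identityʳ B)))) (<2^w {1} (s≤s z≤n))

    -- A subexpression has no larger degree than the whole, so the single assumption on `B ^ 64`
    -- covers all intermediate values.
    fits : ∀ env e → (∀ r → env r ≤ B) → deg e ≤ 64 → Fits env e
    fits env e@(var r)     small d≤ = ≤-<-trans (val≤B^deg env e small) (<2^w d≤)
    fits env e@(lit c)     small d≤ = ≤-<-trans (val≤B^deg env e small) (<2^w d≤)
    fits env e@(bin o a b) small d≤ =
      fits env a small (≤-trans (≤-trans (m≤m+n (deg a) (deg b)) (n≤1+n _)) d≤) ,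
      fits env b small (≤-trans (≤-trans (m≤n+m (deg b) (deg a)) (n≤1+n _)) d≤) ,
      ≤-<-trans (val≤B^deg env e small) (<2^w d≤)
    fits env (cell A e)    small d≤ = fits env e small d≤

    module _ (a₀ : Arrays) where

      Encodes : List (ℕ × ℕ) → Arrays → Set
      Encodes es a = a (base register 1) 0 ≡ length es ×
        (∀ i → a (base array 0) i ≡ cells 0 (map proj₁ es) i) ×
        (∀ i → a (base array 1) i ≡ cells 0 (map proj₂ es) i) ×
        (∀ A i → A ≢ base register 1 → A ≢ base array 0 → A ≢ base array 1 → a A i ≡ a₀ A i)

      cells-map-snoc : ∀ (f : ℕ × ℕ → ℕ) es v i →
        cells 0 (map f (es ++ v ∷ [])) i ≡ update (cells 0 (map f es)) (length es) (f v) i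
      cells-map-snoc f es v i = trans (cong (λ xs → cells 0 xs i) (List.map-++ f es (v ∷ [])))
        (trans (cells-snoc (map f es) (f v) i)
          (cong (λ n → update (cells 0 (map f es)) n (f v) i) (List.length-map f es)))

      update-cong : ∀ {f g : ℕ → ℕ} {i i′ v v′} → (∀ j → f j ≡ g j) → i ≡ i′ → v ≡ v′ →
                    ∀ j → update f i v j ≡ update g i′ v′ j
      update-cong {i = i} f≗g refl refl j with i ≡ᵇ j
      ... | true  = refl
      ... | false = f≗g j

      holds-after : ∀ ℓ x {S S′} → length ℓ < 33 → 50 ≤ x →
        (∀ r → r < 64 + 0 → x ≢ r → reg S′ r ≡ reg S r) → Holds ℓ S → Holds ℓ S′
      holds-after ℓ x ℓ≤32 50≤x same h r r<ℓ = trans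
        (same r (≤-trans r<33 (m≤m+n 33 31)) (>⇒≢ (≤-trans r<33 (≤-trans (m≤m+n 33 17) 50≤x)))) (h r r<ℓ)
        where
        r<33 : r < 33
        r<33 = ≤-trans r<ℓ (<⇒≤ ℓ≤32)

      holds-≥50 : ∀ ℓ x v S → length ℓ < 33 → 50 ≤ x → Holds ℓ S → Holds ℓ (setReg x v S)
      holds-≥50 ℓ x v S ℓ≤32 50≤x h = holds-after ℓ x {S} {setReg x v S} ℓ≤32 50≤x
        (λ r _ x≢r → reg-set-other S v x≢r) h

      -- base register 1, base array 0 and base array 1 are the arrays 12, 9 and 15.
      emit-run : ∀ ℓ es s t → length ℓ < 33 → Small ℓ →
        T (wellFormed (length ℓ) (emit s t)) →
        length (es ++ ⟦ emit s t ⟧ᵍ ℓ) < 2 ^ w →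
        Triple ℓ (Encodes es) (compile (length ℓ) (emit s t)) (size s + (size t + 7))
               ℓ (Encodes (es ++ ⟦ emit s t ⟧ᵍ ℓ))
      emit-run ℓ es s t ℓ≤32 small wf len .run S h inp (cnt , tails , heads , rest)
        with wfs , wft ← T-∧ (varsBelow (length ℓ) s ∧ (deg s <ᵇ 65)) wf
        with bs , ds ← T-∧ (varsBelow (length ℓ) s) wfs
        with bt , dt ← T-∧ (varsBelow (length ℓ) t) wft
        with t₁ , S₁ , e₁ , t₁≤ , v₁ , same₁ , arr₁ ←
          assign-run {length ℓ} {cells 0 ℓ} (≤-trans (<⇒≤ ℓ≤32) (m≤m+n 33 31)) 50 s 0 S bs
            (fits (cells 0 ℓ) s small (s≤s⁻¹ (<ᵇ⇒< (deg s) 65 ds))) h inp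
        with h₁ ← holds-after ℓ 50 {S} {S₁} ℓ≤32 ≤-refl same₁ h
        with t₂ , S₂ , e₂ , t₂≤ , v₂ , same₂ , arr₂ ←
          assign-run {length ℓ} {cells 0 ℓ} (≤-trans (<⇒≤ ℓ≤32) (m≤m+n 33 31)) 51 t 0 S₁ bt
            (fits (cells 0 ℓ) t small (s≤s⁻¹ (<ᵇ⇒< (deg t) 65 dt))) h₁ (subst HasInput (sym arr₁) inp)
        with refl ← arr₁ with refl ← arr₂
        = t₁ + (t₂ + 7) , _ ,
          e₁ ⨾ e₂ ⨾ const (<-trans z<s 1<2^w) ⨾ load ⨾ store ⨾ store ⨾ const 1<2^w ⨾
            op (subst (_< 2 ^ w) (sym count) len) ⨾ store ,
          +-mono-≤ t₁≤ (+-monoˡ-≤ 7 t₂≤) ,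
          holds-≥50 ℓ 53 _ S₅ ℓ≤32 (m≤m+n 50 3) (holds-≥50 ℓ 54 1 S₄ ℓ≤32 (m≤m+n 50 4)
            (holds-≥50 ℓ 53 _ S₃ ℓ≤32 (m≤m+n 50 3) (holds-≥50 ℓ 52 0 S₂ ℓ≤32 (m≤m+n 50 2)
              (holds-after ℓ 51 {S₁} {S₂} ℓ≤32 (n≤1+n 50) same₂ h₁)))) ,
          (λ where
            0 i A<3 → inp 0 i A<3
            1 i A<3 → inp 1 i A<3
            2 i A<3 → inp 2 i A<3
            (suc (suc (suc _))) i (s≤s (s≤s (s≤s ())))) ,
          count ,
          (λ i → trans (update-cong tails cnt (trans (same₂ 50 (m≤m+n 51 13) λ ()) v₁) i)
                   (sym (cells-map-snoc proj₁ es _ i))) ,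
          (λ i → trans (update-cong heads cnt v₂ i) (sym (cells-map-snoc proj₂ es _ i))) ,
          (λ A i ≢c ≢t ≢h → trans (cong (λ f → f i) (update-other (arr S₇) _ (≢-sym ≢c)))
            (trans (cong (λ f → f i) (update-other (arr S₆) _ (≢-sym ≢h)))
              (trans (cong (λ f → f i) (update-other (arr S) _ (≢-sym ≢t))) (rest A i ≢c ≢t ≢h))))
        where
        S₃ S₄ S₅ S₆ S₇ : State
        S₃ = setReg 52 0 S₂
        S₄ = setReg 53 (arr S 12 0) S₃
        S₅ = setReg 54 1 S₄
        S₆ = setCell 9 (arr S 12 0) (reg S₂ 50) S₅
        S₇ = setCell 15 (arr S 12 0) (reg S₂ 51) S₆
        count : arr S 12 0 + 1 ≡ length (es ++ ⟦ emit s t ⟧ᵍ ℓ)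
        count = trans (cong (_+ 1) cnt) (sym (List.length-++ es))

      module _ (M : ℕ) (M≤B : M ≤ B) where

        LoopSmall : List ℕ → Set
        LoopSmall ℓ = ∀ r → r ≢ 2 → cells 0 ℓ r ≤ M

        -- The list `es` of edges emitted so far is carried along because loops extend it round by
        -- round. The assumption on the length keeps the edge counter within a word; it concerns the
        -- final list and is inherited by all prefixes.
        gen-run : ∀ g ℓ es → length ℓ < 33 → Small ℓ → LoopSmall ℓ → T (wellFormed (length ℓ) g) →
          length (es ++ ⟦ g ⟧ᵍ ℓ) < 2 ^ w →
          Triple ℓ (Encodes es) (compile (length ℓ) g) (genCost M g) ℓ (Encodes (es ++ ⟦ g ⟧ᵍ ℓ))
        gen-run (emit s t) ℓ es ℓ≤32 small lsmall wf len = emit-run ℓ es s t ℓ≤32 small wf len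
        gen-run (loop b g) ℓ es ℓ≤32 small lsmall wf len
          with wf₁ , wf₂ ← T-∧ ((length ℓ <ᵇ 32) ∧ (b <ᵇ length ℓ)) wf
          with ℓ<32 , b<ℓ ← T-∧ (length ℓ <ᵇ 32) wf₁
          with b≢2 , wf₃ ← T-∧ (not (b ≡ᵇ 2)) wf₂ =
          weakenT {P = I 0} {Q = I m} {P′ = Encodes es} {Q′ = Encodes (es ++ gather m f)}
            (λ a → subst (λ xs → Encodes xs a) (sym (List.++-identityʳ es)))
            (λ a x → x) cost≤
            (forT ℓ b I (compile (suc (length ℓ)) g) (λ _ → genCost M g) (<ᵇ⇒< _ 32 ℓ<32) (<ᵇ⇒< b _ b<ℓ)
              (≤B⇒<2^w (small b)) body)
          where
          wf′ = T-∧ ((length ℓ <ᵇ 32) ∧ (b <ᵇ length ℓ)) wf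
          m = cells 0 ℓ b
          f : ℕ → List (ℕ × ℕ)
          f i = ⟦ g ⟧ᵍ (ℓ ∷ʳ i)
          I : ℕ → Arrays → Set
          I i = Encodes (es ++ gather i f)
          m≤M : m ≤ M
          m≤M = lsmall b (not≡2 b (proj₁ (T-∧ (not (b ≡ᵇ 2)) (proj₂ wf′))))
            where
            not≡2 : ∀ b → T (not (b ≡ᵇ 2)) → b ≢ 2
            not≡2 _ () refl
          cost≤ : 3 + sumUpTo (λ _ → genCost M g + 4) m ≤ 3 + M * (genCost M g + 4)
          cost≤ = +-monoʳ-≤ 3 (≤-trans (≤-reflexive (sumUpTo-const (genCost M g + 4) m)) (*-monoˡ-≤ (genCost M g + 4) m≤M))
          length-push : ∀ i → length (ℓ ∷ʳ i) ≡ suc (length ℓ)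
          length-push i = trans (List.length-++ ℓ) (+-comm _ 1)
          body : ∀ i → i < m → Triple (ℓ ∷ʳ i) (I i) (compile (suc (length ℓ)) g) (genCost M g) (ℓ ∷ʳ i) (I (suc i))
          body i i<m =
            subst₂ (λ k xs → Triple (ℓ ∷ʳ i) (I i) (compile k g) (genCost M g) (ℓ ∷ʳ i) (Encodes xs))
              (length-push i) (List.++-assoc es (gather i f) (f i))
              (gen-run g (ℓ ∷ʳ i) (es ++ gather i f)
                (subst (_< 33) (sym (length-push i)) (s≤s (<ᵇ⇒< (length ℓ) 32 (proj₁ (T-∧ (length ℓ <ᵇ 32) (proj₁ wf′))))))
                (Small-push ℓ small (<⇒≤ (<-≤-trans i<m (≤-trans m≤M M≤B))))
                (λ r r≢2 → cells-∷ʳ-≤ ℓ i r (lsmall r r≢2) (<⇒≤ (<-≤-trans i<m m≤M)))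
                (subst (λ k → T (wellFormed k g)) (sym (length-push i)) (proj₂ (T-∧ (not (b ≡ᵇ 2)) (proj₂ wf′))))
                (≤-<-trans (≤-trans (≤-reflexive (cong length (List.++-assoc es (gather i f) (f i))))
                   (≤-trans (≤-reflexive (List.length-++ es)) (≤-trans (+-monoʳ-≤ (length es) (gather-length-mono f i<m))
                     (≤-reflexive (sym (List.length-++ es)))))) len))
        gen-run (guard e g) ℓ es ℓ≤32 small lsmall wf len .run S h inp enc
          with wfe , wfg ← T-∧ (varsBelow (length ℓ) e ∧ (deg e <ᵇ 65)) wf
          with be , de ← T-∧ (varsBelow (length ℓ) e) wfe
          with t₁ , S₁ , e₁ , t₁≤ , v₁ , same₁ , refl ←
            assign-run {length ℓ} {cells 0 ℓ} (≤-trans (<⇒≤ ℓ≤32) (m≤m+n 33 31)) 50 e 0 S be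
              (fits (cells 0 ℓ) e small (s≤s⁻¹ (<ᵇ⇒< (deg e) 65 de))) h inp
          with h₁ ← holds-after ℓ 50 {S} {S₁} ℓ≤32 ≤-refl same₁ h
          with val (cells 0 ℓ) e
        ... | zero = _ , S₁ , e₁ ⨾ ifFalse v₁ skip , +-mono-≤ t₁≤ (s≤s (m≤n+m 1 (genCost M g))) , h₁ , inp ,
              subst (λ xs → Encodes xs (arr S)) (sym (List.++-identityʳ es)) enc
        ... | suc _
          with t₂ , S₂ , e₂ , t₂≤ , post ← gen-run g ℓ es ℓ≤32 small lsmall wfg len .run S₁ h₁ inp enc
            = _ , S₂ , e₁ ⨾ ifTrue (λ z → contradiction (trans (sym v₁) z) λ ()) e₂ ,
              +-mono-≤ t₁≤ (s≤s (≤-trans t₂≤ (m≤m+n _ 1))) , post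
        gen-run (g ▹ h) ℓ es ℓ≤32 small lsmall wf len
          with wfg , wfh ← T-∧ (wellFormed (length ℓ) g) wf =
          seqT {Q = Encodes (es ++ ⟦ g ⟧ᵍ ℓ)} {R = Encodes (es ++ ⟦ g ⟧ᵍ ℓ ++ ⟦ h ⟧ᵍ ℓ)}
            (gen-run g ℓ es ℓ≤32 small lsmall wfg
              (≤-<-trans (≤-trans (m≤m+n _ (length (⟦ h ⟧ᵍ ℓ)))
                (≤-reflexive (trans (sym (List.length-++ (es ++ ⟦ g ⟧ᵍ ℓ))) (cong length assoc)))) len))
            (subst (λ xs → Triple ℓ (Encodes (es ++ ⟦ g ⟧ᵍ ℓ)) (compile (length ℓ) h) (genCost M h) ℓ (Encodes xs)) assoc
              (gen-run h ℓ (es ++ ⟦ g ⟧ᵍ ℓ) ℓ≤32 small lsmall wfh (subst (λ xs → length xs < 2 ^ w) (sym assoc) len)))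
          where
          assoc = List.++-assoc es (⟦ g ⟧ᵍ ℓ) (⟦ h ⟧ᵍ ℓ)

  -- Distances

  -- Finitely many double negations commute with the universal quantifier. This collects the
  -- distances from one vertex to all others although each of them is known only up to double
  -- negation.
  ¬¬-Fin : ∀ {n} {P : Fin n → Set} → (∀ i → ¬ ¬ P i) → ¬ ¬ (∀ i → P i)
  ¬¬-Fin {zero}  f k = k λ ()
  ¬¬-Fin {suc n} f k = f zero λ p₀ → ¬¬-Fin (f ∘ suc) λ ps → k λ where
    zero    → p₀
    (suc i) → ps i

  maximum : ∀ {n} (f : Fin (suc n) → ℕ) → ∃[ i ] ∀ j → f j ≤ f i
  maximum {zero}  f = zero , λ where zero → ≤-refl
  maximum {suc n} f with maximum (f ∘ suc)
  ... | i , max with ≤-total (f zero) (f (suc i))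
  ...   | inj₁ le = suc i , λ where
          zero    → le
          (suc j) → max j
  ...   | inj₂ ge = zero , λ where
          zero    → ≤-refl
          (suc j) → ≤-trans (max j) ge

  module _ {n : ℕ} {G : Graph n} where

    walk-++ : ∀ {u v x k l} → Walk G u v k → Walk G v x l → Walk G u x (k + l)
    walk-++ []      q = q
    walk-++ (e ∷ p) q = e ∷ walk-++ p q

    walk-∷ʳ : ∀ {u v x l} → Walk G u v l → (v , x) ∈ G → Walk G u x (suc l)
    walk-∷ʳ {l = l} p e = subst (Walk G _ _) (+-comm l 1) (walk-++ p (e ∷ []))

    -- φ is a lower bound for the distance to the vertex from which it vanishes.
    potential-bound : (φ : Fin n → ℕ) → (∀ {u v} → (u , v) ∈ G → φ u ≤ suc (φ v)) →
                      ∀ {u v l} → Walk G u v l → φ u ≤ l + φ v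
    potential-bound φ step []      = ≤-refl
    potential-bound φ step (e ∷ p) = ≤-trans (step e) (s≤s (potential-bound φ step p))

    closed-walk : (P : Fin n → Set) → (∀ {u v} → (u , v) ∈ G → P u → P v) →
                  ∀ {u v l} → Walk G u v l → P u → P v
    closed-walk P step []      pu = pu
    closed-walk P step (e ∷ p) pu = closed-walk P step p (step e pu)

    -- Either the given walk is shortest or some strictly shorter walk takes its place in the
    -- induction. This case distinction is what costs the double negation.
    ¬¬-shortest : ∀ {u v} l → Walk G u v l → ¬ ¬ (∃[ k ] k ≤ l × IsDistance G u v [ k ])
    ¬¬-shortest {u} {v} = <-rec (λ l → Walk G u v l → ¬ ¬ (∃[ k ] k ≤ l × IsDistance G u v [ k ])) rec
      where
      rec : ∀ l → (∀ {k} → k < l → Walk G u v k → ¬ ¬ (∃[ j ] j ≤ k × IsDistance G u v [ j ])) →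
            Walk G u v l → ¬ ¬ (∃[ k ] k ≤ l × IsDistance G u v [ k ])
      rec l ih p none = none (l , ≤-refl , shortest p λ {m} q → ≮⇒≥ λ m<l →
        ih m<l q λ (j , j≤m , dist) → none (j , ≤-trans j≤m (<⇒≤ m<l) , dist))

    ¬¬-distance : ∀ u v → ¬ ¬ (∃[ d ] IsDistance G u v d)
    ¬¬-distance u v none = none (⊤⁺ , unreachable λ {l} p →
      ¬¬-shortest l p λ (k , _ , dist) → none ([ k ] , dist))

    distance-unique : ∀ {u v k d} → IsDistance G u v [ k ] → IsDistance G u v d → d ≡ [ k ]
    distance-unique (shortest p min) (shortest q min′) = cong [_] (≤-antisym (min′ p) (min q))
    distance-unique (shortest p min) (unreachable none) = contradiction p none

    -- The largest distance from c is an eccentricity of at most B, and the radius is no larger. The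
    -- eccentricity is available only up to double negation, but the comparison of r with B is
    -- decidable, and an infinite radius is refuted outright.
    radius-≤ : ∀ {P} c B → (∀ v → ∃[ l ] l ≤ B × Walk G c v l) → IsRadius G P →
               ∃[ r ] P ≡ [ r ] × r ≤ B
    radius-≤ {P} c B walks (_ , min) = conclude P min
      where
      Bounded : Set
      Bounded = ∃[ e ] e ≤ B × IsEccentricity G c [ e ]

      largest : ∀ {n} → Fin n → (f : Fin n → ℕ) → ∃[ i ] ∀ j → f j ≤ f i
      largest {suc n} _ f = maximum f

      bounded : ¬ ¬ Bounded
      bounded none = ¬¬-Fin
        (λ v → let l , l≤B , p = walks v in
          λ none → ¬¬-shortest l p λ (j , j≤l , dist) → none (j , ≤-trans j≤l l≤B , dist))
        λ dists → let i , max = largest c (λ v → proj₁ (dists v)) in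
          none (proj₁ (dists i) , proj₁ (proj₂ (dists i)) , (i , proj₂ (proj₂ (dists i))) ,
            λ u d du → subst (_≤⁺ _) (sym (distance-unique (proj₂ (proj₂ (dists u))) du)) [ max u ])

      conclude : ∀ P → (∀ v e → IsEccentricity G v e → P ≤⁺ e) → ∃[ r ] P ≡ [ r ] × r ≤ B
      conclude [ r ] min = r , refl , decidable-stable (r ≤? B) λ r≰B →
        bounded λ (e , e≤B , ecc) → r≰B (≤-trans (unwrap (min c [ e ] ecc)) e≤B)
        where
        unwrap : ∀ {k l} → [ k ] ≤⁺ [ l ] → k ≤ l
        unwrap [ p ] = p
      conclude ⊤⁺ min = ⊥-elim (bounded λ (e , _ , ecc) → absurd (min c [ e ] ecc))
        where
        absurd : ∀ {l} → ¬ (⊤⁺ ≤⁺ [ l ])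
        absurd ()

    -- Applied to a centre v with its far vertex x: the distance is at most the eccentricity r,
    -- hence finite and attained by a walk, whose length is at least B.
    radius-≥ : ∀ {r} B → (∀ v → ∃[ x ] ∀ {l} → Walk G v x l → B ≤ l) → IsRadius G [ r ] → B ≤ r
    radius-≥ {r} B far ((v , _ , max) , _) = decidable-stable (B ≤? r) λ B≰r →
      let x , B≤ = far v in ¬¬-distance v x λ (d , dist) → B≰r (bound B≤ dist (max x d dist))
      where
      bound : ∀ {x d} → (∀ {l} → Walk G v x l → B ≤ l) → IsDistance G v x d → d ≤⁺ [ r ] → B ≤ r
      bound B≤ (shortest p _) [ l≤r ] = ≤-trans (B≤ p) l≤r

  -- The graph of an instance

  module Construction (n m d L : ℕ) (U : Fin n → Fin d → Bool) (V : Fin m → Fin d → Bool) where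

    -- The vertex of u is the upper end of its line, that of v the lower end of its line. The middle
    -- line gives access to all `inn i` and `out i`; being of length L it offers no short cut.
    data Line : Set where
      left   : Fin n → Line
      middle : Line
      right  : Fin m → Line

    data Vertex : Set where
      at  : Fin (suc L) → Line → Vertex
      hub : Vertex
      inn : Fin d → Vertex
      out : Fin d → Vertex

    S N : ℕ
    S = n + suc m
    N = suc L * S + suc (d + d)

    top : Fin (suc L)
    top = Fin.fromℕ L

    data Edgeˢ : Vertex → Vertex → Set where
      up       : ∀ j c → Edgeˢ (at (inject₁ j) c) (at (suc j) c)
      start    : ∀ x → Edgeˢ hub (at zero (left x))
      startₘ   : Edgeˢ hub (at zero middle)
      back     : ∀ x → Edgeˢ (at top (left x)) hub
      enter    : ∀ x i → U x i ≡ true → Edgeˢ (at top (left x)) (inn i)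
      leave    : ∀ y i → V y i ≡ true → Edgeˢ (out i) (at zero (right y))
      innₘ     : ∀ i → Edgeˢ (at top middle) (inn i)
      outₘ     : ∀ i → Edgeˢ (at top middle) (out i)

    -- The coordinates i with w i = true are opened by the edge from inn i to
    -- out i; a loop makes the number of edges independent of w.
    crossing : (w : Fin d → Bool) → Fin d → Vertex
    crossing w i = if w i then out i else inn i

    data Edgeʷ (w : Fin d → Bool) : Vertex → Vertex → Set where
      static : ∀ {u v} → Edgeˢ u v → Edgeʷ w u v
      cross  : ∀ i → Edgeʷ w (inn i) (crossing w i)

    encodeLine : Line → Fin S
    encodeLine (left x)  = x ↑ˡ suc m
    encodeLine middle    = n ↑ʳ zero
    encodeLine (right y) = n ↑ʳ suc y

    decodeLine′ : Fin n ⊎ Fin (suc m) → Line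
    decodeLine′ (inj₁ x)       = left x
    decodeLine′ (inj₂ zero)    = middle
    decodeLine′ (inj₂ (suc y)) = right y

    decodeLine : Fin S → Line
    decodeLine x = decodeLine′ (splitAt n x)

    decode-encodeLine : ∀ c → decodeLine (encodeLine c) ≡ c
    decode-encodeLine (left x)  = cong decodeLine′ (Fin.splitAt-↑ˡ n x (suc m))
    decode-encodeLine middle    = cong decodeLine′ (Fin.splitAt-↑ʳ n (suc m) zero)
    decode-encodeLine (right y) = cong decodeLine′ (Fin.splitAt-↑ʳ n (suc m) (suc y))

    encode-decodeLine : ∀ x → encodeLine (decodeLine x) ≡ x
    encode-decodeLine x = trans (lemma (splitAt n x)) (Fin.join-splitAt n (suc m) x)
      where
      lemma : ∀ z → encodeLine (decodeLine′ z) ≡ Fin.join n (suc m) z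
      lemma (inj₁ x)       = refl
      lemma (inj₂ zero)    = refl
      lemma (inj₂ (suc y)) = refl

    tail : Fin (suc (d + d)) → Fin N
    tail x = suc L * S ↑ʳ x

    encode : Vertex → Fin N
    encode (at j c) = combine j (encodeLine c) ↑ˡ suc (d + d)
    encode hub      = tail zero
    encode (inn i)  = tail (suc (i ↑ˡ d))
    encode (out i)  = tail (suc (d ↑ʳ i))

    decodeTail : Fin d ⊎ Fin d → Vertex
    decodeTail (inj₁ i) = inn i
    decodeTail (inj₂ i) = out i

    decode′ : Fin (suc L * S) ⊎ Fin (suc (d + d)) → Vertex
    decode′ (inj₁ a)       = at (proj₁ (remQuot {suc L} S a)) (decodeLine (proj₂ (remQuot {suc L} S a)))
    decode′ (inj₂ zero)    = hub
    decode′ (inj₂ (suc z)) = decodeTail (splitAt d z)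

    decode : Fin N → Vertex
    decode a = decode′ (splitAt (suc L * S) a)

    decode-encode : ∀ v → decode (encode v) ≡ v
    decode-encode (at j c) = trans (cong decode′ (Fin.splitAt-↑ˡ (suc L * S) (combine j (encodeLine c)) (suc (d + d))))
      (cong₂ at (cong proj₁ (Fin.remQuot-combine j (encodeLine c)))
        (trans (cong (decodeLine ∘ proj₂) (Fin.remQuot-combine j (encodeLine c))) (decode-encodeLine c)))
    decode-encode hub     = cong decode′ (Fin.splitAt-↑ʳ (suc L * S) (suc (d + d)) zero)
    decode-encode (inn i) = trans (cong decode′ (Fin.splitAt-↑ʳ (suc L * S) (suc (d + d)) (suc (i ↑ˡ d))))
      (cong decodeTail (Fin.splitAt-↑ˡ d i d))
    decode-encode (out i) = trans (cong decode′ (Fin.splitAt-↑ʳ (suc L * S) (suc (d + d)) (suc (d ↑ʳ i))))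
      (cong decodeTail (Fin.splitAt-↑ʳ d d i))

    encode-decode : ∀ a → encode (decode a) ≡ a
    encode-decode a = trans (lemma (splitAt (suc L * S) a)) (Fin.join-splitAt (suc L * S) (suc (d + d)) a)
      where
      lemmaTail : ∀ z → encode (decodeTail z) ≡ tail (suc (Fin.join d d z))
      lemmaTail (inj₁ i) = refl
      lemmaTail (inj₂ i) = refl
      lemma : ∀ z → encode (decode′ z) ≡ Fin.join (suc L * S) (suc (d + d)) z
      lemma (inj₁ a) = cong (_↑ˡ suc (d + d)) (trans
        (cong (combine (proj₁ (remQuot {suc L} S a))) (encode-decodeLine (proj₂ (remQuot {suc L} S a))))
        (Fin.combine-remQuot {suc L} S a))
      lemma (inj₂ zero)    = refl
      lemma (inj₂ (suc z)) = trans (lemmaTail (splitAt d z)) (cong (tail ∘ suc) (Fin.join-splitAt d d z))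

    encode-injective : ∀ {u v} → encode u ≡ encode v → u ≡ v
    encode-injective {u} {v} e = trans (sym (decode-encode u)) (trans (cong decode e) (decode-encode v))

    record Realizes (w : Fin d → Bool) (G : Graph N) : Set where
      field
        sound    : ∀ {a b} → (a , b) ∈ G → Edgeʷ w (decode a) (decode b)
        complete : ∀ {u v} → Edgeʷ w u v → (encode u , encode v) ∈ G

    Hits : (w : Fin d → Bool) → Fin n → Fin m → Set
    Hits w x y = ∃[ i ] U x i ≡ true × V y i ≡ true × w i ≡ true

    module _ (w : Fin d → Bool) {G : Graph N} (realizes : Realizes w G) where

      open Realizes realizes

      climb : ∀ c j → Walk G (encode (at zero c)) (encode (at j c)) (toℕ j)
      climb c = <-weakInduction (λ j → Walk G (encode (at zero c)) (encode (at j c)) (toℕ j)) []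
        λ j p → subst (Walk G _ _) (cong suc (Fin.toℕ-inject₁ j)) (walk-∷ʳ p (complete (static (up j c))))

      -- The upper end of the line of x serves as centre. The left lines and the middle line are
      -- entered by two edges through the hub, the right lines by three edges through a hit, and the
      -- coordinates lie one edge beyond the middle line.
      radius-hit : ∀ {P} x → (∀ y → Hits w x y) → IsRadius G P → ∃[ r ] P ≡ [ r ] × r ≤ 3 + L
      radius-hit x hits = radius-≤ (encode (at top (left x))) (3 + L) λ a →
        subst (λ b → ∃[ l ] l ≤ 3 + L × Walk G (encode (at top (left x))) b l) (encode-decode a) (reach (decode a))
        where
        toHub : Walk G (encode (at top (left x))) (encode hub) 1
        toHub = complete (static (back x)) ∷ []

        toMiddle : Walk G (encode (at top (left x))) (encode (at top middle)) (2 + L)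
        toMiddle = subst (Walk G _ _) (cong (2 +_) (Fin.toℕ-fromℕ L))
          (walk-++ (walk-∷ʳ toHub (complete (static startₘ))) (climb middle top))

        short : ∀ (j : Fin (suc L)) → toℕ j ≤ L
        short j = s≤s⁻¹ (Fin.toℕ<n j)

        reach : ∀ v → ∃[ l ] l ≤ 3 + L × Walk G (encode (at top (left x))) (encode v) l
        reach (at j (left x′)) = 2 + toℕ j , s≤s (s≤s (≤-trans (short j) (n≤1+n L))) ,
          walk-++ (walk-∷ʳ toHub (complete (static (start x′)))) (climb (left x′) j)
        reach (at j middle) = 2 + toℕ j , s≤s (s≤s (≤-trans (short j) (n≤1+n L))) ,
          walk-++ (walk-∷ʳ toHub (complete (static startₘ))) (climb middle j)
        reach (at j (right y)) = 3 + toℕ j , s≤s (s≤s (s≤s (short j))) , via (hits y)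
          where
          via : Hits w x y → Walk G (encode (at top (left x))) (encode (at j (right y))) (3 + toℕ j)
          via (i , ui , vi , wi) =
            complete (static (enter x i ui)) ∷
            (complete (subst (λ b → Edgeʷ w (inn i) (if b then out i else inn i)) wi (cross i)) ∷
            (complete (static (leave y i vi)) ∷ climb (right y) j))
        reach hub     = 1 , s≤s z≤n , toHub
        reach (inn i) = 3 + L , ≤-refl , walk-∷ʳ toMiddle (complete (static (innₘ i)))
        reach (out i) = 3 + L , ≤-refl , walk-∷ʳ toMiddle (complete (static (outₘ i)))

      -- A lower bound for the distance to the end of the line of y, where y is
      -- not hit by x.
      module _ (x : Fin n) (y : Fin m) (miss : ¬ Hits w x y) where

        φ : Vertex → ℕ
        φ (at j (left x′)) with x Fin.≟ x′
        -- As x does not hit y, every route first returns to the hub and climbs another line.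
        ... | yes _ = L + L
        -- The rest of the present line and then the whole line of y.
        ... | no _  = (L ∸ toℕ j) + L
        φ (at j middle) = (L ∸ toℕ j) + L
        φ (at j (right y′)) with y Fin.≟ y′
        ... | yes _ = L ∸ toℕ j
        ... | no _  = L + L
        φ hub     = L + L
        -- The L counts the line of y, which can be entered from here only if coordinate i is open
        -- and belongs to y. The edges in between are not counted.
        φ (inn i) = if w i ∧ V y i then L else L + L
        φ (out i) = if V y i then L else L + L

        L≤if : ∀ b → L ≤ (if b then L else L + L)
        L≤if true  = ≤-refl
        L≤if false = m≤m+n L L

        if≤2L : ∀ b → (if b then L else L + L) ≤ L + L
        if≤2L true  = m≤m+n L L
        if≤2L false = ≤-refl

        L∸top≡0 : L ∸ toℕ top ≡ 0
        L∸top≡0 = trans (cong (L ∸_) (Fin.toℕ-fromℕ L)) (n∸n≡0 L)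

        climb-step : ∀ (j : Fin L) → L ∸ toℕ (inject₁ j) ≤ suc (L ∸ suc (toℕ j))
        climb-step j = ≤-reflexive (trans (cong (L ∸_) (Fin.toℕ-inject₁ j)) (+-∸-assoc 1 (Fin.toℕ<n j)))

        φ-step : ∀ {u v} → Edgeʷ w u v → φ u ≤ suc (φ v)
        φ-step (static (up j (left x′))) with x Fin.≟ x′
        ... | yes _ = n≤1+n _
        ... | no _  = +-monoˡ-≤ L (climb-step j)
        φ-step (static (up j middle)) = +-monoˡ-≤ L (climb-step j)
        φ-step (static (up j (right y′))) with y Fin.≟ y′
        ... | yes _ = climb-step j
        ... | no _  = n≤1+n _
        φ-step (static (start x′)) with x Fin.≟ x′
        ... | yes _ = n≤1+n _
        ... | no _  = n≤1+n _
        φ-step (static startₘ) = n≤1+n _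
        φ-step (static (back x′)) with x Fin.≟ x′
        ... | yes _ = n≤1+n _
        ... | no _  = ≤-trans (+-monoˡ-≤ L (m∸n≤m L (toℕ top))) (n≤1+n _)
        φ-step (static (enter x′ i ui)) with x Fin.≟ x′
        ... | no _  = ≤-trans (≤-reflexive (cong (_+ L) L∸top≡0)) (≤-trans (L≤if (w i ∧ V y i)) (n≤1+n _))
        ... | yes refl with w i in wi | V y i in vi
        ...   | true  | true  = contradiction (i , ui , vi , wi) miss
        ...   | true  | false = n≤1+n _
        ...   | false | true  = n≤1+n _
        ...   | false | false = n≤1+n _
        φ-step (static (leave y′ i vi)) with y Fin.≟ y′
        ... | yes refl rewrite vi = n≤1+n L
        ... | no _ = ≤-trans (if≤2L (V y i)) (n≤1+n _)
        φ-step (static (innₘ i)) = ≤-trans (≤-reflexive (cong (_+ L) L∸top≡0)) (≤-trans (L≤if (w i ∧ V y i)) (n≤1+n _))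
        φ-step (static (outₘ i)) = ≤-trans (≤-reflexive (cong (_+ L) L∸top≡0)) (≤-trans (L≤if (V y i)) (n≤1+n _))
        φ-step (cross i) with w i in wi
        ... | true  = n≤1+n _
        ... | false rewrite wi = n≤1+n _

        φ-end : φ (at top (right y)) ≡ 0
        φ-end with y Fin.≟ y
        ... | yes _   = L∸top≡0
        ... | no y≢y = contradiction refl y≢y

        φ-start : ∀ j → φ (at j (left x)) ≡ L + L
        φ-start j with x Fin.≟ x
        ... | yes _   = refl
        ... | no x≢x = contradiction refl x≢x

        walk-≥ : ∀ {a l} → Walk G a (encode (at top (right y))) l → φ (decode a) ≤ l
        walk-≥ {a} {l} p = ≤-trans
          (potential-bound (φ ∘ decode) (λ e → φ-step (sound e)) p)
          (≤-reflexive (trans (cong (l +_) (trans (cong φ (decode-encode (at top (right y)))) φ-end)) (+-identityʳ l)))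

      -- No edge leads from these vertices back to the hub or to a left line, so the hub is
      -- unreachable and their eccentricity is infinite.
      Trapped : Vertex → Set
      Trapped (at _ (left _)) = ⊥
      Trapped hub             = ⊥
      Trapped _               = ⊤

      trapped-step : ∀ {u v} → Edgeʷ w u v → Trapped u → Trapped v
      trapped-step (static (up j middle))    _ = tt
      trapped-step (static (up j (right x))) _ = tt
      trapped-step (static (leave y i x))    _ = tt
      trapped-step (static (innₘ i))         _ = tt
      trapped-step (static (outₘ i))         _ = tt
      trapped-step (cross i) _ with w i
      ... | true  = tt
      ... | false = tt

      -- From the line of x, the end of a line that x misses is far. The potential of the hub is
      -- `L + L` for every missing pair, so there any `x₀` yields a far vertex. All other vertices
      -- are trapped.
      radius-miss : ∀ {r} → Fin n → (∀ x → ∃[ y ] ¬ Hits w x y) → IsRadius G [ r ] → L + L ≤ r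
      radius-miss x₀ misses = radius-≥ (L + L) λ a → far a (decode a) refl
        where
        trapped-far : ∀ a → Trapped (decode a) → ∃[ x ] ∀ {l} → Walk G a x l → L + L ≤ l
        trapped-far a t = encode hub , λ p → ⊥-elim (subst Trapped (decode-encode hub)
          (closed-walk (Trapped ∘ decode) (λ e → trapped-step (sound e)) p t))

        far : ∀ a v → decode a ≡ v → ∃[ x ] ∀ {l} → Walk G a x l → L + L ≤ l
        far a (at j (left x)) e = let y , miss = misses x in encode (at top (right y)) , λ p →
          ≤-trans (≤-reflexive (sym (trans (cong (φ x y miss) e) (φ-start x y miss j)))) (walk-≥ x y miss p)
        far a hub e = let y , miss = misses x₀ in encode (at top (right y)) , λ p →
          ≤-trans (≤-reflexive (sym (cong (φ x₀ y miss) e))) (walk-≥ x₀ y miss p)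
        far a (at j middle)    e = trapped-far a (subst Trapped (sym e) tt)
        far a (at j (right _)) e = trapped-far a (subst Trapped (sym e) tt)
        far a (inn i)          e = trapped-far a (subst Trapped (sym e) tt)
        far a (out i)          e = trapped-far a (subst Trapped (sym e) tt)

  -- Lists of edges

  -- Enumerates in the same order as `gather`, so that the list of edges and the list emitted by the
  -- program agree position by position.
  gatherF : ∀ {A : Set} (m : ℕ) → (Fin m → List A) → List A
  gatherF zero    f = []
  gatherF (suc m) f = gatherF m (f ∘ inject₁) ++ f (Fin.fromℕ m)

  module _ {A : Set} where

    ∈-gatherF⁻ : ∀ m {f : Fin m → List A} {e} → e ∈ gatherF m f → ∃[ i ] e ∈ f i
    ∈-gatherF⁻ (suc m) {f} e∈ with ∈-++⁻ (gatherF m (f ∘ inject₁)) e∈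
    ... | inj₂ e∈ = Fin.fromℕ m , e∈
    ... | inj₁ e∈ = let i , e∈f = ∈-gatherF⁻ m e∈ in inject₁ i , e∈f

    ∈-gatherF⁺ : ∀ {m} {f : Fin m → List A} {e} i → e ∈ f i → e ∈ gatherF m f
    ∈-gatherF⁺ {suc m} {f} i e∈ with view i
    ... | ‵fromℕ         = ∈-++⁺ʳ (gatherF m (f ∘ inject₁)) e∈
    ... | ‵inj₁ {i = j} _ = ∈-++⁺ˡ (∈-gatherF⁺ {m} {f ∘ inject₁} j e∈)

    gatherF-length : ∀ m {f : Fin m → List A} c → (∀ i → length (f i) ≤ c) → length (gatherF m f) ≤ m * c
    gatherF-length zero    c f≤ = z≤n
    gatherF-length (suc m) {f} c f≤ = begin
      length (gatherF m (f ∘ inject₁) ++ f (Fin.fromℕ m))        ≡⟨ List.length-++ (gatherF m (f ∘ inject₁)) ⟩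
      length (gatherF m (f ∘ inject₁)) + length (f (Fin.fromℕ m)) ≤⟨ +-mono-≤ (gatherF-length m c (f≤ ∘ inject₁)) (f≤ _) ⟩
      m * c + c                                                   ≡⟨ +-comm (m * c) c ⟩
      suc m * c                                                   ∎
      where open ≤-Reasoning

    gatherF-unique : ∀ m {f : Fin m → List A} → (∀ i → Unique (f i)) →
                     (∀ {i j e} → e ∈ f i → e ∈ f j → i ≡ j) → Unique (gatherF m f)
    gatherF-unique zero    uf same = []
    gatherF-unique (suc m) {f} uf same = Unique.++⁺
      (gatherF-unique m (uf ∘ inject₁) λ p q → Fin.inject₁-injective (same p q)) (uf _)
      λ (p , q) → let i , p′ = ∈-gatherF⁻ m p in contradiction (same q p′) Fin.fromℕ≢inject₁

    unique-++ : ∀ (tag : A → ℕ) t {xs ys} → Unique xs → Unique ys → (∀ {e} → e ∈ xs → tag e ≡ t) →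
                (∀ {e} → e ∈ ys → t < tag e) → Unique (xs ++ ys)
    unique-++ tag t ux uy xs≡ ys> = Unique.++⁺ ux uy λ (p , q) → <⇒≢ (ys> q) (sym (xs≡ p))

    ∈-if : ∀ b {x e : A} → e ∈ (if b then x ∷ [] else []) → b ≡ true × e ≡ x
    ∈-if true (here e≡x) = refl , e≡x

    map-gatherF : ∀ {B : Set} (g : A → B) m {f : Fin m → List A} (h : ℕ → List B) →
                  (∀ i → map g (f i) ≡ h (toℕ i)) → map g (gatherF m f) ≡ gather m h
    map-gatherF g zero    h f≡h = refl
    map-gatherF g (suc m) {f} h f≡h = trans (List.map-++ g (gatherF m (f ∘ inject₁)) _) (cong₂ _++_
      (map-gatherF g m h λ i → trans (f≡h (inject₁ i)) (cong h (Fin.toℕ-inject₁ i)))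
      (trans (f≡h (Fin.fromℕ m)) (cong h (Fin.toℕ-fromℕ m))))

  module _ {n : ℕ} where

    insertAll : List (Edge n) → Graph n → Graph n
    insertAll []       G = G
    insertAll (e ∷ es) G = insertAll es (e ∷ G)

    deleteAll : List (Edge n) → Graph n → Graph n
    deleteAll []       G = G
    deleteAll (e ∷ es) G = deleteAll es (filter (λ e′ → ¬? (e′ ≟ᴱ e)) G)

    ∈-insertAll⁻ : ∀ es {G e} → e ∈ insertAll es G → e ∈ es ⊎ e ∈ G
    ∈-insertAll⁻ []       e∈ = inj₂ e∈
    ∈-insertAll⁻ (x ∷ es) e∈ with ∈-insertAll⁻ es e∈
    ... | inj₁ e∈es         = inj₁ (there e∈es)
    ... | inj₂ (here refl)  = inj₁ (here refl)
    ... | inj₂ (there e∈G)  = inj₂ e∈G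

    ∈-insertAll⁺ : ∀ es {G e} → e ∈ es ⊎ e ∈ G → e ∈ insertAll es G
    ∈-insertAll⁺ []       (inj₂ e∈)          = e∈
    ∈-insertAll⁺ (x ∷ es) (inj₁ (here refl)) = ∈-insertAll⁺ es (inj₂ (here refl))
    ∈-insertAll⁺ (x ∷ es) (inj₁ (there e∈))  = ∈-insertAll⁺ es (inj₁ e∈)
    ∈-insertAll⁺ (x ∷ es) (inj₂ e∈)          = ∈-insertAll⁺ es (inj₂ (there e∈))

    ∈-deleteAll⁻ : ∀ es {G e} → e ∈ deleteAll es G → e ∈ G × e ∉ es
    ∈-deleteAll⁻ []       e∈ = e∈ , λ ()
    ∈-deleteAll⁻ (x ∷ es) {G} e∈ =
      let e∈′ , e∉es = ∈-deleteAll⁻ es e∈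
          e∈G , e≢x = ∈-filter⁻ (λ e′ → ¬? (e′ ≟ᴱ x)) {xs = G} e∈′
      in e∈G , λ where
        (here e≡x)  → e≢x e≡x
        (there e∈es) → e∉es e∈es

    ∈-deleteAll⁺ : ∀ es {G e} → e ∈ G → e ∉ es → e ∈ deleteAll es G
    ∈-deleteAll⁺ []       e∈ e∉ = e∈
    ∈-deleteAll⁺ (x ∷ es) e∈ e∉ =
      ∈-deleteAll⁺ es (∈-filter⁺ (λ e′ → ¬? (e′ ≟ᴱ x)) e∈ (e∉ ∘ here)) (e∉ ∘ there)

  module _ {σ : Setting} {n M : ℕ} where

    legal-insert : SupportsInsertions σ → ∀ (es : List (Edge n)) (G : Graph n) → Unique es → (∀ {e} → e ∈ es → e ∉ G) →
                   length es + length G ≤ M → Legal σ M G (map insert es) (insertAll es G)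
    legal-insert ok []       G _ fresh len = []
    legal-insert ok (e ∷ es) G (e∉es ∷ unique) fresh len =
      insert ok (fresh (here refl)) (≤-trans (s≤s (m≤n+m (length G) (length es))) len)
        (legal-insert ok es (e ∷ G) unique
          (λ where
            e′∈es (here refl)  → All.All¬⇒¬Any e∉es e′∈es
            e′∈es (there e′∈G) → fresh (there e′∈es) e′∈G)
          (≤-trans (≤-reflexive (+-suc (length es) (length G))) len))

    legal-delete : SupportsDeletions σ → ∀ (es : List (Edge n)) (G : Graph n) → Unique es → (∀ {e} → e ∈ es → e ∈ G) →
                   Legal σ M G (map delete es) (deleteAll es G)
    legal-delete ok []       G _ present = []
    legal-delete ok (e ∷ es) G (e∉es ∷ unique) present =
      delete ok (present (here refl)) (legal-delete ok es _ unique λ e′∈es →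
        ∈-filter⁺ (λ e′ → ¬? (e′ ≟ᴱ e)) (present (there e′∈es))
          λ where refl → All.All¬⇒¬Any e∉es e′∈es)

    legal-query : ∀ {G : Graph n} {rs G′} → Legal σ M G rs G′ → Legal σ M G (rs ∷ʳ query) G′
    legal-query []                  = query []
    legal-query (insert ok new l p) = insert ok new l (legal-query p)
    legal-query (delete ok old p)   = delete ok old (legal-query p)
    legal-query (query p)           = query (legal-query p)

  -- Insertions serve the incremental and also the fully dynamic setting, deletions the decremental
  -- one.
  data Mode : Set where
    inserting deleting : Mode

  Supports : Setting → Mode → Set
  Supports σ inserting = SupportsInsertions σ
  Supports σ deleting  = SupportsDeletions σ

  -- The initial edges and the requests of a phase

  module EdgeLists (n m d L : ℕ) (U : Fin n → Fin d → Bool) (V : Fin m → Fin d → Bool) where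

    open Construction n m d L U V public

    Pair : Set
    Pair = Vertex × Vertex

    ups starts exits leaves middles crossings : List Pair
    ups = gatherF L λ j → gatherF S λ x →
      (at (inject₁ j) (decodeLine x) , at (suc j) (decodeLine x)) ∷ []
    starts = gatherF n (λ x → (hub , at zero (left x)) ∷ []) ++ (hub , at zero middle) ∷ []
    exits = gatherF n λ x → (at top (left x) , hub) ∷
      gatherF d λ i → if U x i then (at top (left x) , inn i) ∷ [] else []
    leaves = gatherF m λ y → gatherF d λ i → if V y i then (out i , at zero (right y)) ∷ [] else []
    middles = gatherF d λ i → (at top middle , inn i) ∷ (at top middle , out i) ∷ []
    crossings = gatherF d λ i → (inn i , out i) ∷ (inn i , inn i) ∷ []

    -- For deletions the loop and the crossing edge are both present initially,
    -- and the wrong one is removed.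
    dynamic : Mode → List Pair
    dynamic inserting = []
    dynamic deleting  = crossings

    initial : Mode → List Pair
    initial mode = ups ++ starts ++ exits ++ leaves ++ middles ++ dynamic mode

    -- The six groups of edges can be told apart by their endpoints. Distinct tags give
    -- disjointness, which reduces uniqueness of the whole list to uniqueness of each group.
    tag : Pair → ℕ
    tag (at _ _ , at _ _)     = 0
    tag (hub , _)             = 1
    tag (at _ (left _) , _)   = 2
    tag (out _ , _)           = 3
    tag (at _ _ , _)          = 4
    tag (inn _ , _)           = 5

    ∈ups : ∀ {e} → e ∈ ups → ∃[ j ] ∃[ x ] e ≡ (at (inject₁ j) (decodeLine x) , at (suc j) (decodeLine x))
    ∈ups e∈ with ∈-gatherF⁻ L e∈
    ... | j , e∈j with ∈-gatherF⁻ S e∈j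
    ...   | x , here refl = j , x , refl

    ∈starts : ∀ {e} → e ∈ starts → Edgeˢ (proj₁ e) (proj₂ e) × tag e ≡ 1
    ∈starts e∈ with ∈-++⁻ (gatherF n (λ x → (hub , at zero (left x)) ∷ [])) e∈
    ... | inj₂ (here refl) = startₘ , refl
    ... | inj₁ e∈ with ∈-gatherF⁻ n e∈
    ...   | x , here refl = start x , refl

    exit : Fin n → List Pair
    exit x = gatherF d λ i → if U x i then (at top (left x) , inn i) ∷ [] else []

    ∈exit : ∀ {x e} → e ∈ exit x → ∃[ i ] U x i ≡ true × e ≡ (at top (left x) , inn i)
    ∈exit {x} e∈ with ∈-gatherF⁻ d e∈
    ... | i , e∈i with ∈-if (U x i) e∈i
    ...   | ui , refl = i , ui , refl

    ∈exits : ∀ {e} → e ∈ exits → Edgeˢ (proj₁ e) (proj₂ e) × tag e ≡ 2 × ∃[ x ] proj₁ e ≡ at top (left x)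
    ∈exits e∈ with ∈-gatherF⁻ n e∈
    ... | x , here refl = back x , refl , x , refl
    ... | x , there e∈x with ∈exit e∈x
    ...   | i , ui , refl = enter x i ui , refl , x , refl

    leaving : Fin m → List Pair
    leaving y = gatherF d λ i → if V y i then (out i , at zero (right y)) ∷ [] else []

    ∈leaving : ∀ {y e} → e ∈ leaving y → ∃[ i ] V y i ≡ true × e ≡ (out i , at zero (right y))
    ∈leaving {y} e∈ with ∈-gatherF⁻ d e∈
    ... | i , e∈i with ∈-if (V y i) e∈i
    ...   | vi , refl = i , vi , refl

    ∈leaves : ∀ {e} → e ∈ leaves → Edgeˢ (proj₁ e) (proj₂ e) × tag e ≡ 3
    ∈leaves e∈ with ∈-gatherF⁻ m e∈
    ... | y , e∈y with ∈leaving e∈y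
    ...   | i , vi , refl = leave y i vi , refl

    ∈middles : ∀ {e} → e ∈ middles → Edgeˢ (proj₁ e) (proj₂ e) × tag e ≡ 4
    ∈middles e∈ with ∈-gatherF⁻ d e∈
    ... | i , here refl         = innₘ i , refl
    ... | i , there (here refl) = outₘ i , refl

    ∈crossings : ∀ {e} → e ∈ crossings → (∃[ i ] (e ≡ (inn i , out i) ⊎ e ≡ (inn i , inn i))) × tag e ≡ 5
    ∈crossings e∈ with ∈-gatherF⁻ d e∈
    ... | i , here refl         = (i , inj₁ refl) , refl
    ... | i , there (here refl) = (i , inj₂ refl) , refl

    at-injective : ∀ {j j′ c c′} → at j c ≡ at j′ c′ → j ≡ j′ × c ≡ c′
    at-injective refl = refl , refl

    decodeLine-injective : ∀ {x x′} → decodeLine x ≡ decodeLine x′ → x ≡ x′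
    decodeLine-injective {x} {x′} e = trans (sym (encode-decodeLine x))
      (trans (cong encodeLine e) (encode-decodeLine x′))

    unique-[_] : ∀ (e : Pair) → Unique (e ∷ [])
    unique-[ e ] = [] ∷ []

    unique-if : ∀ b (e : Pair) → Unique (if b then e ∷ [] else [])
    unique-if true  e = unique-[ e ]
    unique-if false e = []

    ups-unique : Unique ups
    ups-unique = gatherF-unique L
      (λ j → gatherF-unique S (λ x → unique-[ _ ])
        λ where (here refl) (here e) → decodeLine-injective (proj₂ (at-injective (cong proj₁ e))))
      λ p q → let _ , p′ = ∈-gatherF⁻ S p ; _ , q′ = ∈-gatherF⁻ S q in same p′ q′
      where
      same : ∀ {j j′ x x′ e} →
        e ∈ (at (inject₁ j) (decodeLine x) , at (suc j) (decodeLine x)) ∷ [] →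
        e ∈ (at (inject₁ j′) (decodeLine x′) , at (suc j′) (decodeLine x′)) ∷ [] → j ≡ j′
      same (here refl) (here e) = Fin.suc-injective (proj₁ (at-injective (cong proj₂ e)))

    starts-unique : Unique starts
    starts-unique = Unique.++⁺
      (gatherF-unique n (λ x → unique-[ _ ]) λ where (here refl) (here refl) → refl) unique-[ _ ]
      λ (p , q) → disjoint (∈-gatherF⁻ n p) q
      where
      disjoint : ∀ {e : Pair} → ∃[ x ] e ∈ (hub , at zero (left x)) ∷ [] → ¬ e ∈ (hub , at zero middle) ∷ []
      disjoint (x , here refl) (here ())
      disjoint (x , here refl) (there ())

    exits-unique : Unique exits
    exits-unique = gatherF-unique n
      (λ x → Unique.++⁺ unique-[ _ ]
        (gatherF-unique d (λ i → unique-if (U x i) _)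
          λ {i} {j} p q → sameᵢ (proj₂ (∈-if (U x i) p)) (proj₂ (∈-if (U x j) q)))
        λ where
          (here refl , q) → hub≢inn (proj₂ (proj₂ (∈exit q))))
      λ {x} {x′} p q → sameₓ (source p) (source q)
      where
      sameᵢ : ∀ {e : Pair} {a i j} → e ≡ (a , inn i) → e ≡ (a , inn j) → i ≡ j
      sameᵢ refl refl = refl
      hub≢inn : ∀ {a i} {A : Set} → _≡_ {A = Pair} (a , hub) (a , inn i) → A
      hub≢inn ()
      source : ∀ {x e} → e ∈ (at top (left x) , hub) ∷ exit x → proj₁ e ≡ at top (left x)
      source (here refl) = refl
      source (there e∈)  = cong proj₁ (proj₂ (proj₂ (∈exit e∈)))
      sameₓ : ∀ {e x x′} → e ≡ at top (left x) → e ≡ at top (left x′) → x ≡ x′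
      sameₓ refl refl = refl

    leaves-unique : Unique leaves
    leaves-unique = gatherF-unique m
      (λ y → gatherF-unique d (λ i → unique-if (V y i) _)
        λ {i} {j} p q → sameᵢ (proj₂ (∈-if (V y i) p)) (proj₂ (∈-if (V y j) q)))
      λ p q → sameᵧ (proj₂ (proj₂ (∈leaving p))) (proj₂ (proj₂ (∈leaving q)))
      where
      sameᵢ : ∀ {e : Pair} {a i j} → e ≡ (out i , a) → e ≡ (out j , a) → i ≡ j
      sameᵢ refl refl = refl
      sameᵧ : ∀ {e : Pair} {y y′ a a′} → e ≡ (a , at zero (right y)) → e ≡ (a′ , at zero (right y′)) → y ≡ y′
      sameᵧ refl refl = refl

    middles-unique : Unique middles
    middles-unique = gatherF-unique d (λ i → ((λ ()) ∷ []) ∷ unique-[ _ ]) λ where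
      (here refl)         (here refl)         → refl
      (here refl)         (there (here ()))
      (there (here refl)) (here ())
      (there (here refl)) (there (here refl)) → refl

    crossings-unique : Unique crossings
    crossings-unique = gatherF-unique d (λ i → ((λ ()) ∷ []) ∷ unique-[ _ ]) λ where
      (here refl)         (here refl)         → refl
      (here refl)         (there (here ()))
      (there (here refl)) (here ())
      (there (here refl)) (there (here refl)) → refl

    initial-unique : ∀ mode → Unique (initial mode)
    initial-unique mode =
      unique-++ tag 0 ups-unique
        (unique-++ tag 1 starts-unique
          (unique-++ tag 2 exits-unique
            (unique-++ tag 3 leaves-unique
              (unique-++ tag 4 middles-unique (dynamic-unique mode) (proj₂ ∘ ∈middles) (>4 mode))
              (proj₂ ∘ ∈leaves) >3)
            (proj₁ ∘ proj₂ ∘ ∈exits) >2)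
          (proj₂ ∘ ∈starts) >1)
        ups-tag (exceeds (n<1+n 0) (proj₂ ∘ ∈starts) >1)
      where
      ups-tag : ∀ {e} → e ∈ ups → tag e ≡ 0
      ups-tag e∈ with _ , _ , refl ← ∈ups e∈ = refl
      exceeds : ∀ {a b xs} {ys : List Pair} → a < b → (∀ {e} → e ∈ xs → tag e ≡ b) → (∀ {e} → e ∈ ys → b < tag e) →
                ∀ {e} → e ∈ xs ++ ys → a < tag e
      exceeds {xs = xs} a<b xs≡ ys> e∈ with ∈-++⁻ xs e∈
      ... | inj₁ e∈ = ≤-trans a<b (≤-reflexive (sym (xs≡ e∈)))
      ... | inj₂ e∈ = <-trans a<b (ys> e∈)
      dynamic-unique : ∀ mode → Unique (dynamic mode)
      dynamic-unique inserting = []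
      dynamic-unique deleting  = crossings-unique
      >4 : ∀ mode {e} → e ∈ dynamic mode → 4 < tag e
      >4 deleting e∈ = ≤-reflexive (sym (proj₂ (∈crossings e∈)))
      >3 : ∀ {e} → e ∈ middles ++ dynamic mode → 3 < tag e
      >3 = exceeds (n<1+n 3) (proj₂ ∘ ∈middles) (>4 mode)
      >2 : ∀ {e} → e ∈ leaves ++ middles ++ dynamic mode → 2 < tag e
      >2 = exceeds (n<1+n 2) (proj₂ ∘ ∈leaves) >3
      >1 : ∀ {e} → e ∈ exits ++ leaves ++ middles ++ dynamic mode → 1 < tag e
      >1 = exceeds (n<1+n 1) (proj₁ ∘ proj₂ ∘ ∈exits) >2

    ∈initial⁻ : ∀ mode {e} → e ∈ initial mode → Edgeˢ (proj₁ e) (proj₂ e) ⊎ e ∈ dynamic mode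
    ∈initial⁻ mode e∈ with ∈-++⁻ ups e∈
    ... | inj₁ e∈ with j , x , refl ← ∈ups e∈ = inj₁ (up j (decodeLine x))
    ... | inj₂ e∈ with ∈-++⁻ starts e∈
    ...   | inj₁ e∈ = inj₁ (proj₁ (∈starts e∈))
    ...   | inj₂ e∈ with ∈-++⁻ exits e∈
    ...     | inj₁ e∈ = inj₁ (proj₁ (∈exits e∈))
    ...     | inj₂ e∈ with ∈-++⁻ leaves e∈
    ...       | inj₁ e∈ = inj₁ (proj₁ (∈leaves e∈))
    ...       | inj₂ e∈ with ∈-++⁻ middles e∈
    ...         | inj₁ e∈ = inj₁ (proj₁ (∈middles e∈))
    ...         | inj₂ e∈ = inj₂ e∈

    ∈initial⁺ : ∀ mode {u v} → Edgeˢ u v → (u , v) ∈ initial mode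
    ∈initial⁺ mode e = listed e
      where
      if-true : ∀ {b} {e : Pair} → b ≡ true → e ∈ (if b then e ∷ [] else [])
      if-true refl = here refl
      in-exits : ∀ {e} → e ∈ exits → e ∈ initial mode
      in-exits e∈ = ∈-++⁺ʳ ups (∈-++⁺ʳ starts (∈-++⁺ˡ e∈))
      in-leaves : ∀ {e} → e ∈ leaves → e ∈ initial mode
      in-leaves e∈ = ∈-++⁺ʳ ups (∈-++⁺ʳ starts (∈-++⁺ʳ exits (∈-++⁺ˡ e∈)))
      in-middles : ∀ {e} → e ∈ middles → e ∈ initial mode
      in-middles e∈ = ∈-++⁺ʳ ups (∈-++⁺ʳ starts (∈-++⁺ʳ exits (∈-++⁺ʳ leaves (∈-++⁺ˡ e∈))))
      listed : ∀ {u v} → Edgeˢ u v → (u , v) ∈ initial mode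
      listed (up j c) = ∈-++⁺ˡ (∈-gatherF⁺ j (∈-gatherF⁺ (encodeLine c)
        (here (cong (λ c → at (inject₁ j) c , at (suc j) c) (sym (decode-encodeLine c))))))
      listed (start x) = ∈-++⁺ʳ ups (∈-++⁺ˡ (∈-++⁺ˡ (∈-gatherF⁺ x (here refl))))
      listed startₘ =
        ∈-++⁺ʳ ups (∈-++⁺ˡ (∈-++⁺ʳ (gatherF n (λ x → (hub , at zero (left x)) ∷ [])) (here refl)))
      listed (back x)       = in-exits (∈-gatherF⁺ x (here refl))
      listed (enter x i ui) = in-exits (∈-gatherF⁺ x (there (∈-gatherF⁺ i (if-true ui))))
      listed (leave y i vi) = in-leaves (∈-gatherF⁺ y (∈-gatherF⁺ i (if-true vi)))
      listed (innₘ i)       = in-middles (∈-gatherF⁺ i (here refl))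
      listed (outₘ i)       = in-middles (∈-gatherF⁺ i (there (here refl)))

    crossing∈initial : ∀ w i → (inn i , crossing w i) ∈ initial deleting
    crossing∈initial w i = ∈-++⁺ʳ ups (∈-++⁺ʳ starts (∈-++⁺ʳ exits (∈-++⁺ʳ leaves (∈-++⁺ʳ middles
      (∈-gatherF⁺ i (choose (w i)))))))
      where
      choose : ∀ b → (inn i , (if b then out i else inn i)) ∈ (inn i , out i) ∷ (inn i , inn i) ∷ []
      choose true  = here refl
      choose false = there (here refl)

    -- The summand d leaves room for the d insertions of a phase. The factor `5 + 2 * d` is crude
    -- but polylogarithmic.
    initial-length : ∀ mode → d + length (initial mode) ≤ N * (5 + 2 * d)
    initial-length mode = ≤-trans (+-monoʳ-≤ d bound) (≤-trans (≤-reflexive (rearrange L n m d)) (total L n m d))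
      where
      if-length : ∀ b (e : Pair) → length (if b then e ∷ [] else []) ≤ 1
      if-length true  e = ≤-refl
      if-length false e = z≤n
      sum≤ : ∀ xs ys {a b} → length {A = Pair} xs ≤ a → length ys ≤ b → length (xs ++ ys) ≤ a + b
      sum≤ xs ys p q = ≤-trans (≤-reflexive (List.length-++ xs)) (+-mono-≤ p q)
      ups≤ : length ups ≤ L * (S * 1)
      ups≤ = gatherF-length L _ λ j → gatherF-length S 1 λ x → ≤-refl
      starts≤ : length starts ≤ n * 1 + 1
      starts≤ = sum≤ (gatherF n _) _ (gatherF-length n 1 λ x → ≤-refl) ≤-refl
      exits≤ : length exits ≤ n * (1 + d * 1)
      exits≤ = gatherF-length n _ λ x → s≤s (gatherF-length d 1 λ i → if-length (U x i) _)
      leaves≤ : length leaves ≤ m * (d * 1)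
      leaves≤ = gatherF-length m _ λ y → gatherF-length d 1 λ i → if-length (V y i) _
      middles≤ : length middles ≤ d * 2
      middles≤ = gatherF-length d 2 λ i → ≤-refl
      dynamic≤ : ∀ mode → length (dynamic mode) ≤ d * 2
      dynamic≤ inserting = z≤n
      dynamic≤ deleting  = gatherF-length d 2 λ i → ≤-refl
      B : ℕ
      B = L * (S * 1) + ((n * 1 + 1) + (n * (1 + d * 1) + (m * (d * 1) + (d * 2 + d * 2))))
      bound : length (initial mode) ≤ B
      bound = sum≤ ups _ ups≤ (sum≤ starts _ starts≤ (sum≤ exits _ exits≤ (sum≤ leaves _ leaves≤
        (sum≤ middles _ middles≤ (dynamic≤ mode)))))
      rearrange : ∀ L n m d →
        d + (L * ((n + suc m) * 1) + ((n * 1 + 1) + (n * (1 + d * 1) + (m * (d * 1) + (d * 2 + d * 2))))) ≡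
        L * (n + suc m) + 1 + 2 * n + (n + m) * d + 5 * d
      rearrange = solve-∀
      slack : ∀ L n m d → suc L * (n + suc m) * (5 + 2 * d) + suc (d + d) * (5 + 2 * d) ≡
        (L * (n + suc m) + 1 + 2 * n + (n + m) * d + 5 * d) +
        (L * (n + suc m) * (4 + 2 * d) + (n + suc m) * 2 + (n + suc m) * d + n + 3 * m + 7 + 8 * d + d * d * 4)
      slack = solve-∀
      total : ∀ L n m d → L * (n + suc m) + 1 + 2 * n + (n + m) * d + 5 * d ≤
        (suc L * (n + suc m) + suc (d + d)) * (5 + 2 * d)
      total L n m d = ≤-trans (m≤m+n _ _) (≤-reflexive (sym (trans
        (*-distribʳ-+ (5 + 2 * d) (suc L * (n + suc m)) (suc (d + d))) (slack L n m d))))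

    encodePair : Pair → Edge N
    encodePair (u , v) = encode u , encode v

    encodePair-injective : ∀ {e e′} → encodePair e ≡ encodePair e′ → e ≡ e′
    encodePair-injective eq₁ = cong₂ _,_ (encode-injective (cong proj₁ eq₁)) (encode-injective (cong proj₂ eq₁))

    initialGraph : Mode → Graph N
    initialGraph mode = map encodePair (initial mode)

    initialGraph-unique : ∀ mode → Unique (initialGraph mode)
    initialGraph-unique mode = Unique.map⁺ encodePair-injective (initial-unique mode)

    target : Mode → (Fin d → Bool) → Fin d → Vertex
    target inserting w = crossing w
    target deleting  w = crossing (not ∘ w)

    requested : Mode → (Fin d → Bool) → Fin d → Pair
    requested mode w i = inn i , target mode w i

    updateRequest : Mode → (Fin d → Bool) → Fin d → Request N
    updateRequest inserting w i = insert (encodePair (requested inserting w i))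
    updateRequest deleting  w i = delete (encodePair (requested deleting w i))

    requests : Mode → (Fin d → Bool) → List (Request N)
    requests mode w = List.tabulate (updateRequest mode w)

    -- Either mode ends with exactly one edge leaving each `inn i`, the one prescribed by w i: it is
    -- the edge inserted, or the one that remains when its counterpart is deleted.
    legal : ∀ {σ} M mode → Supports σ mode → d + length (initial mode) ≤ M → ∀ w →
            ∃[ G′ ] Legal σ M (initialGraph mode) (requests mode w) G′ × Realizes w G′
    legal {σ} M mode ok len w = go mode ok len
      where
      edges : Mode → List (Edge N)
      edges mode = List.tabulate (encodePair ∘ requested mode w)
      requested-injective : ∀ mode {i j} → encodePair (requested mode w i) ≡ encodePair (requested mode w j) → i ≡ j
      requested-injective mode {i} {j} e with encodePair-injective {requested mode w i} {requested mode w j} e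
      ... | e′ = inn-injective (cong proj₁ e′)
        where
        inn-injective : ∀ {i j} → inn i ≡ inn j → i ≡ j
        inn-injective refl = refl
      edges-unique : ∀ mode → Unique (edges mode)
      edges-unique mode = Unique.tabulate⁺ (requested-injective mode)
      graph⁻ : ∀ mode {a b} → (a , b) ∈ initialGraph mode →
        ∃[ u ] ∃[ v ] (a ≡ encode u × b ≡ encode v × (u , v) ∈ initial mode)
      graph⁻ mode e∈ with (u , v) , uv∈ , refl ← ∈-map⁻ encodePair e∈ = u , v , refl , refl , uv∈
      no-cross : ∀ {i v} → ¬ Edgeˢ (inn i) v
      no-cross ()
      decoded : ∀ {u v} → Edgeʷ w u v → Edgeʷ w (decode (encode u)) (decode (encode v))
      decoded {u} {v} = subst₂ (Edgeʷ w) (sym (decode-encode u)) (sym (decode-encode v))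
      crossing-cases : ∀ i {v} → v ≡ out i ⊎ v ≡ inn i → v ≢ crossing (not ∘ w) i → v ≡ crossing w i
      crossing-cases i v≡ ne with w i
      crossing-cases i (inj₁ v≡) ne | true  = v≡
      crossing-cases i (inj₂ v≡) ne | true  = contradiction v≡ ne
      crossing-cases i (inj₁ v≡) ne | false = contradiction v≡ ne
      crossing-cases i (inj₂ v≡) ne | false = v≡
      crossing-differs : ∀ i → crossing w i ≢ crossing (not ∘ w) i
      crossing-differs i e with w i
      crossing-differs i () | true
      crossing-differs i () | false

      go : ∀ mode → Supports σ mode → d + length (initial mode) ≤ M →
           ∃[ G′ ] Legal σ M (initialGraph mode) (requests mode w) G′ × Realizes w G′
      go inserting ok len = insertAll (edges inserting) (initialGraph inserting) ,
        subst (λ rs → Legal σ M (initialGraph inserting) rs (insertAll (edges inserting) (initialGraph inserting)))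
          (List.map-tabulate (encodePair ∘ requested inserting w) insert)
          (legal-insert {σ} {N} {M} ok (edges inserting) (initialGraph inserting) (edges-unique inserting) fresh
            (≤-trans (≤-reflexive (cong₂ _+_ (List.length-tabulate (encodePair ∘ requested inserting w))
               (List.length-map encodePair (initial inserting)))) len)) ,
        record { sound = sound ; complete = complete }
        where
        fresh : ∀ {e} → e ∈ edges inserting → e ∉ initialGraph inserting
        fresh e∈ e∈G with i , refl ← ∈-tabulate⁻ e∈
          with u , v , u≡ , v≡ , uv∈ ← graph⁻ inserting e∈G
          with refl ← encode-injective {inn i} {u} u≡
          with ∈initial⁻ inserting uv∈
        ... | inj₁ s = no-cross s
        sound : ∀ {a b} → (a , b) ∈ insertAll (edges inserting) (initialGraph inserting) → Edgeʷ w (decode a) (decode b)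
        sound e∈ with ∈-insertAll⁻ (edges inserting) e∈
        ... | inj₁ e∈ with i , refl ← ∈-tabulate⁻ e∈ = decoded (cross i)
        ... | inj₂ e∈ with u , v , refl , refl , uv∈ ← graph⁻ inserting e∈ with ∈initial⁻ inserting uv∈
        ...   | inj₁ s = decoded (static s)
        complete : ∀ {u v} → Edgeʷ w u v → (encode u , encode v) ∈ insertAll (edges inserting) (initialGraph inserting)
        complete (static s) = ∈-insertAll⁺ (edges inserting) (inj₂ (∈-map⁺ encodePair (∈initial⁺ inserting s)))
        complete (cross i)  = ∈-insertAll⁺ (edges inserting) (inj₁ (∈-tabulate⁺ {f = encodePair ∘ requested inserting w} i))
      go deleting ok len = deleteAll (edges deleting) (initialGraph deleting) ,
        subst (λ rs → Legal σ M (initialGraph deleting) rs (deleteAll (edges deleting) (initialGraph deleting)))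
          (List.map-tabulate (encodePair ∘ requested deleting w) delete)
          (legal-delete {σ} {N} {M} ok (edges deleting) (initialGraph deleting) (edges-unique deleting) present) ,
        record { sound = sound ; complete = complete }
        where
        present : ∀ {e} → e ∈ edges deleting → e ∈ initialGraph deleting
        present e∈ with i , refl ← ∈-tabulate⁻ e∈ = ∈-map⁺ encodePair (crossing∈initial (not ∘ w) i)
        kept : ∀ i {v} → v ≡ out i ⊎ v ≡ inn i → encodePair (inn i , v) ∉ edges deleting → Edgeʷ w (inn i) v
        kept i v≡ e∉ = subst (Edgeʷ w (inn i)) (sym (crossing-cases i v≡ λ e →
          e∉ (subst (λ v → encodePair (inn i , v) ∈ edges deleting) (sym e)
            (∈-tabulate⁺ {f = encodePair ∘ requested deleting w} i)))) (cross i)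
        sound : ∀ {a b} → (a , b) ∈ deleteAll (edges deleting) (initialGraph deleting) → Edgeʷ w (decode a) (decode b)
        sound e∈ with e∈G , e∉ ← ∈-deleteAll⁻ (edges deleting) e∈
          with u , v , refl , refl , uv∈ ← graph⁻ deleting e∈G with ∈initial⁻ deleting uv∈
        ... | inj₁ s = decoded (static s)
        ... | inj₂ c with ∈crossings c
        ...   | (i , inj₁ refl) , _ = decoded (kept i (inj₁ refl) e∉)
        ...   | (i , inj₂ refl) , _ = decoded (kept i (inj₂ refl) e∉)
        complete : ∀ {u v} → Edgeʷ w u v → (encode u , encode v) ∈ deleteAll (edges deleting) (initialGraph deleting)
        complete (static s) = ∈-deleteAll⁺ (edges deleting) (∈-map⁺ encodePair (∈initial⁺ deleting s)) λ e∈ →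
          let i , e = ∈-tabulate⁻ e∈ in no-cross (subst (λ u → Edgeˢ u _) (encode-injective (cong proj₁ e)) s)
        complete (cross i) = ∈-deleteAll⁺ (edges deleting) (∈-map⁺ encodePair (crossing∈initial w i)) λ e∈ →
          let j , e = ∈-tabulate⁻ e∈ in differs j (encodePair-injective {inn i , crossing w i} {requested deleting w j} e)
          where
          differs : ∀ j → (inn i , crossing w i) ≢ requested deleting w j
          differs j e with refl ← cong proj₁ e = crossing-differs i (cong proj₂ e)

  -- Generators for the edges

  infixl 6 _⊕_
  infixl 7 _⊗_

  _⊕_ _⊗_ : Expr → Expr → Expr
  _⊕_ = bin plus
  _⊗_ = bin times

  -- Registers: 0 n, 1 m, 2 the number of phases, 3 d, 4 L, 5 S, 6 L S,
  -- 7 the hub, 8 the first inn, 9 the first out, 10 N, 11 the threshold.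
  parameters : (n m K d L : ℕ) → List ℕ
  parameters n m K d L = n ∷ m ∷ K ∷ d ∷ L ∷ S ∷ L * S ∷ L * S + S ∷ L * S + S + 1 ∷
    L * S + S + 1 + d ∷ L * S + S + 1 + d + d ∷ L + L + 1 ∷ []
    where
    S : ℕ
    S = n + (m + 1)

  -- Variables 12 and 13 are the counters of the outer and the inner loop, since the parameters
  -- occupy the registers 0 to 11.
  upsGen startsGen exitsGen leavesGen middlesGen crossingsGen : Gen
  upsGen = loop 4 (loop 5 (emit (var 5 ⊗ var 12 ⊕ var 13) (var 5 ⊗ var 12 ⊕ var 13 ⊕ var 5)))
  startsGen = loop 0 (emit (var 7) (var 12)) ▹ emit (var 7) (var 0)
  exitsGen = loop 0 (emit (var 6 ⊕ var 12) (var 7) ▹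
    loop 3 (guard (cell 0 (var 12 ⊗ var 3 ⊕ var 13)) (emit (var 6 ⊕ var 12) (var 8 ⊕ var 13))))
  leavesGen = loop 1 (loop 3 (guard (cell 1 (var 12 ⊗ var 3 ⊕ var 13))
    (emit (var 9 ⊕ var 13) (var 0 ⊕ lit 1 ⊕ var 12))))
  middlesGen = loop 3 (emit (var 6 ⊕ var 0) (var 8 ⊕ var 12) ▹ emit (var 6 ⊕ var 0) (var 9 ⊕ var 12))
  crossingsGen = loop 3 (emit (var 8 ⊕ var 12) (var 9 ⊕ var 12) ▹ emit (var 8 ⊕ var 12) (var 8 ⊕ var 12))

  -- `guard (lit 0)` plays the part of the empty generator.
  dynamicGen graphGen : Mode → Gen
  dynamicGen inserting = guard (lit 0) crossingsGen
  dynamicGen deleting  = crossingsGen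
  graphGen mode = upsGen ▹ startsGen ▹ exitsGen ▹ leavesGen ▹ middlesGen ▹ dynamicGen mode

  -- Register arithmetic has to reproduce the numbers assigned by `encode`: the lines level by
  -- level, then the hub, then all `inn`, then all `out`.
  module Numbering (n m K d L : ℕ) (U : Fin n → Fin d → Bool) (V : Fin m → Fin d → Bool)
    (input : Arrays)
    (inputU : ∀ x i → input 0 (toℕ x * d + toℕ i) ≡ bit (U x i))
    (inputV : ∀ y i → input 1 (toℕ y * d + toℕ i) ≡ bit (V y i)) where

    open EdgeLists n m d L U V public
    open Expressions input
    open Meaning input

    ℓ : List ℕ
    ℓ = parameters n m K d L

    env : ℕ → ℕ
    env = cells 0 ℓ

    number : Vertex → ℕ
    number v = toℕ (encode v)

    numbers : Pair → ℕ × ℕ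
    numbers (u , v) = number u , number v

    number-S : env 5 ≡ S
    number-S = cong (n +_) (+-comm m 1)

    number-at : ∀ j c → number (at j c) ≡ env 5 * toℕ j + toℕ (encodeLine c)
    number-at j c = trans (Fin.toℕ-↑ˡ (combine j (encodeLine c)) (suc (d + d)))
      (trans (Fin.toℕ-combine j (encodeLine c)) (cong (λ s → s * toℕ j + toℕ (encodeLine c)) (sym number-S)))

    line-left : ∀ x → toℕ (encodeLine (left x)) ≡ toℕ x
    line-left x = Fin.toℕ-↑ˡ x (suc m)

    line-middle : toℕ (encodeLine middle) ≡ n
    line-middle = trans (Fin.toℕ-↑ʳ n zero) (+-identityʳ n)

    line-right : ∀ y → toℕ (encodeLine (right y)) ≡ n + 1 + toℕ y
    line-right y = trans (Fin.toℕ-↑ʳ n (suc y)) (sym (+-assoc n 1 (toℕ y)))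

    number-up : ∀ (j : Fin L) x → numbers (at (inject₁ j) (decodeLine x) , at (suc j) (decodeLine x)) ≡
      (env 5 * toℕ j + toℕ x , env 5 * toℕ j + toℕ x + env 5)
    number-up j x = cong₂ _,_
      (trans (number-at (inject₁ j) (decodeLine x))
        (cong₂ (λ a b → env 5 * a + toℕ b) (Fin.toℕ-inject₁ j) (encode-decodeLine x)))
      (trans (number-at (suc j) (decodeLine x)) (trans (cong (λ b → env 5 * suc (toℕ j) + toℕ b) (encode-decodeLine x))
        (rearrange (env 5) (toℕ j) (toℕ x))))
      where
      rearrange : ∀ s a b → s * suc a + b ≡ s * a + b + s
      rearrange = solve-∀

    number-bottom : ∀ c → number (at zero c) ≡ toℕ (encodeLine c)
    number-bottom c = trans (number-at zero c) (cong (_+ toℕ (encodeLine c)) (*-zeroʳ (env 5)))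

    number-top : ∀ c → number (at top c) ≡ env 6 + toℕ (encodeLine c)
    number-top c = trans (number-at top c) (cong (_+ toℕ (encodeLine c))
      (trans (cong (env 5 *_) (Fin.toℕ-fromℕ L)) (*-comm (env 5) L)))

    blocks : suc L * S ≡ env 7
    blocks = trans (cong (suc L *_) (sym number-S)) (+-comm (env 5) (L * env 5))

    number-tail : ∀ x → toℕ (tail x) ≡ env 7 + toℕ x
    number-tail x = trans (Fin.toℕ-↑ʳ (suc L * S) x) (cong (_+ toℕ x) blocks)

    number-hub : number hub ≡ env 7
    number-hub = trans (number-tail zero) (+-identityʳ (env 7))

    number-inn : ∀ i → number (inn i) ≡ env 8 + toℕ i
    number-inn i = trans (number-tail (suc (i ↑ˡ d))) (trans (cong (λ z → env 7 + suc z) (Fin.toℕ-↑ˡ i d))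
      (sym (+-assoc (env 7) 1 (toℕ i))))

    number-out : ∀ i → number (out i) ≡ env 9 + toℕ i
    number-out i = trans (number-tail (suc (d ↑ʳ i))) (trans (cong (λ z → env 7 + suc z) (Fin.toℕ-↑ʳ d i))
      (rearrange (env 7) d (toℕ i)))
      where
      rearrange : ∀ h d i → h + suc (d + i) ≡ h + 1 + d + i
      rearrange = solve-∀

    number-N : N ≡ env 10
    number-N = trans (cong (_+ suc (d + d)) blocks) (rearrange (env 7) d)
      where
      rearrange : ∀ h d → h + suc (d + d) ≡ h + 1 + d + d
      rearrange = solve-∀

    map-if : ∀ b (e : Pair) {x} → x ≡ bit b → map numbers (if b then e ∷ [] else []) ≡
             (if x ≡ᵇ 0 then [] else numbers e ∷ [])
    map-if true  e refl = refl
    map-if false e refl = refl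

    ups-numbers : map numbers ups ≡ ⟦ upsGen ⟧ᵍ ℓ
    ups-numbers = map-gatherF numbers L _ λ j → trans
      (map-gatherF numbers S _ λ x → cong (_∷ []) (number-up j x))
      (cong (λ s → gather s λ x → (env 5 * toℕ j + x , env 5 * toℕ j + x + env 5) ∷ []) (sym number-S))

    starts-numbers : map numbers starts ≡ ⟦ startsGen ⟧ᵍ ℓ
    starts-numbers = trans (List.map-++ numbers (gatherF n (λ x → (hub , at zero (left x)) ∷ [])) _) (cong₂ _++_
      (map-gatherF numbers n _ λ x → cong (_∷ []) (cong₂ _,_ number-hub (trans (number-bottom (left x)) (line-left x))))
      (cong (_∷ []) (cong₂ _,_ number-hub (trans (number-bottom middle) line-middle))))

    number-source : ∀ x → number (at top (left x)) ≡ env 6 + toℕ x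
    number-source x = trans (number-top (left x)) (cong (env 6 +_) (line-left x))

    exits-numbers : map numbers exits ≡ ⟦ exitsGen ⟧ᵍ ℓ
    exits-numbers = map-gatherF numbers n _ λ x → cong₂ _∷_ (cong₂ _,_ (number-source x) number-hub)
      (map-gatherF numbers d _ λ i → trans (map-if (U x i) _ (inputU x i))
        (cong (λ e → if input 0 (toℕ x * d + toℕ i) ≡ᵇ 0 then [] else e ∷ [])
          (cong₂ _,_ (number-source x) (number-inn i))))

    leaves-numbers : map numbers leaves ≡ ⟦ leavesGen ⟧ᵍ ℓ
    leaves-numbers = map-gatherF numbers m _ λ y → map-gatherF numbers d _ λ i →
      trans (map-if (V y i) _ (inputV y i))
        (cong (λ e → if input 1 (toℕ y * d + toℕ i) ≡ᵇ 0 then [] else e ∷ [])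
          (cong₂ _,_ (number-out i) (trans (number-bottom (right y)) (line-right y))))

    number-middle : number (at top middle) ≡ env 6 + n
    number-middle = trans (number-top middle) (cong (env 6 +_) line-middle)

    middles-numbers : map numbers middles ≡ ⟦ middlesGen ⟧ᵍ ℓ
    middles-numbers = map-gatherF numbers d _ λ i → cong₂ (λ a b → a ∷ b ∷ [])
      (cong₂ _,_ number-middle (number-inn i)) (cong₂ _,_ number-middle (number-out i))

    crossings-numbers : map numbers crossings ≡ ⟦ crossingsGen ⟧ᵍ ℓ
    crossings-numbers = map-gatherF numbers d _ λ i → cong₂ (λ a b → a ∷ b ∷ [])
      (cong₂ _,_ (number-inn i) (number-out i)) (cong₂ _,_ (number-inn i) (number-inn i))

    dynamic-numbers : ∀ mode → map numbers (dynamic mode) ≡ ⟦ dynamicGen mode ⟧ᵍ ℓ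
    dynamic-numbers inserting = refl
    dynamic-numbers deleting  = crossings-numbers

    initial-numbers : ∀ mode → map numbers (initial mode) ≡ ⟦ graphGen mode ⟧ᵍ ℓ
    initial-numbers mode = append ups ups-numbers (append starts starts-numbers (append exits exits-numbers
      (append leaves leaves-numbers (append middles middles-numbers (dynamic-numbers mode)))))
      where
      append : ∀ es {es′ xs ys} → map numbers es ≡ xs → map numbers es′ ≡ ys → map numbers (es ++ es′) ≡ xs ++ ys
      append es {es′} e e′ = trans (List.map-++ numbers es es′) (cong₂ _++_ e e′)

    initialGraph-tails : ∀ mode → map (toℕ ∘ proj₁) (initialGraph mode) ≡ map proj₁ (⟦ graphGen mode ⟧ᵍ ℓ)
    initialGraph-tails mode = trans (sym (List.map-∘ (initial mode)))
      (trans (List.map-∘ (initial mode)) (cong (map proj₁) (initial-numbers mode)))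

    initialGraph-heads : ∀ mode → map (toℕ ∘ proj₂) (initialGraph mode) ≡ map proj₂ (⟦ graphGen mode ⟧ᵍ ℓ)
    initialGraph-heads mode = trans (sym (List.map-∘ (initial mode)))
      (trans (List.map-∘ (initial mode)) (cong (map proj₂) (initial-numbers mode)))

    initialGraph-length : ∀ mode → length (initialGraph mode) ≡ length (⟦ graphGen mode ⟧ᵍ ℓ)
    initialGraph-length mode = trans (List.length-map encodePair (initial mode))
      (trans (sym (List.length-map numbers (initial mode))) (cong length (initial-numbers mode)))

  -- Probability

  module _ {A : Set} where

    pigeonhole : ∀ {xs ys : List A} → Unique xs → (∀ {x} → x ∈ xs → x ∈ ys) → length xs ≤ length ys
    pigeonhole {[]}     _               _     = z≤n
    pigeonhole {x ∷ xs} (x∉xs ∷ unique) xs⊆ys with as , bs , refl ← ∈-∃++ (xs⊆ys (here refl)) = begin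
      suc (length xs)            ≤⟨ s≤s (pigeonhole unique λ y∈xs → remove y∈xs (∈-++⁻ as (xs⊆ys (there y∈xs)))) ⟩
      suc (length (as ++ bs))    ≡⟨ cong suc (List.length-++ as) ⟩
      suc (length as + length bs) ≡⟨ +-suc (length as) (length bs) ⟨
      length as + suc (length bs) ≡⟨ List.length-++ as ⟨
      length (as ++ x ∷ bs)      ∎
      where
      open ≤-Reasoning
      remove : ∀ {y} → y ∈ xs → y ∈ as ⊎ y ∈ x ∷ bs → y ∈ as ++ bs
      remove y∈xs (inj₁ y∈as)         = ∈-++⁺ˡ y∈as
      remove y∈xs (inj₂ (here refl))  = contradiction y∈xs (All.All¬⇒¬Any x∉xs)
      remove y∈xs (inj₂ (there y∈bs)) = ∈-++⁺ʳ as y∈bs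

    filter-length : ∀ {P : A → Set} (P? : Decidable P) xs →
                    length (filter P? xs) + length (filter (¬? ∘ P?) xs) ≡ length xs
    filter-length P? []       = refl
    filter-length P? (x ∷ xs) with P? x
    ... | yes _ = cong suc (filter-length P? xs)
    ... | no _  = trans (+-suc _ _) (cong suc (filter-length P? xs))

  bitVectors : ∀ N → List (Vec Bool N)
  bitVectors zero    = [] ∷ []
  bitVectors (suc N) = List.map (true ∷_) (bitVectors N) ++ List.map (false ∷_) (bitVectors N)

  ∈-bitVectors : ∀ {N} (v : Vec Bool N) → v ∈ bitVectors N
  ∈-bitVectors []          = here refl
  ∈-bitVectors {suc N} (true ∷ v)  = ∈-++⁺ˡ (∈-map⁺ (true ∷_) (∈-bitVectors v))
  ∈-bitVectors {suc N} (false ∷ v) = ∈-++⁺ʳ (List.map (true ∷_) (bitVectors N)) (∈-map⁺ (false ∷_) (∈-bitVectors v))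

  bitVectors-length : ∀ N → length (bitVectors N) ≡ 2 ^ N
  bitVectors-length zero    = refl
  bitVectors-length (suc N) = trans (List.length-++ (List.map (true ∷_) (bitVectors N)))
    (trans (cong₂ _+_ (half true) (half false)) (cong (2 ^ N +_) (sym (+-identityʳ (2 ^ N)))))
    where
    half : ∀ b → length (List.map (b ∷_) (bitVectors N)) ≡ 2 ^ N
    half b = trans (List.length-map (b ∷_) (bitVectors N)) (bitVectors-length N)

  bitVectors-unique : ∀ N → Unique (bitVectors N)
  bitVectors-unique zero    = [] ∷ []
  bitVectors-unique (suc N) = Unique.++⁺ (half true) (half false) disjoint
    where
    half : ∀ b → Unique (List.map (b ∷_) (bitVectors N))
    half b = Unique.map⁺ Vec.∷-injectiveʳ (bitVectors-unique N)
    disjoint : ∀ {v} → ¬ (v ∈ List.map (true ∷_) (bitVectors N) × v ∈ List.map (false ∷_) (bitVectors N))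
    disjoint (p , q) with ∈-map⁻ (true ∷_) p | ∈-map⁻ (false ∷_) q
    ... | _ , _ , refl | _ , _ , ()

  unique-length : ∀ {N} {xs : List (Vec Bool N)} → Unique xs → length xs ≤ 2 ^ N
  unique-length {N} unique = ≤-trans (pigeonhole unique λ {v} _ → ∈-bitVectors v) (≤-reflexive (bitVectors-length N))

  module _ {N : ℕ} where

    open import Data.List.Membership.DecPropositional (Vec.≡-dec {n = N} Bool._≟_) using (_∈?_)

    -- The tapes of L outside `L₀` are disjoint from `L₀`, so together they number at most `2 ^ N`.
    -- Passing to the intersection therefore adds at most 1/y to the failure probability, which
    -- after K events is at most K/y.
    intersection : ∀ y K (P : Fin K → Vec Bool N → Set) → (∀ k → ErrorAtMost1/ y (P k)) →
      ∃[ L ] Unique L × All (λ ρ → ∀ k → P k ρ) L × y * 2 ^ N ≤ y * length L + K * 2 ^ N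
    intersection y zero P errors = bitVectors N , bitVectors-unique N , All.universal (λ _ ()) _ ,
      ≤-reflexive (trans (cong (y *_) (sym (bitVectors-length N))) (sym (+-identityʳ _)))
    intersection y (suc K) P errors
      with L₀ , unique₀ , all₀ , error₀ ← errors zero
      with L , unique , all , error ← intersection y K (P ∘ suc) (errors ∘ suc)
      = I , Unique.filter⁺ (_∈? L₀) unique , All.tabulate good , bound
      where
      I D : List (Vec Bool N)
      I = filter (_∈? L₀) L
      D = filter (¬? ∘ (_∈? L₀)) L
      good : ∀ {ρ} → ρ ∈ I → ∀ k → P k ρ
      good ρ∈I zero    = All.lookup all₀ (proj₂ (∈-filter⁻ (_∈? L₀) {xs = L} ρ∈I))
      good ρ∈I (suc k) = All.lookup all (proj₁ (∈-filter⁻ (_∈? L₀) {xs = L} ρ∈I)) k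
      D+L₀ : length D + length L₀ ≤ 2 ^ N
      D+L₀ = ≤-trans (≤-reflexive (sym (List.length-++ D))) (unique-length (Unique.++⁺
        (Unique.filter⁺ (¬? ∘ (_∈? L₀)) unique) unique₀
        λ (p , q) → proj₂ (∈-filter⁻ (¬? ∘ (_∈? L₀)) {xs = L} p) q))
      bound : y * 2 ^ N ≤ y * length I + suc K * 2 ^ N
      bound = +-cancelʳ-≤ (y * 2 ^ N) _ _ (begin
        y * 2 ^ N + y * 2 ^ N
          ≤⟨ +-mono-≤ error error₀ ⟩
        (y * length L + K * 2 ^ N) + (y * length L₀ + 2 ^ N)
          ≡⟨ cong (λ l → (y * l + K * 2 ^ N) + (y * length L₀ + 2 ^ N)) (filter-length (_∈? L₀) L) ⟨
        (y * (length I + length D) + K * 2 ^ N) + (y * length L₀ + 2 ^ N)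
          ≡⟨ rearrange y (length I) (length D) (length L₀) K (2 ^ N) ⟩
        (y * length I + suc K * 2 ^ N) + y * (length D + length L₀)
          ≤⟨ +-monoʳ-≤ (y * length I + suc K * 2 ^ N) (*-monoʳ-≤ y D+L₀) ⟩
        (y * length I + suc K * 2 ^ N) + y * 2 ^ N ∎)
        where
        open ≤-Reasoning
        rearrange : ∀ y i j l k a → (y * (i + j) + k * a) + (y * l + a) ≡ (y * i + suc k * a) + y * (j + l)
        rearrange = solve-∀

    -- The failure probability K/y is at most 1/3 because `K * 3 ≤ y`. In integers this means
    -- dividing by K, which must not be zero.
    union-bound : ∀ y K .{{_ : NonZero K}} (P : Fin K → Vec Bool N → Set) → K * 3 ≤ y →
      (∀ k → ErrorAtMost1/ y (P k)) → ErrorAtMost1/ 3 (λ ρ → ∀ k → P k ρ)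
    union-bound y K P 3K≤y errors
      with L , unique , all , error ← intersection y K P errors
      = L , unique , all , third (≤-total (2 ^ N) (length L))
      where
      a l : ℕ
      a = 2 ^ N
      l = length L
      third : a ≤ l ⊎ l ≤ a → 3 * a ≤ 3 * l + a
      third (inj₁ a≤l) = ≤-trans (*-monoʳ-≤ 3 a≤l) (m≤m+n _ _)
      -- With b the number of tapes outside L, the error bound says that `y * b ≤ K * a`; hence
      -- `3 * b ≤ a`.
      third (inj₂ l≤a) = begin
        3 * a            ≡⟨ cong (3 *_) (m+[n∸m]≡n l≤a) ⟨
        3 * (l + b)      ≡⟨ *-distribˡ-+ 3 l b ⟩
        3 * l + 3 * b    ≤⟨ +-monoʳ-≤ (3 * l) (*-cancelˡ-≤ K (begin
          K * (3 * b)  ≡⟨ *-assoc K 3 b ⟨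
          K * 3 * b    ≤⟨ *-monoˡ-≤ b 3K≤y ⟩
          y * b        ≤⟨ +-cancelˡ-≤ (y * l) _ _ (begin
            y * l + y * b  ≡⟨ *-distribˡ-+ y l b ⟨
            y * (l + b)    ≡⟨ cong (y *_) (m+[n∸m]≡n l≤a) ⟩
            y * a          ≤⟨ error ⟩
            y * l + K * a  ∎) ⟩
          K * a        ∎)) ⟩
        3 * l + a        ∎
        where
        open ≤-Reasoning
        b = a ∸ l

  bits-++ : ∀ {N r} (ρ : Vec Bool N) (σ : Vec Bool r) i → i < N → bits ρ i ≡ bits (ρ Vec.++ σ) i
  bits-++ {N} ρ σ i i<N = sym (trans (cong (λ xs → cells false xs i) (Vec.toList-++ ρ σ))
    (cells-++ˡ (Vec.toList ρ) (Vec.toList σ) (subst (i <_) (sym (Vec.length-toList ρ)) i<N)))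

  prefix : ∀ {N M} → N ≤ M → (ρ : Vec Bool M) → ∃[ ρ₀ ] ∀ i → i < N → bits {N} ρ₀ i ≡ bits ρ i
  prefix {N} {M} N≤M ρ with M ∸ N | m+[n∸m]≡n N≤M
  ... | r | refl with ρ₀ , σ , refl ← Vec.splitAt N ρ = ρ₀ , bits-++ ρ₀ σ

  -- Every good short tape has `2 ^ r` extensions, all of them good, where `M = N + r`. The
  -- proportion of good tapes is thus preserved.
  prefix-error : ∀ {y N M} (N≤M : N ≤ M) (P : Vec Bool N → Set) (Q : Vec Bool M → Set) →
    (∀ ρ ρ′ → (∀ i → i < N → bits ρ i ≡ bits ρ′ i) → P ρ → Q ρ′) →
    ErrorAtMost1/ y P → ErrorAtMost1/ y Q
  prefix-error {y} {N} {M} N≤M P Q extend error with M ∸ N | m+[n∸m]≡n N≤M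
  ... | r | refl with L , unique , all , bound ← error =
    L′ , Unique.cartesianProductWith⁺ Vec._++_ (Vec.++-injective _ _) unique (bitVectors-unique r) ,
    All.tabulate good , bound′
    where
    L′ : List (Vec Bool (N + r))
    L′ = cartesianProductWith Vec._++_ L (bitVectors r)
    good : ∀ {ρ} → ρ ∈ L′ → Q ρ
    good ρ∈ with ρ , σ , ρ∈L , _ , refl ← ∈-cartesianProductWith⁻ Vec._++_ L (bitVectors r) ρ∈ =
      extend ρ (ρ Vec.++ σ) (bits-++ ρ σ) (All.lookup all ρ∈L)
    bound′ : y * 2 ^ (N + r) ≤ y * length L′ + 2 ^ (N + r)
    bound′ = begin
      y * 2 ^ (N + r)                       ≡⟨ cong (y *_) (^-distribˡ-+-* 2 N r) ⟩
      y * (2 ^ N * 2 ^ r)                   ≡⟨ *-assoc y (2 ^ N) (2 ^ r) ⟨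
      y * 2 ^ N * 2 ^ r                     ≤⟨ *-monoˡ-≤ (2 ^ r) bound ⟩
      (y * length L + 2 ^ N) * 2 ^ r        ≡⟨ rearrange y (length L) (2 ^ N) (2 ^ r) ⟩
      y * (length L * 2 ^ r) + 2 ^ N * 2 ^ r
        ≡⟨ cong₂ (λ a b → y * a + b) (sym L′-length) (sym (^-distribˡ-+-* 2 N r)) ⟩
      y * length L′ + 2 ^ (N + r)           ∎
      where
      open ≤-Reasoning
      rearrange : ∀ y l a b → (y * l + a) * b ≡ y * (l * b) + a * b
      rearrange = solve-∀
      product-length : ∀ L → length (cartesianProductWith Vec._++_ L (bitVectors r)) ≡ length L * length (bitVectors r)
      product-length []      = refl
      product-length (ρ ∷ L) = trans (List.length-++ (List.map (ρ Vec.++_) (bitVectors r)))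
        (cong₂ _+_ (List.length-map (ρ Vec.++_) (bitVectors r)) (product-length L))
      L′-length : length L′ ≡ length L * 2 ^ r
      L′-length = trans (product-length L) (cong (length L *_) (bitVectors-length r))

  -- The reduction

  setup : ℕ → Program
  setup L =
    assign 4 (lit L) 0 ⨾
    assign 5 (var 0 ⊕ (var 1 ⊕ lit 1)) 0 ⨾
    assign 6 (var 4 ⊗ var 5) 0 ⨾
    assign 7 (var 6 ⊕ var 5) 0 ⨾
    assign 8 (var 7 ⊕ lit 1) 0 ⨾
    assign 9 (var 8 ⊕ var 3) 0 ⨾
    assign 10 (var 9 ⊕ var 3) 0 ⨾
    assign 11 (var 4 ⊕ var 4 ⊕ lit 1) 0

  -- In a phase, registers 12, 13 and 14 hold the index of w, the version and
  -- the coordinate.  Cell 0 of array 3 becomes nonzero once a phase accepts.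
  entry : Expr
  entry = cell 2 (var 12 ⊗ var 3 ⊕ var 14)

  -- The number of `out i` exceeds that of `inn i` by d, so the bit read from w selects between the
  -- two. A deletion removes the wrong edge, hence the complemented bit.
  headExpr : Mode → Expr
  headExpr inserting = var 8 ⊕ var 14 ⊕ var 3 ⊗ entry
  headExpr deleting  = var 8 ⊕ var 14 ⊕ var 3 ⊗ bin minus (lit 1) entry

  putArgument : Reg → Expr → Program
  putArgument x e = assign 42 e 0 ⨾ const 41 0 ⨾ writeOverlay register x

  updating : Mode → Algorithm → Program
  updating inserting A = Algorithm.insertion A
  updating deleting  A = Algorithm.deletion A

  updateStep : Mode → Algorithm → Program
  updateStep mode A = putArgument 0 (var 8 ⊕ var 14) ⨾ putArgument 1 (headExpr mode) ⨾
    translate writeOverlay (updating mode A)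

  test : Program
  test = (const 41 0 ⨾ read register 0 42) ⨾
    ifNZ 42 then (op lt 43 42 11 ⨾ ifNZ 43 then (const 44 1 ⨾ const 41 0 ⨾ store 3 41 44) else skip)
    else skip

  -- The first assignment is the rollback: the new version, one more than the index of w, exceeds
  -- every stamp written so far.
  phase : Mode → Algorithm → Program
  phase mode A = assign 13 (var 12 ⊕ lit 1) 0 ⨾ for 14 3 (updateStep mode A) ⨾
    translate writeOverlay (Algorithm.querying A) ⨾ test

  storeVertices : Program
  storeVertices = const 41 0 ⨾ store (base register 0) 41 10

  preparation : Algorithm → Program
  -- Registers are allocated consecutively, so 12 is filled before the version enters 13. The
  -- version 1 differs from the initial stamps 0.
  preparation A = assign 12 (lit 1) 0 ⨾ assign 13 (lit 1) 0 ⨾ translate writeBase (Algorithm.preprocessing A)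

  program : Mode → Algorithm → ℕ → Program
  program mode A L =
    (setup L ⨾ compile 12 (graphGen mode) ⨾ storeVertices ⨾ preparation A ⨾ for 12 2 (phase mode A)) ⨾
    const 41 0 ⨾ load 0 3 41

  setupCost : ℕ
  setupCost = 60

  -- One sequence of requests in the shape of a loop: states and durations are functions of the
  -- number of updates served, as the invariant in `forT` requires.
  record Phase (A : Algorithm) (w₀ : ℕ) (ρ₀ : ℕ → Bool) {n d : ℕ}
               (s₀ : State) (requests : Fin d → Request n) : Set where
    field
      states    : ℕ → State
      durations : ℕ → ℕ
      final     : State
      time      : ℕ
      begins    : states 0 ≡ s₀
      steps     : ∀ i → Serve A w₀ ρ₀ (requests i) (states (toℕ i)) (durations (toℕ i)) (states (suc (toℕ i)))
      answers   : Eval w₀ ρ₀ (Algorithm.querying A) (states d) time final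

  -- A finite answer m̂ is represented by 1 + m̂, so this says m̂ < 2 L.
  Accepts : ℕ → ℕ → Set
  Accepts L r = r ≢ 0 × r < L + L + 1

  -- Correctness and running time of the program

  module Reduction
    (n m K d L : ℕ) (U : Fin n → Fin d → Bool) (V : Fin m → Fin d → Bool) (W : Fin K → Fin d → Bool)
    (input : Arrays)
    (inputU : ∀ x i → input 0 (toℕ x * d + toℕ i) ≡ bit (U x i))
    (inputV : ∀ y i → input 1 (toℕ y * d + toℕ i) ≡ bit (V y i))
    (inputW : ∀ k i → input 2 (toℕ k * d + toℕ i) ≡ bit (W k i))
    (input≤1 : ∀ A i → input A i ≤ 1)
    (input≡0 : ∀ A i → input (3 + A) i ≡ 0)
    (w : ℕ) (ρ : ℕ → Bool) (1<2^w : 1 < 2 ^ w)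
    (B : ℕ) (2≤B : 2 ≤ B) (B^64<2^w : B ^ 64 < 2 ^ w)
    where

    open Numbering n m K d L U V input inputU inputV
    open Generation input w ρ 1<2^w B 2≤B B^64<2^w input≤1
    open Meaning input

    -- The number of vertices plus the threshold bounds every parameter except the number of phases,
    -- which is compared with B separately.
    M : ℕ
    M = env 10 + env 11

    module _ (M≤B : M ≤ B) (K<B : K < B) where

      N≤B : env 10 ≤ B
      N≤B = ≤-trans (m≤m+n (env 10) (env 11)) M≤B

      env-≤M : ∀ r → r ≢ 2 → env r ≤ M
      env-≤M = bounded
        where
        10≤M : env 10 ≤ M
        10≤M = m≤m+n (env 10) (env 11)
        9≤M : env 9 ≤ M
        9≤M = ≤-trans (m≤m+n (env 9) d) 10≤M
        8≤M : env 8 ≤ M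
        8≤M = ≤-trans (m≤m+n (env 8) d) 9≤M
        7≤M : env 7 ≤ M
        7≤M = ≤-trans (m≤m+n (env 7) 1) 8≤M
        5≤M : env 5 ≤ M
        5≤M = ≤-trans (m≤n+m (env 5) (L * env 5)) 7≤M
        11≤M : env 11 ≤ M
        11≤M = m≤n+m (env 11) (env 10)
        bounded : ∀ r → r ≢ 2 → env r ≤ M
        bounded 0  _ = ≤-trans (m≤m+n n (m + 1)) 5≤M
        bounded 1  _ = ≤-trans (≤-trans (m≤m+n m 1) (m≤n+m (m + 1) n)) 5≤M
        bounded 2 2≢2 = contradiction refl 2≢2
        bounded 3  _ = ≤-trans (m≤n+m d (env 9)) 10≤M
        bounded 4  _ = ≤-trans (≤-trans (m≤m+n L L) (m≤m+n (L + L) 1)) 11≤M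
        bounded 5  _ = 5≤M
        bounded 6  _ = ≤-trans (m≤m+n (env 6) (env 5)) 7≤M
        bounded 7  _ = 7≤M
        bounded 8  _ = 8≤M
        bounded 9  _ = 9≤M
        bounded 10 _ = 10≤M
        bounded 11 _ = 11≤M
        bounded (suc (suc (suc (suc (suc (suc (suc (suc (suc (suc (suc (suc r)))))))))))) _ = z≤n

      small : Small ℓ
      small r with r ≟ 2
      ... | yes refl = <⇒≤ K<B
      ... | no r≢2  = ≤-trans (env-≤M r r≢2) M≤B

      Small-take : ∀ k xs → Small xs → Small (take k xs)
      Small-take k xs sm r = go k xs r (sm r)
        where
        go : ∀ k xs r → cells 0 xs r ≤ B → cells 0 (take k xs) r ≤ B
        go zero    xs       r       p = z≤n
        go (suc k) []       r       p = p
        go (suc k) (x ∷ xs) zero    p = p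
        go (suc k) (x ∷ xs) (suc r) p = go k xs r p

      letSmall : ∀ ℓ′ e {P} → Small ℓ′ → T (length ℓ′ <ᵇ 65) → T (varsBelow (length ℓ′) e) → T (deg e <ᵇ 65) →
        Triple ℓ′ P (assign (length ℓ′) e 0) (size e) (ℓ′ ∷ʳ val (cells 0 ℓ′) e) P
      letSmall ℓ′ e {P} sm len below dg = letT ℓ′ P e (s≤s⁻¹ (<ᵇ⇒< (length ℓ′) 65 len)) below
        (fits (cells 0 ℓ′) e sm (s≤s⁻¹ (<ᵇ⇒< (deg e) 65 dg)))

      L<2^w : L < 2 ^ w
      L<2^w = ≤B⇒<2^w (small 4)

      setupT : ∀ {P} → Triple (take 4 ℓ) P (setup L) setupCost ℓ P
      setupT {P} = weakenT {P = P} {Q = P} (λ _ x → x) (λ _ x → x) (m≤m+n 39 21)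
        (seqT (letT (take 4 ℓ) P (lit L) (m≤m+n 4 60) tt L<2^w)
        (seqT (letSmall (take 5 ℓ) (var 0 ⊕ (var 1 ⊕ lit 1)) (Small-take 5 ℓ small) tt tt tt)
        (seqT (letSmall (take 6 ℓ) (var 4 ⊗ var 5) (Small-take 6 ℓ small) tt tt tt)
        (seqT (letSmall (take 7 ℓ) (var 6 ⊕ var 5) (Small-take 7 ℓ small) tt tt tt)
        (seqT (letSmall (take 8 ℓ) (var 7 ⊕ lit 1) (Small-take 8 ℓ small) tt tt tt)
        (seqT (letSmall (take 9 ℓ) (var 8 ⊕ var 3) (Small-take 9 ℓ small) tt tt tt)
        (seqT (letSmall (take 10 ℓ) (var 9 ⊕ var 3) (Small-take 10 ℓ small) tt tt tt)
              (letSmall (take 11 ℓ) (var 4 ⊕ var 4 ⊕ lit 1) (Small-take 11 ℓ small) tt tt tt))))))))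

      Initial : Arrays → Set
      Initial a = ∀ A i → a A i ≡ input A i

      readOutput : ∀ {ℓ₀ P p c ℓ′ Q} {X : Set} → Triple ℓ₀ P p c ℓ′ Q →
        ∀ S → Holds ℓ₀ S → HasInput (arr S) → P (arr S) → (∀ a → Q a → a 3 0 ≢ 0 ⇔ X) →
        ∃[ t ] ∃[ S′ ] Eval w ρ (p ⨾ const 41 0 ⨾ load 0 3 41) S t S′ × t ≤ c + 2 × (reg S′ 0 ≢ 0 ⇔ X)
      readOutput main S h inp pre output =
        let t , S′ , e , t≤ , _ , _ , post = main .run S h inp pre
        in t + 2 , setReg 0 (arr S′ 3 0) (setReg 41 0 S′) , e ⨾ const (<-trans z<s 1<2^w) ⨾ load ,
           +-monoˡ-≤ 2 t≤ , output (arr S′) post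

      module _ (mode : Mode) where

        G : Graph N
        G = initialGraph mode

        edges : List (ℕ × ℕ)
        edges = ⟦ graphGen mode ⟧ᵍ ℓ

        few-edges : length edges < 2 ^ w
        few-edges = ≤-<-trans (begin
          length edges
            ≡⟨ trans (sym (initialGraph-length mode)) (List.length-map encodePair (initial mode)) ⟩
          length (initial mode)    ≤⟨ m≤n+m _ d ⟩
          d + length (initial mode) ≤⟨ initial-length mode ⟩
          N * (5 + 2 * d)          ≤⟨ *-mono-≤ (≤-trans (≤-reflexive number-N) N≤B)
                                       (+-mono-≤ 5≤ (*-mono-≤ 2≤B (≤-trans (env-≤M 3 λ ()) M≤B))) ⟩
          B * (B ^ 3 + B * B)      ≤⟨ *-monoʳ-≤ B (+-monoʳ-≤ (B ^ 3) (*-monoʳ-≤ B (m≤m*n B B))) ⟩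
          B * (B ^ 3 + B * (B * B)) ≡⟨ rearrange B ⟩
          2 * B ^ 4                ≤⟨ *-monoˡ-≤ (B ^ 4) 2≤B ⟩
          B ^ 5                    ∎) (<2^w {5} (m≤m+n 5 59))
          where
          open ≤-Reasoning
          5≤ : 5 ≤ B ^ 3
          5≤ = ≤-trans (m≤m+n 5 3) (^-monoˡ-≤ 3 2≤B)
          rearrange : ∀ b → b * (b * (b * (b * 1)) + b * (b * b)) ≡ 2 * (b * (b * (b * (b * 1))))
          rearrange = solve-∀

        graphT : Triple ℓ Initial (compile 12 (graphGen mode)) (genCost M (graphGen mode)) ℓ (Encodes input edges)
        graphT = weakenT {P = Encodes input []} {Q = Encodes input edges}
          (λ a init → trans (init 12 0) (input≡0 9 0) , (λ i → trans (init 9 i) (input≡0 6 i)) ,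
            (λ i → trans (init 15 i) (input≡0 12 i)) , λ A i _ _ _ → init A i)
          (λ a x → x) ≤-refl
          (gen-run input M M≤B (graphGen mode) ℓ [] (m≤m+n 13 20) small env-≤M (wf mode) few-edges)
          where
          wf : ∀ mode → T (wellFormed 12 (graphGen mode))
          wf inserting = tt
          wf deleting  = tt

        Loaded : Arrays → Set
        Loaded a = Represents 1 (inputGraph G) a × (∀ κ x i → a (stamp κ x) i ≡ 0) × a 3 0 ≡ 0

        storeVerticesT : Triple ℓ (Encodes input edges) storeVertices 2 ℓ Loaded
        storeVerticesT .run S h inp (count , tails , heads , rest) =
          2 , S′ , const (<-trans z<s 1<2^w) ⨾ store , ≤-refl ,
          holds-≥50′ , inp′ , (registers , arrays) , stamps , trans (rest 3 0 (λ ()) (λ ()) (λ ())) (input≡0 0 0)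
          where
          S′ : State
          -- Array 6 is the base version of register 0.
          S′ = setCell 6 0 (reg S 10) (setReg 41 0 S)
          holds-≥50′ : Holds ℓ S′
          holds-≥50′ r r< = trans (reg-set-other S 0 (>⇒≢ (≤-trans r< (m≤m+n 12 29)))) (h r r<)
          inp′ : HasInput (arr S′)
          inp′ 0 i A<3 = inp 0 i A<3
          inp′ 1 i A<3 = inp 1 i A<3
          inp′ 2 i A<3 = inp 2 i A<3
          inp′ (suc (suc (suc _))) i (s≤s (s≤s (s≤s ())))
          stamps : ∀ κ x i → arr S′ (stamp κ x) i ≡ 0
          stamps κ x i = trans
            (setVersion-other (arr S) 2 ≤-refl register 0 0 (reg S 10) 0 z≤n κ x i λ ())
            (trans (rest (stamp κ x) i (differs κ x register 1) (differs κ x array 0) (differs κ x array 1))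
              (input≡0 (1 + (offset κ + x * 6)) i))
            where
            differs : ∀ κ x κ′ x′ → version 0 κ x ≢ version 2 κ′ x′
            differs κ x κ′ x′ e with version-injective 0 z≤n 2 ≤-refl {κ} {κ′} {x} {x′} e
            ... | () , _
          unstamped : Unstamped 1 (arr S′)
          unstamped κ x i = cong (_≡ᵇ 1) (stamps κ x i)
          based : ∀ {v} κ x i → v ≡ arr S′ (base κ x) i → v ≡ look 1 (arr S′) κ x i
          based κ x i e = trans e (sym (look-unstamped 1 (arr S′) unstamped κ x i))
          apart : ∀ κ κ′ x x′ → ¬ (κ ≡ κ′ × x ≡ x′) → base κ x ≢ base κ′ x′
          apart κ κ′ x x′ ≢ e = ≢ (proj₂ (version-injective 2 ≤-refl 2 ≤-refl {κ} {κ′} {x} {x′} e))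
          registers : ∀ x → reg (inputGraph G) x ≡ look 1 (arr S′) register x 0
          registers 0 = based register 0 0 (trans number-N (sym (h 10 (m≤m+n 11 1))))
          registers 1 = based register 1 0 (trans (initialGraph-length mode) (sym count))
          registers (suc (suc x)) = based register (suc (suc x)) 0 (sym (trans
            (rest (base register (suc (suc x))) 0
              (apart register register (suc (suc x)) 1 λ ())
              (apart register array (suc (suc x)) 0 λ ())
              (apart register array (suc (suc x)) 1 λ ()))
            (input≡0 _ 0)))
          arrays : ∀ A i → arr (inputGraph G) A i ≡ look 1 (arr S′) array A i
          arrays 0 i = based array 0 i (trans (cong (λ xs → cells 0 xs i) (initialGraph-tails mode)) (sym (tails i)))
          arrays 1 i = based array 1 i (trans (cong (λ xs → cells 0 xs i) (initialGraph-heads mode)) (sym (heads i)))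
          arrays (suc (suc A)) i = based array (suc (suc A)) i (sym (trans
            (rest (base array (suc (suc A))) i
              (apart array register (suc (suc A)) 1 λ ())
              (apart array array (suc (suc A)) 0 λ ())
              (apart array array (suc (suc A)) 1 λ ()))
            (input≡0 _ i)))

        module _ (A : Algorithm) (w₀ : ℕ) (ρ₀ : ℕ → Bool) (w₀≤w : 2 ^ w₀ ≤ 2 ^ w)
          (ρ₀≡ρ : ∀ i → i < 2 ^ w₀ → ρ₀ i ≡ ρ i) where

          module _ {J : ℕ} (Wr : Writer J) (inv-input : ∀ {a} → Writer.Inv Wr a → HasInput a)
            (ℓ′ : List ℕ) (ℓ′<33 : length ℓ′ < 33) (13<ℓ′ : 13 < length ℓ′) (J≡ : cells 0 ℓ′ 13 ≡ J) where

            open Writer Wr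
            open Simulation Wr {w₀} {w} {ρ₀} {ρ} w₀≤w 1<2^w ρ₀≡ρ

            Simulated-state : State → Arrays → Set
            Simulated-state s a = Represents J s a × Inv a

            simulateT : ∀ {p s t s′} → Eval w₀ ρ₀ p s t s′ →
              Triple ℓ′ (Simulated-state s) (translate write p) (20 * t) ℓ′ (Simulated-state s′)
            simulateT e .run S h inp (rep , inv) =
              let t , S′ , e′ , (rep′ , inv′ , _) , near , t≤ = simulate e {S} (rep , inv , trans (h 13 13<ℓ′) J≡)
              in t , S′ , e′ , t≤ , (λ r r< → trans (near r (≤-trans r< (s≤s⁻¹ ℓ′<33))) (h r r<)) ,
                 inv-input inv′ , rep′ , inv′

            putT : ∀ x e s → Small ℓ′ → T (varsBelow (length ℓ′) e) → T (deg e <ᵇ 65) →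
              Triple ℓ′ (Simulated-state s) (assign 42 e 0 ⨾ const 41 0 ⨾ write register x) (size e + 3)
                     ℓ′ (Simulated-state (setReg x (val (cells 0 ℓ′) e) s))
            putT x e s sm below dg .run S h inp (rep , inv)
              with t₁ , S₁ , e₁ , t₁≤ , v₁ , same₁ , refl ←
                assign-run {length ℓ′} {cells 0 ℓ′} (≤-trans (<⇒≤ ℓ′<33) (m≤m+n 33 31)) 42 e 0 S below
                  (fits (cells 0 ℓ′) e sm (s≤s⁻¹ (<ᵇ⇒< (deg e) 65 dg))) h inp
              with h₁ ← (λ r (r< : r < length ℓ′) → trans (same₁ r (≤-trans r< (≤-trans (<⇒≤ ℓ′<33) (m≤m+n 33 31)))
                   (>⇒≢ (≤-trans r< (≤-trans (<⇒≤ ℓ′<33) (m≤m+n 33 9))))) (h r r<))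
              with t₂ , e₂ , t₂≤ ← write-run {w} {ρ} register x (setReg 41 0 S₁) (trans (h₁ 13 13<ℓ′) J≡)
              = t₁ + (1 + t₂) , _ , e₁ ⨾ const (<-trans z<s 1<2^w) ⨾ e₂ , +-mono-≤ t₁≤ (s≤s t₂≤) ,
                (λ r r< → trans (reg-set-other S₁ 0 (>⇒≢ (≤-trans r< (≤-trans (<⇒≤ ℓ′<33) (m≤m+n 33 8))))) (h₁ r r<)) ,
                inv-input inv′ ,
                Represents-setReg {J} {s} {arr S} {effect (arr S) register x 0 (reg S₁ 42)} rep
                  (λ κ′ x′ i′ → trans (look-write (arr S) register x 0 (reg S₁ 42) inv κ′ x′ i′)
                    (cong (λ v → put register x 0 v (look J (arr S)) κ′ x′ i′) v₁)) ,
                inv′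
              where inv′ = Inv-write (arr S) register x 0 (reg S₁ 42) inv

          module _ {t₀ : ℕ} {s₀ : State} (prepared : Eval w₀ ρ₀ (Algorithm.preprocessing A) (inputGraph G) t₀ s₀) where

            Based : Arrays → Set
            Based a = (∀ x → reg s₀ x ≡ a (base register x) 0) × (∀ A i → arr s₀ A i ≡ a (base array A) i)

            preparationT : Triple ℓ Loaded (preparation A) (2 + 20 * t₀) ℓ
              (λ a → Based a × (∀ κ x i → a (stamp κ x) i ≡ 0) × a 3 0 ≡ 0)
            preparationT .run S h inp (rep , stamps , zeroed) =
              let t , S′ , e , t≤ , h′ , inp′ , rep′ , own′ , stamps′ =
                    popT {ℓ′ = ℓ} {v = 1} (popT {ℓ′ = ℓ ∷ʳ 1} {v = 1}
                      (seqT (letSmall ℓ (lit 1) {P} small tt tt tt)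
                      (seqT (letSmall (ℓ ∷ʳ 1) (lit 1) {P} (Small-push ℓ small 1≤B) tt tt tt)
                      (simulateT Wr inv-input (ℓ ∷ʳ 1 ∷ʳ 1) (m≤m+n 15 18) ≤-refl refl prepared))))
                    .run S h inp (rep , (λ _ _ _ → refl) , stamps)
                  base-look = λ κ x i → look-unstamped 1 (arr S′) (λ κ x i → cong (_≡ᵇ 1) (stamps′ κ x i)) κ x i
              in t , S′ , e , t≤ , h′ , inp′ ,
                 ((λ x → trans (proj₁ rep′ x) (base-look register x 0)) ,
                  (λ A i → trans (proj₂ rep′ A i) (base-look array A i))) ,
                 stamps′ , trans (own′ 3 0 ≤-refl) zeroed
              where
              1≤B : 1 ≤ B
              1≤B = ≤-trans (s≤s z≤n) 2≤B
              Wr : Writer 1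
              Wr = baseWriter (arr S)
              P : Arrays → Set
              P a = Represents 1 (inputGraph G) a × Writer.Inv Wr a
              inv-input : ∀ {a} → Writer.Inv Wr a → HasInput a
              inv-input (own , _) A i A<3 = trans (own A i (<-trans A<3 (n<1+n 3))) (inp A i A<3)

            module _ (phases : ∀ k → Phase A w₀ ρ₀ s₀ (updateRequest mode (W k))) where

              response : Fin K → ℕ
              response k = reg (Phase.final (phases k)) 0

              -- Cell 0 of array 3 accumulates the disjunction of the answers; the two components
              -- are its two directions.
              Output : ℕ → ℕ → Set
              Output k v = (v ≢ 0 → ∃[ j ] Accepts L (response j)) ×
                           (∀ j → toℕ j < k → Accepts L (response j) → v ≢ 0)

              -- Between phases the overlays may contain anything. Stamps of at most k make them
              -- invisible to the next phase, which has version `k + 1`.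
              Ready : ℕ → Arrays → Set
              Ready k a = Based a × (∀ κ x i → a (stamp κ x) i ≤ k) × Output k (a 3 0)

              module _ (k : Fin K) where

                open Phase (phases k)

                J : ℕ
                J = toℕ k + 1

                ℓ₁ ℓ₂ : List ℕ
                ℓ₁ = ℓ ∷ʳ toℕ k
                ℓ₂ = ℓ₁ ∷ʳ J

                k<B : toℕ k < B
                k<B = <-trans (Fin.toℕ<n k) K<B

                small₁ : Small ℓ₁
                small₁ = Small-push ℓ small (<⇒≤ k<B)

                small₂ : Small ℓ₂
                small₂ = Small-push ℓ₁ small₁ (≤-trans (≤-reflexive (+-comm (toℕ k) 1)) k<B)

                module _ (a₀ : Arrays) (inp₀ : HasInput a₀) where

                  Wr : Writer J
                  Wr = overlayWriter J a₀

                  inv-input : ∀ {a} → Writer.Inv Wr a → HasInput a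
                  inv-input (own , _) A i A<3 = trans (own A i (<-trans A<3 (n<1+n 3))) (inp₀ A i A<3)

                  In : State → Arrays → Set
                  In s a = Represents J s a × Writer.Inv Wr a

                  served : ∀ mode i {s t s′} → Serve A w₀ ρ₀ (updateRequest mode (W k) i) s t s′ →
                    Eval w₀ ρ₀ (updating mode A) (inputEdge (encodePair (requested mode (W k) i)) s) t s′
                  served inserting i e = e
                  served deleting  i e = e

                  crossing-number : ∀ b i → number (if b then out i else inn i) ≡ env 8 + toℕ i + d * bit b
                  crossing-number true  i = trans (number-out i) (rearrange (env 8) d (toℕ i))
                    where
                    rearrange : ∀ c d i → c + d + i ≡ c + i + d * 1
                    rearrange = solve-∀
                  crossing-number false i = trans (number-inn i)
                    (sym (trans (cong (env 8 + toℕ i +_) (*-zeroʳ d)) (+-identityʳ _)))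

                  bit-not : ∀ b → bit (not b) ≡ 1 ∸ bit b
                  bit-not true  = refl
                  bit-not false = refl

                  head-value : ∀ mode i → number (target mode (W k) i) ≡ val (cells 0 (ℓ₂ ∷ʳ toℕ i)) (headExpr mode)
                  head-value inserting i = trans (crossing-number (W k i) i)
                    (cong (λ b → env 8 + toℕ i + d * b) (sym (inputW k i)))
                  head-value deleting i = trans (crossing-number (not (W k i)) i)
                    (cong (λ b → env 8 + toℕ i + d * b)
                      (trans (bit-not (W k i)) (cong (1 ∸_) (sym (inputW k i)))))

                  wf-head : ∀ mode → T (varsBelow 15 (headExpr mode)) × T (deg (headExpr mode) <ᵇ 65) × size (headExpr mode) ≤ 25
                  wf-head inserting = tt , tt , m≤m+n 18 7
                  wf-head deleting  = tt , tt , m≤m+n 20 5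

                  updateT : ∀ i → Triple (ℓ₂ ∷ʳ toℕ i) (In (states (toℕ i))) (updateStep mode A)
                    (20 * durations (toℕ i) + 40) (ℓ₂ ∷ʳ toℕ i) (In (states (suc (toℕ i))))
                  updateT i = weakenT {P = In (states (toℕ i))} {Q = In (states (suc (toℕ i)))} (λ _ x → x) (λ _ x → x)
                    (cost≤ (size (headExpr mode)) (proj₂ (proj₂ (wf-head mode))))
                    (seqT (putT Wr inv-input ℓ₃ (m≤m+n 16 17) (m≤m+n 14 1) refl
                             0 (var 8 ⊕ var 14) (states (toℕ i)) small₃ tt tt)
                    (seqT (putT Wr inv-input ℓ₃ (m≤m+n 16 17) (m≤m+n 14 1) refl
                             1 (headExpr mode) _ small₃ (proj₁ (wf-head mode)) (proj₁ (proj₂ (wf-head mode))))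
                    (simulateT Wr inv-input ℓ₃ (m≤m+n 16 17) (m≤m+n 14 1) refl
                      (subst (λ s → Eval w₀ ρ₀ (updating mode A) s (durations (toℕ i)) (states (suc (toℕ i))))
                        (cong₂ (λ a b → setReg 1 b (setReg 0 a (states (toℕ i)))) (number-inn i) (head-value mode i))
                        (served mode i (steps i))))))
                    where
                    ℓ₃ : List ℕ
                    ℓ₃ = ℓ₂ ∷ʳ toℕ i
                    small₃ : Small ℓ₃
                    small₃ = Small-push ℓ₂ small₂ (≤-trans (<⇒≤ (Fin.toℕ<n i)) (≤-trans (env-≤M 3 λ ()) M≤B))
                    cost≤ : ∀ z → z ≤ 25 → 5 + 3 + (z + 3 + 20 * durations (toℕ i)) ≤ 20 * durations (toℕ i) + 40
                    cost≤ z z≤ = ≤-trans (+-monoʳ-≤ 8 (+-monoˡ-≤ (20 * durations (toℕ i)) (+-monoˡ-≤ 3 z≤)))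
                      (≤-trans (m≤m+n _ 4) (≤-reflexive (rearrange (20 * durations (toℕ i)))))
                      where
                      rearrange : ∀ x → 8 + (28 + x) + 4 ≡ x + 40
                      rearrange = solve-∀

                  updatesT : Triple ℓ₂ (In s₀) (for 14 3 (updateStep mode A))
                    (3 + sumUpTo (λ q → 20 * durations q + 40 + 4) d) ℓ₂ (In (states d))
                  updatesT = subst (λ s → Triple ℓ₂ (In s) (for 14 3 (updateStep mode A))
                      (3 + sumUpTo (λ q → 20 * durations q + 40 + 4) d) ℓ₂ (In (states d))) begins
                    (forT ℓ₂ 3 (λ q → In (states q)) (updateStep mode A) (λ q → 20 * durations q + 40)
                      (m≤m+n 15 17) (m≤m+n 4 10) (≤B⇒<2^w (≤-trans (env-≤M 3 λ ()) M≤B))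
                      λ q q<d → subst (λ q → Triple (ℓ₂ ∷ʳ q) (In (states q)) (updateStep mode A)
                        (20 * durations q + 40) (ℓ₂ ∷ʳ q) (In (states (suc q)))) (Fin.toℕ-fromℕ< q<d) (updateT (fromℕ< q<d)))

                  queryT : Triple ℓ₂ (In (states d)) (translate writeOverlay (Algorithm.querying A)) (20 * time) ℓ₂ (In final)
                  queryT = simulateT Wr inv-input ℓ₂ (m≤m+n 15 18) ≤-refl refl answers

                  Tested : Arrays → Set
                  Tested a = (∀ κ x i → a (base κ x) i ≡ a₀ (base κ x) i) × (∀ κ x i → a (stamp κ x) i ≤ J) ×
                    (a 3 0 ≢ 0 → a₀ 3 0 ≢ 0 ⊎ Accepts L (response k)) ×
                    (Accepts L (response k) → a 3 0 ≢ 0) × (a₀ 3 0 ≢ 0 → a 3 0 ≢ 0)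

                  testT : Triple ℓ₂ (In final) test 11 ℓ₂ Tested
                  testT .run S h inp (rep , own , bases , stamps) =
                    let t₁ , e₁ , t₁≤ = readRegister-run 0 42 S (h 13 ≤-refl)
                        t₂ , S₂ , e₂ , t₂≤ , h₂ , inp₂ , tested = decide (reg S₁ 42) refl
                    in t₁ + t₂ , S₂ , e₁ ⨾ e₂ , +-mono-≤ t₁≤ t₂≤ , h₂ , inp₂ , tested
                    where
                    open Simulation Wr {w₀} {w} {ρ₀} {ρ} w₀≤w 1<2^w ρ₀≡ρ
                      using (readRegister-run; afterReadRegister; afterReadRegister-≈)
                    S₁ : State
                    S₁ = afterReadRegister 0 42 S
                    h₁ : Holds ℓ₂ S₁
                    h₁ r r< = trans (afterReadRegister-≈ 0 42 S (m≤m+n 32 10) r (≤-trans r< (m≤m+n 14 18))) (h r r<)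
                    r≡ : response k ≡ reg S₁ 42
                    r≡ = proj₁ rep 0
                    limit : reg S₁ 11 ≡ L + L + 1
                    limit = h₁ 11 (m≤m+n 12 2)
                    out≡ : arr S 3 0 ≡ a₀ 3 0
                    out≡ = own 3 0 ≤-refl
                    holds-≥ : ∀ x v S → 14 ≤ x → Holds ℓ₂ S → Holds ℓ₂ (setReg x v S)
                    holds-≥ x v S 14≤x h r r< = trans (reg-set-other S v (>⇒≢ (≤-trans r< 14≤x))) (h r r<)
                    unchanged : ¬ Accepts L (response k) → Tested (arr S)
                    unchanged reject = bases , stamps , (λ nz → inj₁ λ z → nz (trans out≡ z)) ,
                      (λ acc → contradiction acc reject) , λ nz z → nz (trans (sym out≡) z)
                    Rest : Program
                    Rest = ifNZ 42
                      then (op lt 43 42 11 ⨾ ifNZ 43 then (const 44 1 ⨾ const 41 0 ⨾ store 3 41 44) else skip)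
                      else skip
                    Decided : Set
                    Decided = ∃[ t ] ∃[ S₂ ] Eval w ρ Rest S₁ t S₂ × t ≤ 6 × Holds ℓ₂ S₂ × HasInput (arr S₂) × Tested (arr S₂)
                    decide : ∀ r → reg S₁ 42 ≡ r → Decided
                    decide zero e = 2 , S₁ , ifFalse e skip , m≤m+n 2 4 , h₁ , inp , unchanged λ (nz , _) → nz (trans r≡ e)
                    decide (suc r) e with reg S₁ 42 <ᵇ reg S₁ 11 in less
                    ... | false = 4 , setReg 43 0 S₁ ,
                          ifTrue (λ z → contradiction (trans (sym e) z) λ ())
                            (subst (λ b → Eval w ρ (op lt 43 42 11) S₁ 1 (setReg 43 (bit b) S₁)) less (op (bit<2^w _)) ⨾
                              ifFalse refl skip) ,
                          m≤m+n 4 2 , holds-≥ 43 0 S₁ (m≤m+n 14 29) h₁ , inp ,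
                          unchanged λ (_ , lt′) → subst T less (<⇒<ᵇ (subst₂ _<_ r≡ (sym limit) lt′))
                    ... | true = 6 , S₅ ,
                          ifTrue (λ z → contradiction (trans (sym e) z) λ ())
                            (subst (λ b → Eval w ρ (op lt 43 42 11) S₁ 1 (setReg 43 (bit b) S₁)) less (op (bit<2^w _)) ⨾
                              ifTrue (λ ()) (const 1<2^w ⨾ const (<-trans z<s 1<2^w) ⨾ store)) ,
                          ≤-refl ,
                          holds-≥ 41 0 (setReg 44 1 S₃) (m≤m+n 14 27)
                            (holds-≥ 44 1 S₃ (m≤m+n 14 30) (holds-≥ 43 1 S₁ (m≤m+n 14 29) h₁)) ,
                          (λ A i A<3 → trans (setCellA-other (arr S) 3 0 1 A i (>⇒≢ A<3)) (inp A i A<3)) ,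
                          (λ κ x i → trans (unaffected 2 κ x i) (bases κ x i)) ,
                          (λ κ x i → ≤-trans (≤-reflexive (unaffected 0 κ x i)) (stamps κ x i)) ,
                          (λ _ → inj₂ ((λ z → contradiction (trans (sym e) (trans (sym r≡) z)) λ ()) ,
                            subst₂ _<_ (sym r≡) limit (<ᵇ⇒< _ _ (subst T (sym less) tt)))) ,
                          (λ _ ()) , (λ _ ())
                      where
                      S₃ S₅ : State
                      S₃ = setReg 43 1 S₁
                      S₅ = setCell 3 0 1 (setReg 41 0 (setReg 44 1 S₃))
                      unaffected : ∀ c κ x i → arr S₅ (version c κ x) i ≡ arr S (version c κ x) i
                      unaffected c κ x i = setCellA-other (arr S) 3 0 1 (version c κ x) i (≢-sym (version≥4 c κ x ≤-refl))

                phaseCost : ℕ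
                phaseCost = 4 + ((3 + sumUpTo (λ q → 20 * durations q + 40 + 4) d) + (20 * time + 11))

                -- Under the new version all stamps are too old, so every read falls through to the
                -- base. Each phase thus starts in the prepared state `s₀`, whatever the earlier
                -- phases have written.
                phaseT : Triple ℓ₁ (Ready (toℕ k)) (phase mode A) phaseCost ℓ₁ (Ready (suc (toℕ k)))
                phaseT .run S h inp ((based₁ , based₂) , stamps , sound , complete) =
                  let t , S′ , e , t≤ , h′ , inp′ , bases′ , stamps′ , out₁ , out₂ , out₃ =
                        popT {ℓ′ = ℓ₁} {v = J}
                          (seqT (letSmall ℓ₁ (var 12 ⊕ lit 1) {In (arr S) inp s₀} small₁ tt tt tt)
                          (seqT (updatesT (arr S) inp) (seqT (queryT (arr S) inp) (testT (arr S) inp))))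
                          .run S h inp (represents , (λ _ _ _ → refl) , (λ _ _ _ → refl) , λ κ x i → <⇒≤ (stamped κ x i))
                  in t , S′ , e , t≤ , h′ , inp′ ,
                     ((λ x → trans (based₁ x) (sym (bases′ register x 0))) ,
                      (λ A i → trans (based₂ A i) (sym (bases′ array A i)))) ,
                     (λ κ x i → ≤-trans (stamps′ κ x i) (≤-reflexive (+-comm (toℕ k) 1))) ,
                     (λ nz → settle (out₁ nz)) ,
                     λ j j<1+k acc → earlier j acc out₂ out₃ (m≤n⇒m<n∨m≡n (s≤s⁻¹ j<1+k))
                  where
                  stamped : ∀ κ x i → arr S (stamp κ x) i < J
                  stamped κ x i = ≤-<-trans (stamps κ x i) (m<m+n (toℕ k) z<s)
                  unstamped : Unstamped J (arr S)
                  unstamped κ x i = ≢⇒≡ᵇ (<⇒≢ (stamped κ x i))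
                  represents : Represents J s₀ (arr S)
                  represents = (λ x → trans (based₁ x) (sym (look-unstamped J (arr S) unstamped register x 0))) ,
                               λ A i → trans (based₂ A i) (sym (look-unstamped J (arr S) unstamped array A i))
                  settle : arr S 3 0 ≢ 0 ⊎ Accepts L (response k) → ∃[ j ] Accepts L (response j)
                  settle (inj₁ nz)  = sound nz
                  settle (inj₂ acc) = k , acc
                  earlier : ∀ {v} j → Accepts L (response j) → (Accepts L (response k) → v ≢ 0) → (arr S 3 0 ≢ 0 → v ≢ 0) →
                            toℕ j < toℕ k ⊎ toℕ j ≡ toℕ k → v ≢ 0
                  earlier j acc o₂ o₃ (inj₁ j<k) = o₃ (complete j j<k acc)
                  earlier j acc o₂ o₃ (inj₂ j≡k) = o₂ (subst (λ j → Accepts L (response j)) (Fin.toℕ-injective j≡k) acc)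

              module _ (T₁ : ℕ) (within : ∀ k → sumUpTo (Phase.durations (phases k)) d + Phase.time (phases k) ≤ T₁) where

                phaseCost≤ : ∀ k → phaseCost k ≤ 20 * T₁ + d * 44 + 18
                phaseCost≤ k = begin
                  4 + ((3 + sumUpTo (λ q → 20 * durations q + 40 + 4) d) + (20 * time + 11))
                    ≡⟨ cong (λ z → 4 + ((3 + z) + (20 * time + 11))) (sum-affine durations d) ⟩
                  4 + ((3 + (20 * sumUpTo durations d + d * 44)) + (20 * time + 11))
                    ≡⟨ rearrange (sumUpTo durations d) time (d * 44) ⟩
                  20 * (sumUpTo durations d + time) + d * 44 + 18
                    ≤⟨ +-monoˡ-≤ 18 (+-monoˡ-≤ (d * 44) (*-monoʳ-≤ 20 (within k))) ⟩
                  20 * T₁ + d * 44 + 18 ∎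
                  where
                  open ≤-Reasoning
                  open Phase (phases k)
                  sum-affine : ∀ f n → sumUpTo (λ q → 20 * f q + 40 + 4) n ≡ 20 * sumUpTo f n + n * 44
                  sum-affine f zero    = refl
                  sum-affine f (suc n) = trans (cong (20 * f 0 + 40 + 4 +_) (sum-affine (f ∘ suc) n))
                    (affine (f 0) (sumUpTo (f ∘ suc) n) (n * 44))
                    where
                    affine : ∀ a b c → 20 * a + 40 + 4 + (20 * b + c) ≡ 20 * (a + b) + (44 + c)
                    affine = solve-∀
                  rearrange : ∀ a b c → 4 + ((3 + (20 * a + c)) + (20 * b + 11)) ≡ 20 * (a + b) + c + 18
                  rearrange = solve-∀

                loopCost mainCost : ℕ
                loopCost = 3 + K * (20 * T₁ + d * 44 + 18 + 4)
                mainCost = setupCost + (genCost M (graphGen mode) + (2 + ((2 + 20 * t₀) + loopCost)))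

                phasesT : Triple ℓ (Ready 0) (for 12 2 (phase mode A)) loopCost ℓ (Ready K)
                phasesT = subst (λ c → Triple ℓ (Ready 0) (for 12 2 (phase mode A)) (3 + c) ℓ (Ready K))
                  (sumUpTo-const (20 * T₁ + d * 44 + 18 + 4) K)
                  (forT ℓ 2 Ready (phase mode A) (λ _ → 20 * T₁ + d * 44 + 18) (m≤m+n 13 19) (m≤m+n 3 9)
                    (≤B⇒<2^w (<⇒≤ K<B))
                    λ i i<K → subst
                      (λ i → Triple (ℓ ∷ʳ i) (Ready i) (phase mode A) (20 * T₁ + d * 44 + 18) (ℓ ∷ʳ i) (Ready (suc i)))
                      (Fin.toℕ-fromℕ< i<K)
                      (weakenT {P = Ready (toℕ (fromℕ< i<K))} {Q = Ready (suc (toℕ (fromℕ< i<K)))} (λ _ x → x) (λ _ x → x)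
                        (phaseCost≤ (fromℕ< i<K)) (phaseT (fromℕ< i<K))))

                mainT : Triple (take 4 ℓ) Initial
                  (setup L ⨾ compile 12 (graphGen mode) ⨾ storeVertices ⨾ preparation A ⨾ for 12 2 (phase mode A))
                  mainCost ℓ (Ready K)
                mainT = seqT {c = setupCost} {c′ = genCost M (graphGen mode) + (2 + ((2 + 20 * t₀) + loopCost))} setupT
                  (seqT {c = genCost M (graphGen mode)} {c′ = 2 + ((2 + 20 * t₀) + loopCost)} graphT
                  (seqT {c = 2} {c′ = (2 + 20 * t₀) + loopCost} storeVerticesT
                  (seqT {c = 2 + 20 * t₀} {c′ = loopCost}
                    (weakenT (λ _ x → x) ready ≤-refl preparationT) phasesT)))
                  where
                  ready : ∀ a → Based a × (∀ κ x i → a (stamp κ x) i ≡ 0) × a 3 0 ≡ 0 → Ready 0 a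
                  ready a (based , stamps , zeroed) =
                    based , (λ κ x i → ≤-reflexive (stamps κ x i)) , (λ nz → contradiction zeroed nz) , λ _ ()

                program-run : ∃[ t ] ∃[ S′ ] Eval w ρ (program mode A L) ⟨ cells 0 (n ∷ m ∷ K ∷ d ∷ []) , input ⟩ t S′ ×
                  t ≤ mainCost + 2 × (reg S′ 0 ≢ 0 ⇔ (∃[ k ] Accepts L (response k)))
                program-run = readOutput {c = mainCost} {ℓ′ = ℓ} mainT _ (λ _ _ → refl) (λ _ _ _ → refl) (λ _ _ → refl)
                  λ a (_ , _ , sound , complete) → mk⇔ sound λ (j , acc) → complete j (Fin.toℕ<n j) acc

  -- Growth rates

  ^-cancelˡ-≤ : ∀ {m n} e .{{_ : NonZero e}} → m ^ e ≤ n ^ e → m ≤ n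
  ^-cancelˡ-≤ {m} {n} e m^e≤n^e with m ≤? n
  ... | yes m≤n = m≤n
  ... | no m≰n  = contradiction m^e≤n^e (<⇒≱ (^-monoˡ-< e (≰⇒> m≰n)))

  ^-distribʳ-* : ∀ a b e → (a * b) ^ e ≡ a ^ e * b ^ e
  ^-distribʳ-* a b zero    = refl
  ^-distribʳ-* a b (suc e) = trans (cong (a * b *_) (^-distribʳ-* a b e)) (rearrange a b (a ^ e) (b ^ e))
    where
    rearrange : ∀ a b x y → a * b * (x * y) ≡ a * x * (b * y)
    rearrange = solve-∀

  ^-swap : ∀ m a b → (m ^ a) ^ b ≡ (m ^ b) ^ a
  ^-swap m a b = trans (^-*-assoc m a b) (trans (cong (m ^_) (*-comm a b)) (sym (^-*-assoc m b a)))

  n≤n^ : ∀ n e .{{_ : NonZero e}} → n ≤ n ^ e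
  n≤n^ zero    (suc e) = z≤n
  n≤n^ n@(suc _) (suc e) = ≤-trans (≤-reflexive (sym (*-identityʳ n))) (*-monoʳ-≤ n (m^n>0 n e))

  n<2^n : ∀ n → n < 2 ^ n
  n<2^n zero    = ≤-refl
  n<2^n (suc n) = ≤-trans (+-mono-≤ (m^n>0 2 n) (n<2^n n)) (≤-reflexive (cong (2 ^ n +_) (sym (+-identityʳ _))))

  n<2^[1+log] : ∀ n → n < 2 ^ suc ⌊log₂ n ⌋
  n<2^[1+log] n with n <? 2 ^ suc ⌊log₂ n ⌋
  ... | yes lt′ = lt′
  ... | no ≮ = contradiction (≤-trans (≤-reflexive (sym (⌊log₂[2^n]⌋≡n (suc ⌊log₂ n ⌋)))) (⌊log₂⌋-mono-≤ (≮⇒≥ ≮))) 1+n≰n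

  2^log≤n : ∀ n .{{_ : NonZero n}} → 2 ^ ⌊log₂ n ⌋ ≤ n
  2^log≤n n = <-rec (λ n → NonZero n → 2 ^ ⌊log₂ n ⌋ ≤ n) rec n (recover n)
    where
    recover : ∀ n .{{_ : NonZero n}} → NonZero n
    recover (suc n) = _
    twice-half : ∀ n → ⌊ n /2⌋ + ⌊ n /2⌋ ≤ n
    twice-half n = ≤-trans (+-monoʳ-≤ ⌊ n /2⌋ (⌊n/2⌋≤⌈n/2⌉ n)) (≤-reflexive (⌊n/2⌋+⌈n/2⌉≡n n))
    rec : ∀ n → (∀ {m} → m < n → NonZero m → 2 ^ ⌊log₂ m ⌋ ≤ m) → NonZero n → 2 ^ ⌊log₂ n ⌋ ≤ n
    rec 1 ih _ = ≤-refl
    rec n@(suc (suc k)) ih _ = begin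
      2 ^ ⌊log₂ n ⌋                   ≡⟨ cong (2 ^_) (m+[n∸m]≡n {1} 1≤log) ⟨
      2 ^ suc (⌊log₂ n ⌋ ∸ 1)         ≡⟨ cong (λ l → 2 ^ suc l) (⌊log₂⌊n/2⌋⌋≡⌊log₂n⌋∸1 n) ⟨
      2 ^ suc ⌊log₂ ⌊ n /2⌋ ⌋         ≡⟨ cong (2 ^ ⌊log₂ ⌊ n /2⌋ ⌋ +_) (+-identityʳ _) ⟩
      2 ^ ⌊log₂ ⌊ n /2⌋ ⌋ + 2 ^ ⌊log₂ ⌊ n /2⌋ ⌋ ≤⟨ +-mono-≤ half half ⟩
      ⌊ n /2⌋ + ⌊ n /2⌋               ≤⟨ twice-half n ⟩
      n                               ∎
      where
      open ≤-Reasoning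
      half = ih (⌊n/2⌋<n (suc k)) _
      1≤log : 1 ≤ ⌊log₂ n ⌋
      1≤log = ⌊log₂⌋-mono-≤ {2} {n} (s≤s (s≤s z≤n))

  -- (l + 1)^k is bounded through rising k l = (l + 1) ⋯ (l + k), whose
  -- differences in l are multiples of rising (k - 1) (l + 1).
  rising : ℕ → ℕ → ℕ
  rising zero    l = 1
  rising (suc k) l = rising k l * (l + suc k)

  rising-suc : ∀ k l → rising (suc k) (suc l) ≡ rising (suc k) l + suc k * rising k (suc l)
  rising-suc k l = trans (expand k l) (cong (_+ suc k * rising k (suc l)) (shift k l))
    where
    shift : ∀ k l → rising k (suc l) * suc l ≡ rising (suc k) l
    shift zero    l = trans (*-identityˡ (suc l)) (sym (trans (*-identityˡ (l + 1)) (+-comm l 1)))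
    shift (suc k) l = trans (rearrange (rising k (suc l)) (suc l + suc k) (suc l))
      (cong₂ _*_ (shift k l) (sym (+-suc l (suc k))))
      where
      rearrange : ∀ a b c → a * b * c ≡ a * c * b
      rearrange = solve-∀
    expand : ∀ k l → rising k (suc l) * (suc l + suc k) ≡ rising k (suc l) * suc l + suc k * rising k (suc l)
    expand k l = trans (*-distribˡ-+ (rising k (suc l)) (suc l) (suc k)) (cong (rising k (suc l) * suc l +_) (*-comm _ (suc k)))

  -- The first summand pays for the increment in the induction step of `rising-≤`, the second for
  -- its base case.
  factor : ℕ → ℕ
  factor zero    = 1
  factor (suc k) = 2 * (suc k * factor k) + rising (suc k) 0

  rising-≤ : ∀ k l → rising k l ≤ factor k * 2 ^ l
  rising-≤ zero    l       = ≤-trans (m^n>0 2 l) (≤-reflexive (sym (*-identityˡ (2 ^ l))))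
  rising-≤ (suc k) zero    = ≤-trans (m≤n+m _ (2 * (suc k * factor k))) (≤-reflexive (sym (*-identityʳ _)))
  rising-≤ (suc k) (suc l) = begin
    rising (suc k) (suc l)                                 ≡⟨ rising-suc k l ⟩
    rising (suc k) l + suc k * rising k (suc l)
      ≤⟨ +-mono-≤ (rising-≤ (suc k) l) (*-monoʳ-≤ (suc k) (rising-≤ k (suc l))) ⟩
    F * 2 ^ l + suc k * (factor k * (2 * 2 ^ l))
      ≡⟨ cong (F * 2 ^ l +_) (rearrange (suc k) (factor k) (2 ^ l)) ⟩
    F * 2 ^ l + 2 * (suc k * factor k) * 2 ^ l
      ≤⟨ +-monoʳ-≤ (F * 2 ^ l) (*-monoˡ-≤ (2 ^ l) (m≤m+n (2 * (suc k * factor k)) (rising (suc k) 0))) ⟩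
    F * 2 ^ l + F * 2 ^ l                                  ≡⟨ double F (2 ^ l) ⟩
    F * (2 * 2 ^ l)                                        ∎
    where
    open ≤-Reasoning
    F = factor (suc k)
    rearrange : ∀ a b c → a * (b * (2 * c)) ≡ 2 * (a * b) * c
    rearrange = solve-∀
    double : ∀ a c → a * c + a * c ≡ a * (2 * c)
    double = solve-∀

  power-≤-rising : ∀ k l → suc l ^ k ≤ rising k l
  power-≤-rising zero    l = ≤-refl
  power-≤-rising (suc k) l = ≤-trans (≤-reflexive (*-comm (suc l) (suc l ^ k)))
    (*-mono-≤ (power-≤-rising k l) (≤-trans (≤-reflexive (+-comm 1 l)) (+-monoʳ-≤ l (s≤s z≤n))))

  polylog-≤ : ∀ j n .{{_ : NonZero n}} → polylog j n ≤ factor j * n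
  polylog-≤ j n = ≤-trans (power-≤-rising j ⌊log₂ n ⌋)
    (≤-trans (rising-≤ j ⌊log₂ n ⌋) (*-monoʳ-≤ (factor j) (2^log≤n n)))

  1≤polylog : ∀ j n → 1 ≤ polylog j n
  1≤polylog j n = m^n>0 (suc ⌊log₂ n ⌋) j

  -- Bounds in terms of n and of a polylogarithmic d; both sides are raised to
  -- the power Y.
  module Growth (k Y : ℕ) .{{_ : NonZero Y}} where

    record _≲_ (f : ℕ → ℕ → ℕ) (X : ℕ) : Set where
      constructor growth
      field
        multiplier power : ℕ
        bound : ∀ n .{{_ : NonZero n}} d → d ≤ polylog k n → f n d ^ Y ≤ multiplier * polylog power n * n ^ X

    ≲-weaken : ∀ {f X X′} → X ≤ X′ → f ≲ X → f ≲ X′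
    ≲-weaken X≤X′ (growth C j f≲) = growth C j λ n d d≤ →
      ≤-trans (f≲ n d d≤) (*-monoʳ-≤ (C * polylog j n) (^-monoʳ-≤ n X≤X′))

    ≲-const : ∀ c → (λ _ _ → c) ≲ 0
    ≲-const c = growth (c ^ Y) 0 λ n d d≤ → ≤-reflexive (sym (trans (*-identityʳ _) (*-identityʳ _)))

    ≲-n : (λ n _ → n) ≲ Y
    ≲-n = growth 1 0 λ n d d≤ → ≤-reflexive (sym (+-identityʳ _))

    ≲-d : (λ _ d → d) ≲ 0
    ≲-d = growth 1 (k * Y) λ n d d≤ → ≤-trans (^-monoˡ-≤ Y d≤)
      (≤-reflexive (trans (^-*-assoc (suc ⌊log₂ n ⌋) k Y) (sym (trans (*-identityʳ _) (+-identityʳ _)))))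

    ≲-* : ∀ {f g X X′} → f ≲ X → g ≲ X′ → (λ n d → f n d * g n d) ≲ (X + X′)
    ≲-* {f} {g} {X} {X′} (growth C j f≲) (growth C′ j′ g≲) = growth (C * C′) (j + j′) λ n d d≤ → begin
      (f n d * g n d) ^ Y                                   ≡⟨ ^-distribʳ-* (f n d) (g n d) Y ⟩
      f n d ^ Y * g n d ^ Y                                 ≤⟨ *-mono-≤ (f≲ n d d≤) (g≲ n d d≤) ⟩
      (C * polylog j n * n ^ X) * (C′ * polylog j′ n * n ^ X′) ≡⟨ rearrange C C′ (polylog j n) (polylog j′ n) (n ^ X) (n ^ X′) ⟩
      C * C′ * (polylog j n * polylog j′ n) * (n ^ X * n ^ X′)
        ≡⟨ cong₂ (λ a b → C * C′ * a * b) (^-distribˡ-+-* (suc ⌊log₂ n ⌋) j j′) (^-distribˡ-+-* n X X′) ⟨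
      C * C′ * polylog (j + j′) n * n ^ (X + X′)            ∎
      where
      open ≤-Reasoning
      rearrange : ∀ a b p q x y → (a * p * x) * (b * q * y) ≡ a * b * (p * q) * (x * y)
      rearrange = solve-∀

    -- The Y-th power of a sum is bounded through twice the maximum, whence the factor `2 ^ Y`.
    ≲-+ : ∀ {f g X} → f ≲ X → g ≲ X → (λ n d → f n d + g n d) ≲ X
    ≲-+ {f} {g} {X} (growth C j f≲) (growth C′ j′ g≲) = growth (2 ^ Y * (C + C′)) (j + j′) λ n d d≤ →
      ≤-trans (≤-trans (^-monoˡ-≤ Y (sum≤ (f n d) (g n d))) (≤-reflexive (^-distribʳ-* 2 (f n d ⊔ g n d) Y)))
      (≤-trans (*-monoʳ-≤ (2 ^ Y) (max≤ n d d≤ (≤-total (f n d) (g n d))))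
        (≤-reflexive (trans (sym (*-assoc (2 ^ Y) ((C + C′) * polylog (j + j′) n) (n ^ X)))
          (cong (_* n ^ X) (sym (*-assoc (2 ^ Y) (C + C′) (polylog (j + j′) n)))))))
      where
      sum≤ : ∀ a b → a + b ≤ 2 * (a ⊔ b)
      sum≤ a b = +-mono-≤ (m≤m⊔n a b) (≤-trans (m≤n⊔m a b) (≤-reflexive (sym (+-identityʳ _))))
      polylog-mono : ∀ n i l → polylog i n ≤ polylog (i + l) n
      polylog-mono n i l = ^-monoʳ-≤ (suc ⌊log₂ n ⌋) (m≤m+n i l)
      max≤ : ∀ n .{{_ : NonZero n}} d → d ≤ polylog k n → f n d ≤ g n d ⊎ g n d ≤ f n d →
             (f n d ⊔ g n d) ^ Y ≤ (C + C′) * polylog (j + j′) n * n ^ X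
      max≤ n d d≤ (inj₁ f≤g) = ≤-trans (≤-reflexive (cong (_^ Y) (m≤n⇒m⊔n≡n f≤g))) (≤-trans (g≲ n d d≤)
        (*-monoˡ-≤ (n ^ X) (*-mono-≤ (m≤n+m C′ C) (≤-trans (polylog-mono n j′ j) (≤-reflexive (cong (λ i → polylog i n) (+-comm j′ j)))))))
      max≤ n d d≤ (inj₂ g≤f) = ≤-trans (≤-reflexive (cong (_^ Y) (m≥n⇒m⊔n≡m g≤f))) (≤-trans (f≲ n d d≤)
        (*-monoˡ-≤ (n ^ X) (*-mono-≤ (m≤m+n C C′) (polylog-mono n j j′))))

    ≲-^ : ∀ {f X} e → f ≲ X → (λ n d → f n d ^ e) ≲ (e * X)
    ≲-^ zero    f≲ = ≲-const 1
    ≲-^ {f} {X} (suc e) f≲ = ≲-* {f} {λ n d → f n d ^ e} {X} {e * X} f≲ (≲-^ e f≲)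

    -- The number of vertices is n up to a polylogarithm. Substituting it changes the polylogarithm
    -- of the bound but not the exponent.
    ≲-∘ : ∀ {f : ℕ → ℕ} {N : ℕ → ℕ → ℕ} {c} C X → (∀ n d → NonZero (N n d)) →
          (∀ m .{{_ : NonZero m}} → f m ^ Y ≤ C * m ^ X) →
          (∀ n .{{_ : NonZero n}} d → d ≤ polylog k n → N n d ≤ c * polylog k n * n) →
          (λ n d → f (N n d)) ≲ X
    ≲-∘ {f} {N} {c} C X N≢0 f≤ N≤ = growth (C * c ^ X) (k * X) λ n d d≤ → begin
      f (N n d) ^ Y                                ≤⟨ f≤ (N n d) {{N≢0 n d}} ⟩
      C * N n d ^ X                                ≤⟨ *-monoʳ-≤ C (^-monoˡ-≤ X (N≤ n d d≤)) ⟩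
      C * (c * polylog k n * n) ^ X
        ≡⟨ cong (C *_) (trans (^-distribʳ-* (c * polylog k n) n X) (cong (_* n ^ X) (^-distribʳ-* c (polylog k n) X))) ⟩
      C * (c ^ X * polylog k n ^ X * n ^ X)        ≡⟨ cong (λ p → C * (c ^ X * p * n ^ X)) (^-*-assoc (suc ⌊log₂ n ⌋) k X) ⟩
      C * (c ^ X * polylog (k * X) n * n ^ X)      ≡⟨ rearrange C (c ^ X) (polylog (k * X) n) (n ^ X) ⟩
      C * c ^ X * polylog (k * X) n * n ^ X        ∎
      where
      open ≤-Reasoning
      rearrange : ∀ a b p x → a * (b * p * x) ≡ a * b * p * x
      rearrange = solve-∀

    -- Y-th powers are compared, so one more factor n, which raises the true exponent by 1/Y only,
    -- absorbs any polylogarithm.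
    ≲-absorb : ∀ {f X} → f ≲ X → ∃[ C ] ∀ n .{{_ : NonZero n}} d → d ≤ polylog k n → f n d ^ Y ≤ C * n ^ suc X
    ≲-absorb {f} {X} (growth C j f≲) = C * factor j , λ n d d≤ → begin
      f n d ^ Y                     ≤⟨ f≲ n d d≤ ⟩
      C * polylog j n * n ^ X       ≤⟨ *-monoˡ-≤ (n ^ X) (*-monoʳ-≤ C (polylog-≤ j n)) ⟩
      C * (factor j * n) * n ^ X    ≡⟨ rearrange C (factor j) n (n ^ X) ⟩
      C * factor j * n ^ suc X      ∎
      where
      open ≤-Reasoning
      rearrange : ∀ a b n x → a * (b * n) * x ≡ a * b * (n * x)
      rearrange = solve-∀

  maxUpTo : (ℕ → ℕ) → ℕ → ℕ
  maxUpTo f zero    = f 0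
  maxUpTo f (suc n) = maxUpTo f n ⊔ f (suc n)

  ≤maxUpTo : ∀ f n d → d ≤ n → f d ≤ maxUpTo f n
  ≤maxUpTo f zero    .zero z≤n = ≤-refl
  ≤maxUpTo f (suc n) d d≤ with m≤n⇒m<n∨m≡n d≤
  ... | inj₁ d<  = ≤-trans (≤maxUpTo f n d (s≤s⁻¹ d<)) (m≤m⊔n _ _)
  ... | inj₂ refl = m≤n⊔m (maxUpTo f n) _

  maxUpTo-attained : ∀ f n → ∃[ d ] d ≤ n × maxUpTo f n ≡ f d
  maxUpTo-attained f zero = 0 , z≤n , refl
  maxUpTo-attained f (suc n) with ≤-total (maxUpTo f n) (f (suc n))
  ... | inj₁ le = suc n , ≤-refl , m≤n⇒m⊔n≡n le
  ... | inj₂ ge = let d , d≤ , e = maxUpTo-attained f n in d , ≤-trans d≤ (n≤1+n n) , trans (m≥n⇒m⊔n≡m ge) e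

  -- Raising both sides to the denominator of e makes the exponents comparable as integers; the root
  -- is taken at the end. If e is negative, m is at most C itself.
  AtMostPow⇒ : ∀ {m C n} .{{_ : NonZero n}} e X Y → toℚᵘ e ℚᵘ.≤ mkℚᵘ (ℤ.+ X) Y →
               AtMostPow m C n e → m ^ suc Y ≤ C ^ suc Y * n ^ X
  AtMostPow⇒ {m} {C} {n} (mkℚ (ℤ.+ x) y-1 _) X Y (*≤* x/y≤X/Y) m≤ = ^-cancelˡ-≤ y (begin
    (m ^ suc Y) ^ y               ≡⟨ ^-swap m (suc Y) y ⟩
    (m ^ y) ^ suc Y               ≤⟨ ^-monoˡ-≤ (suc Y) m≤ ⟩
    (C * n ^ x) ^ suc Y           ≡⟨ trans (^-distribʳ-* C (n ^ x) (suc Y)) (cong (C ^ suc Y *_) (^-*-assoc n x (suc Y))) ⟩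
    C ^ suc Y * n ^ (x * suc Y)   ≤⟨ *-mono-≤ (n≤n^ (C ^ suc Y) y) (^-monoʳ-≤ n xY≤Xy) ⟩
    (C ^ suc Y) ^ y * n ^ (X * y) ≡⟨ cong ((C ^ suc Y) ^ y *_) (^-*-assoc n X y) ⟨
    (C ^ suc Y) ^ y * (n ^ X) ^ y ≡⟨ ^-distribʳ-* (C ^ suc Y) (n ^ X) y ⟨
    (C ^ suc Y * n ^ X) ^ y       ∎)
    where
    open ≤-Reasoning
    y = suc y-1
    xY≤Xy : x * suc Y ≤ X * y
    xY≤Xy = ℤ.drop‿+≤+ (subst₂ ℤ._≤_ (sym (ℤ.pos-* x (suc Y))) (sym (ℤ.pos-* X y)) x/y≤X/Y)
  AtMostPow⇒ {m} {C} {n} (mkℚ ℤ.-[1+ x ] y-1 _) X Y _ m≤ = begin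
    m ^ suc Y
      ≤⟨ ^-monoˡ-≤ (suc Y) (≤-trans (n≤n^ m (suc y-1)) (≤-trans (m≤m*n (m ^ suc y-1) (n ^ suc x) {{m^n≢0 n (suc x)}}) m≤)) ⟩
    C ^ suc Y          ≤⟨ m≤m*n (C ^ suc Y) (n ^ X) {{m^n≢0 n X}} ⟩
    C ^ suc Y * n ^ X  ∎
    where open ≤-Reasoning

  ⇒AtMostPow : ∀ {m C n} .{{_ : NonZero n}} e X Y → mkℚᵘ (ℤ.+ X) Y ℚᵘ.≤ toℚᵘ e →
               m ^ suc Y ≤ C * n ^ X → AtMostPow m (C ^ ↧ₙ e) n e
  ⇒AtMostPow {m} {C} {n} (mkℚ (ℤ.+ x) y-1 _) X Y (*≤* X/Y≤x/y) m≤ = ^-cancelˡ-≤ (suc Y) (begin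
    (m ^ y) ^ suc Y                   ≡⟨ ^-swap m y (suc Y) ⟩
    (m ^ suc Y) ^ y                   ≤⟨ ^-monoˡ-≤ y m≤ ⟩
    (C * n ^ X) ^ y                   ≡⟨ trans (^-distribʳ-* C (n ^ X) y) (cong (C ^ y *_) (^-*-assoc n X y)) ⟩
    C ^ y * n ^ (X * y)               ≤⟨ *-mono-≤ (n≤n^ (C ^ y) (suc Y)) (^-monoʳ-≤ n Xy≤xY) ⟩
    (C ^ y) ^ suc Y * n ^ (x * suc Y) ≡⟨ cong ((C ^ y) ^ suc Y *_) (^-*-assoc n x (suc Y)) ⟨
    (C ^ y) ^ suc Y * (n ^ x) ^ suc Y ≡⟨ ^-distribʳ-* (C ^ y) (n ^ x) (suc Y) ⟨
    (C ^ y * n ^ x) ^ suc Y           ∎)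
    where
    open ≤-Reasoning
    y = suc y-1
    Xy≤xY : X * y ≤ x * suc Y
    Xy≤xY = ℤ.drop‿+≤+ (subst₂ ℤ._≤_ (sym (ℤ.pos-* X y)) (sym (ℤ.pos-* x (suc Y))) X/Y≤x/y)
  ⇒AtMostPow (mkℚ ℤ.-[1+ x ] y-1 _) X Y (*≤* X/Y≤x/y) m≤ with subst (ℤ._≤ _) (sym (ℤ.pos-* X (suc y-1))) X/Y≤x/y
  ... | ()

  -- With integral exponents the sizes of V and W are exact powers of n, and no rounding has to be
  -- estimated.
  natural : ℕ → ℚ
  natural β = mkℚ (ℤ.+ β) 0 (coprime-sym (1-coprimeTo β))

  unitFraction : ℕ → ℚ
  unitFraction Y = mkℚ (ℤ.+ 1) Y (1-coprimeTo (suc Y))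

  floor-natural : ∀ {m n} β → IsFloorPow m n (natural β) → m ≡ n ^ β
  floor-natural {m} {n} β (lower , upper) = ≤-antisym
    (subst₂ _≤_ (*-identityʳ m) (+-identityʳ _) lower)
    (s≤s⁻¹ (≰⇒> λ le → upper (subst₂ _≤_ (sym (*-identityʳ (suc m))) (sym (+-identityʳ _)) le)))

  toℚᵘ-minus : ∀ p q → toℚᵘ (p ℚ.- q) ℚᵘ.≃ toℚᵘ p ℚᵘ.- toℚᵘ q
  toℚᵘ-minus p q = ℚᵘ.≃-trans (ℚ.toℚᵘ-homo-+ p (ℚ.- q)) (ℚᵘ.+-congʳ (toℚᵘ p) (ℚ.toℚᵘ-homo‿- q))

  -- The right-hand side is 2 - 1/q.
  two-minus : ∀ x q-1 .(c : Coprime (suc x) (suc q-1)) →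
    toℚᵘ ((ℤ.+ 2) ℚ./ 1 ℚ.- mkℚ (ℤ.+ suc x) q-1 c) ℚᵘ.≤ mkℚᵘ (ℤ.+ (1 + 2 * q-1)) q-1
  two-minus x q-1 c = ℚᵘ.≤-respˡ-≃ (ℚᵘ.≃-sym (toℚᵘ-minus ((ℤ.+ 2) ℚ./ 1) (mkℚ (ℤ.+ suc x) q-1 c)))
    (*≤* (ℤ.≤-trans (ℤ.i≤i+j _ (ℤ.+ x ℤ.* ℤ.+ suc q-1) {{nonNegative}}) (ℤ.≤-reflexive
      (trans (identity (ℤ.+ x) (ℤ.+ q-1)) (cong₂ ℤ._*_ (cong (λ z → ℤ.+ 1 ℤ.+ z) (sym (ℤ.pos-* 2 q-1)))
        (cong (λ z → ℤ.+ suc z) (sym (+-identityʳ q-1))))))))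
    where
    nonNegative : ℤ.NonNegative (ℤ.+ x ℤ.* ℤ.+ suc q-1)
    nonNegative = subst ℤ.NonNegative (ℤ.pos-* x (suc q-1)) _
    identity : ∀ x q →
      (ℤ.+ 2 ℤ.* (ℤ.+ 1 ℤ.+ q) ℤ.+ ℤ.- (ℤ.+ 1 ℤ.+ x) ℤ.* ℤ.+ 1) ℤ.* (ℤ.+ 1 ℤ.+ q) ℤ.+ x ℤ.* (ℤ.+ 1 ℤ.+ q) ≡
      (ℤ.+ 1 ℤ.+ ℤ.+ 2 ℤ.* q) ℤ.* (ℤ.+ 1 ℤ.+ q)
    identity = ℤ.solve-∀

  exponent-≤ : ∀ β Y X → X + 1 ≡ suc Y * (β + 2) →
    mkℚᵘ (ℤ.+ X) Y ℚᵘ.≤ toℚᵘ (1ℚ ℚ.+ 1ℚ ℚ.+ natural β ℚ.- unitFraction Y)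
  exponent-≤ β Y X eq₁ = ℚᵘ.≤-respʳ-≃ (ℚᵘ.≃-sym (ℚᵘ.≃-trans (toℚᵘ-minus (1ℚ ℚ.+ 1ℚ ℚ.+ natural β) (unitFraction Y))
      (ℚᵘ.+-congˡ (ℚᵘ.- toℚᵘ (unitFraction Y)) (ℚ.toℚᵘ-homo-+ (1ℚ ℚ.+ 1ℚ) (natural β)))))
    (*≤* (ℤ.≤-reflexive (trans (cong₂ ℤ._*_ X≡ (cong (λ z → ℤ.+ suc z) (+-identityʳ Y))) (identity (ℤ.+ Y) (ℤ.+ β)))))
    where
    X≡ : ℤ.+ X ≡ (ℤ.+ 1 ℤ.+ ℤ.+ Y) ℤ.* (ℤ.+ β ℤ.+ ℤ.+ 2) ℤ.- ℤ.+ 1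
    X≡ = trans (cancel (ℤ.+ X)) (cong (λ z → z ℤ.- ℤ.+ 1) (trans (cong (λ z → ℤ.+ z) eq₁) (ℤ.pos-* (suc Y) (β + 2))))
      where
      cancel : ∀ x → x ≡ x ℤ.+ ℤ.+ 1 ℤ.- ℤ.+ 1
      cancel = ℤ.solve-∀
    identity : ∀ y b → ((ℤ.+ 1 ℤ.+ y) ℤ.* (b ℤ.+ ℤ.+ 2) ℤ.- ℤ.+ 1) ℤ.* (ℤ.+ 1 ℤ.+ y) ≡
      ((ℤ.+ 2 ℤ.* ℤ.+ 1 ℤ.+ b ℤ.* ℤ.+ 1) ℤ.* (ℤ.+ 1 ℤ.+ y) ℤ.+ ℤ.- (ℤ.+ 1) ℤ.* ℤ.+ 1) ℤ.* (ℤ.+ 1 ℤ.+ y)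
    identity = ℤ.solve-∀

  toℚᵘ-fromℕ : ∀ m → toℚᵘ (fromℕ m) ℚᵘ.≃ mkℚᵘ (ℤ.+ m) 0
  toℚᵘ-fromℕ m = ℚ.toℚᵘ-fromℚᵘ (mkℚᵘ (ℤ.+ m) 0)

  -- The approximation guarantee with denominators cleared. The numerator of ε is dropped: ε is at
  -- least the unit fraction with its denominator, and the weaker factor `2 - 1/q` is enough.
  approximation-≤ : ∀ x q-1 .(c : Coprime (suc x) (suc q-1)) {m̂ r} →
    fromℕ m̂ ℚ.≤ ((ℤ.+ 2) ℚ./ 1 ℚ.- mkℚ (ℤ.+ suc x) q-1 c) ℚ.* fromℕ r →
                    m̂ * suc q-1 ≤ (1 + 2 * q-1) * r
  approximation-≤ x q-1 c {m̂} {r} le = extract (ℚᵘ.≤-trans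
    (ℚᵘ.≤-respˡ-≃ (toℚᵘ-fromℕ m̂) (ℚᵘ.≤-respʳ-≃
      (ℚᵘ.≃-trans (ℚ.toℚᵘ-homo-* α (fromℕ r)) (ℚᵘ.*-congˡ {toℚᵘ α} (toℚᵘ-fromℕ r))) (ℚ.toℚᵘ-mono-≤ le)))
    (ℚᵘ.*-monoˡ-≤-nonNeg (mkℚᵘ (ℤ.+ r) 0) (two-minus x q-1 c)))
    where
    α : ℚ
    α = (ℤ.+ 2) ℚ./ 1 ℚ.- mkℚ (ℤ.+ suc x) q-1 c
    extract : mkℚᵘ (ℤ.+ m̂) 0 ℚᵘ.≤ mkℚᵘ (ℤ.+ (1 + 2 * q-1)) q-1 ℚᵘ.* mkℚᵘ (ℤ.+ r) 0 → m̂ * suc q-1 ≤ (1 + 2 * q-1) * r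
    extract (*≤* le) = ℤ.drop‿+≤+ (subst₂ ℤ._≤_
      (trans (cong (λ z → ℤ.+ m̂ ℤ.* ℤ.+ suc z) (*-identityʳ q-1)) (sym (ℤ.pos-* m̂ (suc q-1))))
      (trans (ℤ.*-identityʳ _) (sym (ℤ.pos-* (1 + 2 * q-1) r))) le)

  -- Instances of 3-HS

  cells-++ʳ : ∀ {A : Set} {a : A} (xs ys : List A) j → cells a (xs ++ ys) (length xs + j) ≡ cells a ys j
  cells-++ʳ []       ys j = refl
  cells-++ʳ (x ∷ xs) ys j = cells-++ʳ xs ys j

  toList-concat : ∀ {d m} (r : Vec Bool d) (S : Vec (Vec Bool d) m) →
    Vec.toList (Vec.map bit (Vec.concat (r ∷ S))) ≡
    Vec.toList (Vec.map bit r) ++ Vec.toList (Vec.map bit (Vec.concat S))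
  toList-concat r S = trans (cong Vec.toList (Vec.map-++ bit r (Vec.concat S))) (Vec.toList-++ (Vec.map bit r) _)

  coordinate : ∀ {d m} (S : Vec (Vec Bool d) m) x i →
    cells 0 (Vec.toList (Vec.map bit (Vec.concat S))) (toℕ x * d + toℕ i) ≡ bit (Vec.lookup (Vec.lookup S x) i)
  coordinate {d} (r ∷ S) zero i = trans
    (cong (λ xs → cells 0 xs (toℕ i)) (toList-concat r S))
    (trans (cells-++ˡ (Vec.toList (Vec.map bit r)) _
      (subst (toℕ i <_) (sym (Vec.length-toList (Vec.map bit r))) (Fin.toℕ<n i))) (lookup r i))
    where
    lookup : ∀ {d} (r : Vec Bool d) i → cells 0 (Vec.toList (Vec.map bit r)) (toℕ i) ≡ bit (Vec.lookup r i)
    lookup (b ∷ r) zero    = refl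
    lookup (b ∷ r) (suc i) = lookup r i
  coordinate {d} (r ∷ S) (suc x) i = trans
    (cong₂ (λ xs j → cells 0 xs j) (toList-concat r S)
      (trans (+-assoc d (toℕ x * d) (toℕ i)) (cong (_+ (toℕ x * d + toℕ i)) (sym (Vec.length-toList (Vec.map bit r))))))
    (trans (cells-++ʳ (Vec.toList (Vec.map bit r)) _ (toℕ x * d + toℕ i)) (coordinate S x i))

  cells-bits-≤1 : ∀ {m} (v : Vec Bool m) i → cells 0 (Vec.toList (Vec.map bit v)) i ≤ 1
  cells-bits-≤1 []          i       = z≤n
  cells-bits-≤1 (true ∷ v)  zero    = ≤-refl
  cells-bits-≤1 (false ∷ v) zero    = z≤n
  cells-bits-≤1 (b ∷ v)     (suc i) = cells-bits-≤1 v i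

  sum-nonzero : ∀ {d} (f : Fin d → ℕ) → Vec.sum (Vec.tabulate f) ≢ 0 → ∃[ i ] f i ≢ 0
  sum-nonzero {zero}  f nz = contradiction refl nz
  sum-nonzero {suc d} f nz with f zero in e
  ... | suc _ = zero , λ z → contradiction (trans (sym e) z) λ ()
  ... | zero  = let i , fi = sum-nonzero (f ∘ suc) nz in suc i , fi

  nonzero-sum : ∀ {d} (f : Fin d → ℕ) i → f i ≢ 0 → Vec.sum (Vec.tabulate f) ≢ 0
  nonzero-sum f zero    fi z = fi (m+n≡0⇒m≡0 (f zero) z)
  nonzero-sum f (suc i) fi z = nonzero-sum (f ∘ suc) i fi (m+n≡0⇒n≡0 (f zero) z)

  hits⇒product : ∀ {d} (u v w : Vec Bool d) i → Vec.lookup u i ≡ true → Vec.lookup v i ≡ true →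
                 Vec.lookup w i ≡ true → tripleProduct u v w ≢ 0
  hits⇒product u v w i ui vi wi = nonzero-sum _ i λ z →
    contradiction (trans (sym (cong₂ (λ a b → a * b) (cong₂ (λ a b → bit a * bit b) ui vi) (cong bit wi))) z) λ ()

  product⇒hits : ∀ {d} (u v w : Vec Bool d) → tripleProduct u v w ≢ 0 →
                 ∃[ i ] Vec.lookup u i ≡ true × Vec.lookup v i ≡ true × Vec.lookup w i ≡ true
  product⇒hits u v w nz with i , fi ← sum-nonzero _ nz = i , factors _ _ _ fi
    where
    factors : ∀ a b c → bit a * bit b * bit c ≢ 0 → a ≡ true × b ≡ true × c ≡ true
    factors true  true  true  _  = refl , refl , refl
    factors true  true  false nz = contradiction refl nz
    factors true  false _     nz = contradiction refl nz
    factors false _     _     nz = contradiction refl nz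

  ServeAll-deterministic : ∀ {A w ρ n} {rs : List (Request n)} {s ts₁ s₁ ts₂ s₂} →
    ServeAll A w ρ rs s ts₁ s₁ → ServeAll A w ρ rs s ts₂ s₂ → s₁ ≡ s₂
  ServeAll-deterministic [] [] = refl
  ServeAll-deterministic {rs = insert _ ∷ _} (e ∷ es) (e′ ∷ es′)
    with refl , refl ← Eval-deterministic e e′ = ServeAll-deterministic es es′
  ServeAll-deterministic {rs = delete _ ∷ _} (e ∷ es) (e′ ∷ es′)
    with refl , refl ← Eval-deterministic e e′ = ServeAll-deterministic es es′
  ServeAll-deterministic {rs = query ∷ _} (e ∷ es) (e′ ∷ es′)
    with refl , refl ← Eval-deterministic e e′ = ServeAll-deterministic es es′

  serveAll-phase : ∀ {A w ρ n d} (f : Fin d → Request n) {s ts s′} →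
    ServeAll A w ρ (List.tabulate f ∷ʳ query) s ts s′ →
    Σ (Phase A w ρ s f) λ P → Phase.final P ≡ s′ × sumUpTo (Phase.durations P) d + Phase.time P ≡ sum ts
  serveAll-phase {d = zero} f {s} {t ∷ []} {s′} (e ∷ []) = record
    { states = λ _ → s ; durations = λ _ → 0 ; final = s′ ; time = t
    ; begins = refl ; steps = λ () ; answers = e } , refl , sym (+-identityʳ t)
  serveAll-phase {A} {w} {ρ} {d = suc d} f {s} {t ∷ ts} (e ∷ es)
    with P , final≡ , sum≡ ← serveAll-phase (f ∘ suc) es = record
    { states    = λ where
        zero    → s
        (suc i) → Phase.states P i
    ; durations = λ where
        zero    → t
        (suc i) → Phase.durations P i
    ; final     = Phase.final P
    ; time      = Phase.time P
    ; begins    = refl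
    ; steps     = λ where
        zero    → subst (Serve A w ρ (f zero) s t) (sym (Phase.begins P)) e
        (suc i) → Phase.steps P i
    ; answers   = Phase.answers P
    } , final≡ , trans (+-assoc t _ _) (cong (t +_) sum≡)

  -- Only the total time of a phase matters, so worst-case bounds enter in the same way as amortized
  -- ones.
  within-sum : ∀ τ {ts bs} → Within τ ts bs → sum ts ≤ sum bs
  within-sum amortized le = le
  within-sum worstCase les = pointwise les
    where
    pointwise : ∀ {ts bs} → Pointwise _≤_ ts bs → sum ts ≤ sum bs
    pointwise []         = z≤n
    pointwise (le ∷ les) = +-mono-≤ le (pointwise les)

  finite-answer : ∀ α r s → Approximates α [ r ] (answer s) →
                  ∃[ m̂ ] reg s 0 ≡ suc m̂ × r ≤ m̂ × fromℕ m̂ ℚ.≤ α ℚ.* fromℕ r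
  finite-answer α r s approx with reg s 0
  finite-answer α r s (finite r≤m̂ m̂≤αr) | suc m̂ = m̂ , refl , r≤m̂ , m̂≤αr

  answer-finite : ∀ α P s → Approximates α P (answer s) → reg s 0 ≢ 0 → ∃[ r ] P ≡ [ r ]
  answer-finite α P s approx nonzero with reg s 0
  answer-finite α P s approx       nonzero | zero  = contradiction refl nonzero
  answer-finite α P s (finite _ _) nonzero | suc m̂ = _ , refl

  -- Total cost and word length

  vertices : (L n m d : ℕ) → ℕ
  vertices L n m d = suc L * (n + suc m) + suc (d + d)

  -- The same quantity as M in `Reduction`. Registers 10 and 11 are independent of the number of
  -- phases, for which 0 stands here.
  loopBound : (L n m d : ℕ) → ℕ
  loopBound L n m d = cells 0 (parameters n m 0 d L) 10 + cells 0 (parameters n m 0 d L) 11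

  totalCost : Mode → (L : ℕ) (p u q : ℕ → ℕ) (n m K d : ℕ) → ℕ
  totalCost mode L p u q n m K d =
    setupCost + (genCost (loopBound L n m d) (graphGen mode) + (2 + ((2 + 20 * p N) +
      (3 + K * (20 * (d * u N + q N) + d * 44 + 18 + 4))))) + 2
    where
    N : ℕ
    N = vertices L n m d

  -- With b the power of two above n, `b ^ κ` is the bound B on all parameters. The summand
  -- `κ * 64 + 1` makes `B ^ 64` fit into a word; the last summand makes room for the words of the
  -- simulated machine, whose number of vertices is at most B.
  wordFactor : (k L β c : ℕ) → ℕ
  wordFactor k L β c = κ * 64 + 1 + c * (κ + 1)
    where
    κ : ℕ
    κ = (k + L + 1) * 25 + (β + 1)

  module WordLength (k L β c n d : ℕ) .{{_ : NonZero n}} (d≤ : d ≤ polylog k n) where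

    l b b₁ e κ B : ℕ
    l  = suc ⌊log₂ n ⌋
    b  = 2 ^ l
    -- In `b ^ e`, one factor b bounds n, k factors bound d, and L factors bound L, since L is less
    -- than `2 ^ L`.
    e  = k + L + 1
    b₁ = b ^ e
    κ  = e * 25 + (β + 1)
    B  = b ^ κ

    c′ : ℕ
    c′ = wordFactor k L β c

    instance
      b≢0 : NonZero b
      b≢0 = m^n≢0 2 l

    2≤b : 2 ≤ b
    2≤b = ^-monoʳ-≤ 2 (s≤s (z≤n {⌊log₂ n ⌋}))

    n<b : n < b
    n<b = n<2^[1+log] n

    b≤b₁ : ∀ i → i ≤ e → b ^ i ≤ b₁
    b≤b₁ i i≤e = ^-monoʳ-≤ b i≤e

    n≤b₁ : n ≤ b₁
    n≤b₁ = ≤-trans (<⇒≤ n<b) (≤-trans (≤-reflexive (sym (*-identityʳ b))) (b≤b₁ 1 (m≤n+m 1 (k + L))))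

    d≤b₁ : d ≤ b₁
    d≤b₁ = ≤-trans d≤ (≤-trans (^-monoˡ-≤ k (<⇒≤ (n<2^n l))) (b≤b₁ k (≤-trans (m≤m+n k L) (m≤m+n (k + L) 1))))

    L≤b₁ : L ≤ b₁
    L≤b₁ = ≤-trans (<⇒≤ (n<2^n L)) (≤-trans (^-monoˡ-≤ L 2≤b) (b≤b₁ L (≤-trans (m≤n+m L k) (m≤m+n (k + L) 1))))

    2≤b₁ : 2 ≤ b₁
    2≤b₁ = ≤-trans 2≤b (≤-trans (≤-reflexive (sym (*-identityʳ b))) (b≤b₁ 1 (m≤n+m 1 (k + L))))

    open Expressions (λ _ _ → 0)
    open Bounds b₁ 2≤b₁ (λ _ _ → z≤n)

    bound≤b₁^25 : loopBound L n n d ≤ b₁ ^ 25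
    -- The bound is itself an expression in n, d and L; its degree is 25.
    bound≤b₁^25 = val≤B^deg (cells 0 (n ∷ d ∷ L ∷ [])) expression small
      where
      small : ∀ r → cells 0 (n ∷ d ∷ L ∷ []) r ≤ b₁
      small 0                   = n≤b₁
      small 1                   = d≤b₁
      small 2                   = L≤b₁
      small (suc (suc (suc _))) = z≤n
      lineExpr expression : Expr
      lineExpr = var 0 ⊕ (var 0 ⊕ lit 1)
      expression = (var 2 ⊗ lineExpr ⊕ lineExpr ⊕ lit 1 ⊕ var 1 ⊕ var 1) ⊕ (var 2 ⊕ var 2 ⊕ lit 1)

    bound≤B : loopBound L n n d ≤ B
    bound≤B = ≤-trans bound≤b₁^25 (≤-trans (≤-reflexive (^-*-assoc b e 25)) (^-monoʳ-≤ b (m≤m+n (e * 25) (β + 1))))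

    n^β<B : n ^ β < B
    n^β<B = ≤-<-trans (^-monoˡ-≤ β (<⇒≤ n<b)) (≤-trans
      (^-monoʳ-< b 2≤b (≤-reflexive (+-comm 1 β))) (^-monoʳ-≤ b (m≤n+m (β + 1) (e * 25))))

    2≤B : 2 ≤ B
    2≤B = ≤-trans 2≤b (≤-trans (≤-reflexive (sym (*-identityʳ b)))
      (^-monoʳ-≤ b {1} {κ} (≤-trans (m≤n+m 1 β) (m≤n+m (β + 1) (e * 25)))))

    2^w≡ : 2 ^ wordLength c′ n ≡ b ^ c′
    2^w≡ = trans (cong (2 ^_) (*-comm c′ l)) (sym (^-*-assoc 2 l c′))

    B^64<2^w : B ^ 64 < 2 ^ wordLength c′ n
    B^64<2^w = ≤-trans (s≤s (≤-reflexive (^-*-assoc b κ 64))) (≤-trans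
      (^-monoʳ-< b 2≤b (≤-trans (≤-reflexive (+-comm 1 (κ * 64))) (m≤m+n (κ * 64 + 1) (c * (κ + 1)))))
      (≤-reflexive (sym 2^w≡)))

    1<2^w : 1 < 2 ^ wordLength c′ n
    1<2^w = ≤-<-trans (m^n>0 B {{m^n≢0 b κ}} 64) B^64<2^w

    wordLength-≤ : ∀ N → N ≤ B → 2 ^ wordLength c N ≤ 2 ^ wordLength c′ n
    wordLength-≤ N N≤B = ^-monoʳ-≤ 2 (begin
      c * suc ⌊log₂ N ⌋    ≤⟨ *-monoʳ-≤ c (s≤s log≤) ⟩
      c * suc (l * κ)      ≤⟨ *-monoʳ-≤ c (+-monoˡ-≤ (l * κ) (s≤s (z≤n {⌊log₂ n ⌋}))) ⟩
      c * (l + l * κ)      ≡⟨ cong (c *_) (*-suc l κ) ⟨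
      c * (l * suc κ)      ≡⟨ rearrange c l κ ⟩
      c * (κ + 1) * l      ≤⟨ *-monoˡ-≤ l (m≤n+m (c * (κ + 1)) (κ * 64 + 1)) ⟩
      c′ * l               ∎)
      where
      open ≤-Reasoning
      log≤ : ⌊log₂ N ⌋ ≤ l * κ
      log≤ = ≤-trans (⌊log₂⌋-mono-≤ (≤-trans N≤B (≤-reflexive (^-*-assoc 2 l κ)))) (≤-reflexive (⌊log₂[2^n]⌋≡n (l * κ)))
      rearrange : ∀ c l κ → c * (l * suc κ) ≡ c * (κ + 1) * l
      rearrange = solve-∀

  vertices≤loopBound : ∀ L n m d → vertices L n m d ≤ loopBound L n m d
  vertices≤loopBound L n m d = ≤-trans (≤-reflexive (rearrange L n m d)) (m≤m+n _ (L + L + 1))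
    where
    rearrange : ∀ L n m d → suc L * (n + suc m) + suc (d + d) ≡ L * (n + (m + 1)) + (n + (m + 1)) + 1 + d + d
    rearrange = solve-∀

  polylog-mono : ∀ k {m n} → m ≤ n → polylog k m ≤ polylog k n
  polylog-mono k m≤n = ^-monoˡ-≤ k (s≤s (⌊log₂⌋-mono-≤ m≤n))

  -- The algorithm for 3-HS

  module Solver
    (σ : Setting) (τ : Timing) (mode : Mode) (supported : Supports σ mode)
    (x q-1 : ℕ) .(coprime : Coprime (suc x) (suc q-1)) (β k : ℕ)
    (A : Algorithm) (c : ℕ) (p u q : ℕ → ℕ)
    -- Three more logarithmic factors than d has cover the constants in `5 + 2 * d`, since 7 is
    -- below `2 ^ 3`. A phase has fewer than N requests, hence `l = 1`. The error exponent `β + 1`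
    -- is made for a union over `n ^ β` phases.
    (AR : ApproximatesRadius σ τ ((ℤ.+ 2) ℚ./ 1 ℚ.- mkℚ (ℤ.+ suc x) q-1 coprime) (k + 3) 1 (β + 1) A c p u q)
    where

    open ApproximatesRadius AR

    α : ℚ
    α = (ℤ.+ 2) ℚ./ 1 ℚ.- mkℚ (ℤ.+ suc x) q-1 coprime

    -- With `q = suc q-1`, the inequality `(2 - 1/q) (L + 3) < 2 L` amounts to `L > 6 q - 3`.
    L : ℕ
    L = 8 * suc q-1

    short-accepted : ∀ {r m̂} → r ≤ 3 + L → fromℕ m̂ ℚ.≤ α ℚ.* fromℕ r → m̂ < L + L
    short-accepted {r} {m̂} r≤ approx = *-cancelʳ-< (suc q-1) m̂ (L + L) (begin-strict
      m̂ * suc q-1                         ≤⟨ approximation-≤ x q-1 coprime {m̂} {r} approx ⟩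
      (1 + 2 * q-1) * r                   ≤⟨ *-monoʳ-≤ (1 + 2 * q-1) r≤ ⟩
      (1 + 2 * q-1) * (3 + L)             <⟨ m<m+n _ (z<s {2 * q-1 + 4}) ⟩
      (1 + 2 * q-1) * (3 + L) + suc (2 * q-1 + 4) ≡⟨ rearrange q-1 ⟩
      (L + L) * suc q-1                   ∎)
      where
      open ≤-Reasoning
      rearrange : ∀ q → (1 + 2 * q) * (3 + 8 * suc q) + suc (2 * q + 4) ≡ (8 * suc q + 8 * suc q) * suc q
      rearrange = solve-∀

    cost : (n m K d : ℕ) → ℕ
    cost = totalCost mode L p u q

    module _ {n d : ℕ} .{{_ : NonZero n}} (d≤ : d ≤ polylog k n) (I : Instance 1ℚ (natural β) d n) where

      open Instance I

      ∣V∣≡n : ∣V∣ ≡ n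
      ∣V∣≡n = trans (floor-natural {∣V∣} {n} 1 ∣V∣-size) (*-identityʳ n)

      ∣W∣≡n^β : ∣W∣ ≡ n ^ β
      ∣W∣≡n^β = floor-natural {∣W∣} {n} β ∣W∣-size

      Uᶠ : Fin n → Fin d → Bool
      Uᶠ x i = Vec.lookup (Vec.lookup U x) i
      Vᶠ : Fin ∣V∣ → Fin d → Bool
      Vᶠ y i = Vec.lookup (Vec.lookup V y) i
      Wᶠ : Fin ∣W∣ → Fin d → Bool
      Wᶠ z i = Vec.lookup (Vec.lookup W z) i

      open WordLength k L β c n d d≤ using (B; c′; 2≤B; B^64<2^w; 1<2^w; bound≤B; n^β<B; wordLength-≤)

      input : Arrays
      input = arr (input3HS I)

      input≤1 : ∀ A i → input A i ≤ 1
      input≤1 0 i = cells-bits-≤1 (Vec.concat U) i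
      input≤1 1 i = cells-bits-≤1 (Vec.concat V) i
      input≤1 2 i = cells-bits-≤1 (Vec.concat W) i
      input≤1 (suc (suc (suc A))) i = z≤n

      open EdgeLists n ∣V∣ d L Uᶠ Vᶠ

      N≢0 : NonZero N
      N≢0 = >-nonZero (≤-trans (s≤s z≤n) (m≤n+m (suc (d + d)) (suc L * S)))

      3≤N : 3 ≤ N
      3≤N = +-mono-≤ (≤-trans (+-mono-≤ 1≤n (s≤s (z≤n {∣V∣}))) (m≤m+n S (L * S))) (s≤s (z≤n {d + d}))
        where
        1≤n : 1 ≤ n
        1≤n = >-nonZero⁻¹ n

      n≤N : n ≤ N
      n≤N = ≤-trans (m≤m+n n (suc ∣V∣)) (≤-trans (m≤m+n S (L * S)) (m≤m+n (suc L * S) (suc (d + d))))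

      N≤B : N ≤ B
      N≤B = ≤-trans (vertices≤loopBound L n ∣V∣ d) (≤-trans (≤-reflexive (cong (λ m → loopBound L n m d) ∣V∣≡n)) bound≤B)

      sparse : d + length (initial mode) ≤ N * polylog (k + 3) N
      sparse = ≤-trans (initial-length mode) (*-monoʳ-≤ N (begin
        5 + 2 * d
          ≤⟨ +-mono-≤ (*-monoʳ-≤ 5 (1≤polylog k N)) (*-monoʳ-≤ 2 (≤-trans d≤ (polylog-mono k n≤N))) ⟩
        5 * polylog k N + 2 * polylog k N ≡⟨ *-distribʳ-+ (polylog k N) 5 2 ⟨
        7 * polylog k N                  ≤⟨ *-monoˡ-≤ (polylog k N) (≤-trans (m≤m+n 7 1) (^-monoˡ-≤ 3 (s≤s 1≤log))) ⟩
        polylog 3 N * polylog k N        ≡⟨ *-comm (polylog 3 N) (polylog k N) ⟩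
        polylog k N * polylog 3 N        ≡⟨ ^-distribˡ-+-* (suc ⌊log₂ N ⌋) k 3 ⟨
        polylog (k + 3) N                ∎))
        where
        open ≤-Reasoning
        1≤log : 1 ≤ ⌊log₂ N ⌋
        1≤log = ⌊log₂⌋-mono-≤ {2} {N} (≤-trans (n≤1+n 2) 3≤N)

      G₀ : Graph N
      G₀ = initialGraph mode

      sparse₀ : length G₀ ≤ N * polylog (k + 3) N
      sparse₀ = ≤-trans (≤-reflexive (List.length-map encodePair (initial mode))) (≤-trans (m≤n+m _ d) sparse)

      legalᵏ : ∀ z → ∃[ G′ ] Legal σ (N * polylog (k + 3) N) G₀ (requests mode (Wᶠ z)) G′ × Realizes (Wᶠ z) G′
      legalᵏ z = legal (N * polylog (k + 3) N) mode supported sparse (Wᶠ z)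

      few-requests : ∀ z → length (requests mode (Wᶠ z) ∷ʳ query) ≤ N ^ 1
      few-requests z = begin
        length (requests mode (Wᶠ z) ∷ʳ query)   ≡⟨ List.length-++ (requests mode (Wᶠ z)) ⟩
        length (requests mode (Wᶠ z)) + 1        ≡⟨ cong (_+ 1) (List.length-tabulate (updateRequest mode (Wᶠ z))) ⟩
        d + 1                                    ≡⟨ +-comm d 1 ⟩
        suc d                                    ≤⟨ s≤s (m≤m+n d d) ⟩
        suc (d + d)                              ≤⟨ m≤n+m (suc (d + d)) (suc L * S) ⟩
        N                                        ≡⟨ *-identityʳ N ⟨
        N ^ 1                                    ∎
        where open ≤-Reasoning

      total-bound : ∀ z → sum (map (requestBound u q) (requests mode (Wᶠ z) ∷ʳ query)) ≡ d * u N + q N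
      total-bound z = go d (updateRequest mode (Wᶠ z)) (bounded mode)
        where
        bounded : ∀ mode i → requestBound u q (updateRequest mode (Wᶠ z) i) ≡ u N
        bounded inserting i = refl
        bounded deleting  i = refl
        go : ∀ d (f : Fin d → Request N) → (∀ i → requestBound u q (f i) ≡ u N) →
             sum (map (requestBound u q) (List.tabulate f ∷ʳ query)) ≡ d * u N + q N
        go zero    f f≡ = +-identityʳ (q N)
        go (suc d) f f≡ = trans (cong₂ _+_ (f≡ zero) (go d (f ∘ suc) (f≡ ∘ suc))) (sym (+-assoc (u N) (d * u N) (q N)))

      w w₀ : ℕ
      w  = wordLength c′ n
      w₀ = wordLength c N

      Answered : (z : Fin ∣W∣) → Tape w₀ → Set
      Answered z ρ₀ = ∃[ t ] ∃[ s ] ∃[ ts ] ∃[ s′ ]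
        Eval w₀ (bits ρ₀) (Algorithm.preprocessing A) (inputGraph G₀) t s ×
        ServeAll A w₀ (bits ρ₀) (requests mode (Wᶠ z) ∷ʳ query) s ts s′ ×
        ∃[ P ] IsRadius (proj₁ (legalᵏ z)) P × Approximates α P (answer s′)

      Good : Fin ∣W∣ → Set
      Good z = ∃[ x ] ∀ y → Hits (Wᶠ z) x y

      hits? : ∀ z x y → Dec (Hits (Wᶠ z) x y)
      hits? z x y = Fin.any? λ i → (Uᶠ x i Bool.≟ true) ×-dec (Vᶠ y i Bool.≟ true) ×-dec (Wᶠ z i Bool.≟ true)

      good? : ∀ z → Dec (Good z)
      good? z = Fin.any? λ x → Fin.all? (hits? z x)

      misses : ∀ z → ¬ Good z → ∀ x → ∃[ y ] ¬ Hits (Wᶠ z) x y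
      misses z bad x = Fin.¬∀⟶∃¬ _ (Hits (Wᶠ z) x) (hits? z x) λ hits → bad (x , hits)

      anyVertex : ∀ {n} → .{{NonZero n}} → Fin n
      anyVertex {suc n} = zero

      -- If some u hits all v, the answer is below `2 L` by the choice of L. Otherwise the radius,
      -- and with it the answer, is at least `2 L` or infinite, the latter being encoded by 0.
      accepts-iff : ∀ z s {P} → IsRadius (proj₁ (legalᵏ z)) P → Approximates α P (answer s) →
                    Accepts L (reg s 0) ⇔ Good z
      accepts-iff z s {P} radius approx = mk⇔ accepts⇒good good⇒accepts
        where
        realizes = proj₂ (proj₂ (legalᵏ z))
        accepts⇒good : Accepts L (reg s 0) → Good z
        accepts⇒good (nonzero , small) = decidable-stable (good? z) λ bad →
          let r , P≡ = answer-finite α P s approx nonzero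
              m̂ , e , r≤m̂ , _ = finite-answer α r s (subst (λ P → Approximates α P (answer s)) P≡ approx)
          in contradiction
            (≤-trans (radius-miss (Wᶠ z) realizes anyVertex (misses z bad)
              (subst (IsRadius (proj₁ (legalᵏ z))) P≡ radius)) r≤m̂)
            (<⇒≱ (s≤s⁻¹ (subst₂ _<_ e (+-comm (L + L) 1) small)))
        good⇒accepts : Good z → Accepts L (reg s 0)
        good⇒accepts (x , hits) =
          let r , P≡ , r≤ = radius-hit (Wᶠ z) realizes x hits radius
              m̂ , e , _ , m̂≤ = finite-answer α r s (subst (λ P → Approximates α P (answer s)) P≡ approx)
          in (λ e₀ → contradiction (trans (sym e) e₀) λ ()) ,
             ≤-trans (s≤s (≤-reflexive e)) (≤-trans (s≤s (short-accepted r≤ m̂≤)) (≤-reflexive (+-comm 1 (L + L))))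

      good⇔hitting : (∃[ z ] Good z) ⇔ HasHittingPair I
      good⇔hitting = mk⇔
        (λ (z , x , hits) → x , z , λ y → let i , ui , vi , wi = hits y in
          hits⇒product (Vec.lookup U x) (Vec.lookup V y) (Vec.lookup W z) i ui vi wi)
        (λ (x , z , products) → z , x , λ y →
          product⇒hits (Vec.lookup U x) (Vec.lookup V y) (Vec.lookup W z) (products y))

      module _ (ρ₀ : Tape w₀) (ρ : Tape w) (agree : ∀ i → i < 2 ^ w₀ → bits ρ₀ i ≡ bits ρ i) where

        prepared = preprocessingTime N {{N≢0}} G₀ (initialGraph-unique mode) sparse₀ ρ₀

        s₀ : State
        s₀ = proj₁ (proj₂ prepared)

        -- `requestTime` starts every sequence with a preprocessing run of its own. Determinism
        -- moves the requests to the one prepared state `s₀`, from which all phases start.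
        served : ∀ z → ∃[ ts ] ∃[ s′ ] ServeAll A w₀ (bits ρ₀) (requests mode (Wᶠ z) ∷ʳ query) s₀ ts s′ ×
                       sum ts ≤ d * u N + q N
        served z =
          let t , s , ts , s′ , pre , serve , within = requestTime N {{N≢0}} G₀ (initialGraph-unique mode) sparse₀
                (requests mode (Wᶠ z) ∷ʳ query) (proj₁ (legalᵏ z)) (legal-query (proj₁ (proj₂ (legalᵏ z)))) (few-requests z) ρ₀
          in ts , s′ ,
             subst (λ s → ServeAll A w₀ (bits ρ₀) (requests mode (Wᶠ z) ∷ʳ query) s ts s′)
               (proj₂ (Eval-deterministic pre (proj₁ (proj₂ (proj₂ prepared))))) serve ,
             ≤-trans (within-sum τ within) (≤-reflexive (total-bound z))

        phases : ∀ z → Phase A w₀ (bits ρ₀) s₀ (updateRequest mode (Wᶠ z))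
        phases z = proj₁ (serveAll-phase (updateRequest mode (Wᶠ z)) (proj₁ (proj₂ (proj₂ (served z)))))

        final≡ : ∀ z → Phase.final (phases z) ≡ proj₁ (proj₂ (served z))
        final≡ z = proj₁ (proj₂ (serveAll-phase (updateRequest mode (Wᶠ z)) (proj₁ (proj₂ (proj₂ (served z))))))

        phases-time : ∀ z → sumUpTo (Phase.durations (phases z)) d + Phase.time (phases z) ≤ d * u N + q N
        phases-time z = ≤-trans
          (≤-reflexive (proj₂ (proj₂ (serveAll-phase (updateRequest mode (Wᶠ z)) (proj₁ (proj₂ (proj₂ (served z))))))))
          (proj₂ (proj₂ (proj₂ (served z))))

        run : ∃[ t ] ∃[ S′ ] Eval w (bits ρ) (program mode A L) (input3HS I) t S′ ×
          t ≤ cost n ∣V∣ ∣W∣ d × (reg S′ 0 ≢ 0 ⇔ (∃[ z ] Accepts L (reg (Phase.final (phases z)) 0)))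
        run =
          let t , S′ , e , t≤ , iff = program-run
                (≤-trans (≤-reflexive (cong (λ m → loopBound L n m d) ∣V∣≡n)) bound≤B)
                (subst (_< B) (sym ∣W∣≡n^β) n^β<B) mode A w₀ (bits ρ₀) (wordLength-≤ N N≤B) agree
                (proj₁ (proj₂ (proj₂ prepared))) phases (d * u N + q N) phases-time
          in t , S′ , e , ≤-trans t≤ (+-monoˡ-≤ 2 (+-monoʳ-≤ setupCost
               (+-monoʳ-≤ (genCost (loopBound L n ∣V∣ d) (graphGen mode))
                 (+-monoʳ-≤ 2 (+-monoˡ-≤ _ (+-monoʳ-≤ 2 (*-monoʳ-≤ 20 (proj₂ (proj₂ (proj₂ prepared)))))))))) , iff
          where
          open Reduction n ∣V∣ ∣W∣ d L Uᶠ Vᶠ Wᶠ input (coordinate U) (coordinate V) (coordinate W) input≤1 (λ _ _ → refl)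
            w (bits ρ) 1<2^w B 2≤B B^64<2^w using (program-run)

        run-correct : (∀ z → Answered z ρ₀) →
          ∃[ t ] ∃[ S′ ] Eval w (bits ρ) (program mode A L) (input3HS I) t S′ × (reg S′ 0 ≢ 0 ⇔ HasHittingPair I)
        run-correct answered =
          let t , S′ , e , _ , iff = run
          in t , S′ , e , mk⇔
            (λ nz → let z , acc = Equivalence.to iff nz in
              Equivalence.to good⇔hitting (z , Equivalence.to (response-iff z) acc))
            (λ hit → let z , good = Equivalence.from good⇔hitting hit in
              Equivalence.from iff (z , Equivalence.from (response-iff z) good))
          where
          response-iff : ∀ z → Accepts L (reg (Phase.final (phases z)) 0) ⇔ Good z
          response-iff z =
            let t , s , ts , s′ , pre , serve , P , radius , approx = answered z
                serve₀ = subst (λ s → ServeAll A w₀ (bits ρ₀) (requests mode (Wᶠ z) ∷ʳ query) s ts s′)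
                  (proj₂ (Eval-deterministic pre (proj₁ (proj₂ (proj₂ prepared))))) serve
                s′≡ = trans (ServeAll-deterministic serve₀ (proj₁ (proj₂ (proj₂ (served z))))) (sym (final≡ z))
            in subst (λ s → Accepts L (reg s 0) ⇔ Good z) s′≡ (accepts-iff z s′ radius approx)

      halting : (ρ : Tape w) → ∃[ t ] ∃[ s ] Eval w (bits ρ) (program mode A L) (input3HS I) t s × t ≤ cost n n (n ^ β) d
      halting ρ =
        let ρ₀ , agree = prefix (wordLength-≤ N N≤B) ρ
            t , S′ , e , t≤ , _ = run ρ₀ ρ agree
        in t , S′ , e , ≤-trans t≤ (≤-reflexive (cong₂ (λ m K → cost n m K d) ∣V∣≡n ∣W∣≡n^β))

      -- The request sequences are fixed by the instance before any random bit is drawn, so the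
      -- guarantee applies to each of them with the common tape. The simulated tape is a prefix of
      -- the actual one.
      correctness : ErrorAtMost1/ 3 λ (ρ : Tape w) →
        ∃[ t ] ∃[ s ] Eval w (bits ρ) (program mode A L) (input3HS I) t s × (reg s 0 ≢ 0 ⇔ HasHittingPair I)
      correctness = prefix-error {3} (wordLength-≤ N N≤B) (λ ρ₀ → ∀ z → Answered z ρ₀) _
        (λ ρ₀ ρ agree answered → run-correct ρ₀ ρ agree answered)
        (union-bound (N ^ (β + 1)) ∣W∣ {{subst NonZero (sym ∣W∣≡n^β) (m^n≢0 n β)}} Answered enough λ z →
          correct N {{N≢0}} G₀ (initialGraph-unique mode) sparse₀ (requests mode (Wᶠ z)) (proj₁ (legalᵏ z))
            (proj₁ (proj₂ (legalᵏ z))) (few-requests z))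
        where
        enough : ∣W∣ * 3 ≤ N ^ (β + 1)
        enough = begin
          ∣W∣ * 3        ≡⟨ cong (_* 3) ∣W∣≡n^β ⟩
          n ^ β * 3      ≤⟨ *-mono-≤ (^-monoˡ-≤ β n≤N) 3≤N ⟩
          N ^ β * N      ≡⟨ *-comm (N ^ β) N ⟩
          N * N ^ β      ≡⟨ cong (N ^_) (+-comm 1 β) ⟩
          N ^ (β + 1)    ∎
          where open ≤-Reasoning

  -- The exponent of the running time

  module Cost (mode : Mode) (L β k y : ℕ) (1≤β : 1 ≤ β) (p u q : ℕ → ℕ) (Cₚ Cᵤ C_q : ℕ)
    (p≤ : ∀ m .{{_ : NonZero m}} → p m ^ 1 ≤ Cₚ * m ^ β)
    (u≤ : ∀ m .{{_ : NonZero m}} → u m ^ suc y ≤ Cᵤ * m ^ (1 + 2 * y))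
    (q≤ : ∀ m .{{_ : NonZero m}} → q m ^ suc y ≤ C_q * m ^ (1 + 2 * y)) where

    -- Exponents are measured in units of 1/Y, where Y is twice the denominator of ε′: `X₁` belongs
    -- to one phase, `X₂` to all phases. Since `X₂ + 2` is `Y * (β + 2)`, one unit is left for
    -- absorbing polylogarithms and one for δ.
    Y X₁ X₂ : ℕ
    Y  = suc (1 + 2 * y)
    X₁ = (1 + 2 * y) * 2
    X₂ = β * Y + X₁

    open Growth k Y

    cost : ℕ → ℕ → ℕ
    cost n d = totalCost mode L p u q n n (n ^ β) d

    constant : ∀ {X} c → (λ _ _ → c) ≲ X
    constant c = ≲-weaken z≤n (≲-const c)

    vertices-≤ : ∀ n .{{_ : NonZero n}} d → d ≤ polylog k n → suc (loopBound L n n d) ≤ (5 * L + 9) * polylog k n * n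
    vertices-≤ n d d≤ = begin
      suc (loopBound L n n d)                        ≡⟨ expand L n d ⟩
      L * (n + (n + 1)) + (n + (n + 1)) + 1 + d + d + (L + L + 2)
        ≤⟨ +-mono-≤ (+-mono-≤ (+-mono-≤ (+-mono-≤ (+-mono-≤ (*-monoʳ-≤ L line) line) 1≤Z) d≤Z) d≤Z)
             (+-mono-≤ (+-mono-≤ L≤ L≤) (*-monoʳ-≤ 2 1≤Z)) ⟩
      L * (Z + (Z + Z)) + (Z + (Z + Z)) + Z + Z + Z + (L * Z + L * Z + 2 * Z) ≤⟨ m≤m+n _ Z ⟩
      L * (Z + (Z + Z)) + (Z + (Z + Z)) + Z + Z + Z + (L * Z + L * Z + 2 * Z) + Z ≡⟨ collect L Z ⟩
      (5 * L + 9) * Z                                ≡⟨ *-assoc (5 * L + 9) (polylog k n) n ⟨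
      (5 * L + 9) * polylog k n * n                  ∎
      where
      open ≤-Reasoning
      Z = polylog k n * n
      n≤Z : n ≤ Z
      n≤Z = m≤n*m n (polylog k n) {{>-nonZero (1≤polylog k n)}}
      1≤Z : 1 ≤ Z
      1≤Z = ≤-trans (>-nonZero⁻¹ n) n≤Z
      d≤Z : d ≤ Z
      d≤Z = ≤-trans d≤ (m≤m*n (polylog k n) n)
      L≤ : L ≤ L * Z
      L≤ = m≤m*n L Z {{>-nonZero 1≤Z}}
      line : n + (n + 1) ≤ Z + (Z + Z)
      line = +-mono-≤ n≤Z (+-mono-≤ n≤Z 1≤Z)
      expand : ∀ L n d → suc (L * (n + (n + 1)) + (n + (n + 1)) + 1 + d + d + (L + L + 1)) ≡
        L * (n + (n + 1)) + (n + (n + 1)) + 1 + d + d + (L + L + 2)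
      expand = solve-∀
      collect : ∀ L z → L * (z + (z + z)) + (z + (z + z)) + z + z + z + (L * z + L * z + 2 * z) + z ≡ (5 * L + 9) * z
      collect = solve-∀

    at-vertices : ∀ {f : ℕ → ℕ} C X → (∀ m .{{_ : NonZero m}} → f m ^ Y ≤ C * m ^ X) →
                  (λ n d → f (vertices L n n d)) ≲ X
    at-vertices {f} C X f≤ = ≲-∘ {f} {λ n d → vertices L n n d} {5 * L + 9} C X
      (λ n d → >-nonZero (≤-trans (s≤s z≤n) (m≤n+m (suc (d + d)) (suc L * (n + suc n))))) f≤
      λ n d d≤ → ≤-trans (≤-trans (vertices≤loopBound L n n d) (n≤1+n _)) (vertices-≤ n d d≤)

    square : ∀ {f : ℕ → ℕ} {C} → (∀ m .{{_ : NonZero m}} → f m ^ suc y ≤ C * m ^ (1 + 2 * y)) →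
             ∀ m .{{_ : NonZero m}} → f m ^ Y ≤ C ^ 2 * m ^ X₁
    square {f} {C} f≤ m = begin
      f m ^ Y                          ≡⟨ cong (f m ^_) (double y) ⟩
      f m ^ (suc y * 2)                ≡⟨ ^-*-assoc (f m) (suc y) 2 ⟨
      (f m ^ suc y) ^ 2                ≤⟨ ^-monoˡ-≤ 2 (f≤ m) ⟩
      (C * m ^ (1 + 2 * y)) ^ 2        ≡⟨ ^-distribʳ-* C (m ^ (1 + 2 * y)) 2 ⟩
      C ^ 2 * (m ^ (1 + 2 * y)) ^ 2    ≡⟨ cong (C ^ 2 *_) (^-*-assoc m (1 + 2 * y) 2) ⟩
      C ^ 2 * m ^ X₁                   ∎
      where
      open ≤-Reasoning
      double : ∀ y → suc (1 + 2 * y) ≡ suc y * 2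
      double = solve-∀

    p≲ : (λ n d → p (vertices L n n d)) ≲ (β * Y)
    p≲ = at-vertices {p} (Cₚ ^ Y) (β * Y) λ m → ≤-trans
      (^-monoˡ-≤ Y (≤-trans (≤-reflexive (sym (*-identityʳ (p m)))) (p≤ m)))
      (≤-reflexive (trans (^-distribʳ-* Cₚ (m ^ β) Y) (cong (Cₚ ^ Y *_) (^-*-assoc m β Y))))

    loopBound≲ : (λ n d → loopBound L n n d) ≲ Y
    -- The bound is written as the predecessor of its successor, because `≲-∘` asks for a nonzero
    -- argument.
    loopBound≲ = ≲-∘ {pred} {λ n d → suc (loopBound L n n d)} {5 * L + 9} 1 Y (λ _ _ → _)
      (λ m → ≤-trans (^-monoˡ-≤ Y (pred[n]≤n {m})) (≤-reflexive (sym (*-identityˡ (m ^ Y))))) vertices-≤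

    genDepth : Gen → ℕ
    genDepth (emit _ _)  = 0
    genDepth (loop _ g)  = suc (genDepth g)
    genDepth (guard _ g) = genDepth g
    genDepth (g ▹ h)     = genDepth g ⊔ genDepth h

    genCost≲ : ∀ g → (λ n d → genCost (loopBound L n n d) g) ≲ (genDepth g * Y)
    genCost≲ (emit s t)  = constant (size s + (size t + 7))
    genCost≲ (loop _ g)  = ≲-+ (constant 3) (≲-* loopBound≲ (≲-+ (genCost≲ g) (constant 4)))
    genCost≲ (guard e g) = ≲-+ (constant (size e)) (≲-+ (constant 1) (≲-+ (genCost≲ g) (constant 1)))
    genCost≲ (g ▹ h)     = ≲-+
      (≲-weaken (*-monoˡ-≤ Y (m≤m⊔n (genDepth g) (genDepth h))) (genCost≲ g))
      (≲-weaken (*-monoˡ-≤ Y (m≤n⊔m (genDepth g) (genDepth h))) (genCost≲ h))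

    graph-depth : ∀ mode → genDepth (graphGen mode) ≤ 2
    graph-depth inserting = ≤-refl
    graph-depth deleting  = ≤-refl

    -- The nested loops that emit the graph take about `n ^ 2` steps. This is dominated by the
    -- phases, because β is at least 1 and the exponent of a single phase is at least 1 as well.
    2Y≤X₂ : 2 * Y ≤ X₂
    2Y≤X₂ = ≤-trans (≤-trans (m≤m+n (2 * Y) (2 * y)) (≤-reflexive (rearrange y))) (+-monoˡ-≤ X₁ (*-monoˡ-≤ Y 1≤β))
      where
      rearrange : ∀ y → 2 * suc (1 + 2 * y) + 2 * y ≡ 1 * suc (1 + 2 * y) + (1 + 2 * y) * 2
      rearrange = solve-∀

    cost≲ : cost ≲ X₂
    cost≲ =
      ≲-+ (≲-+ (constant setupCost)
      (≲-+ (≲-weaken (≤-trans (*-monoˡ-≤ Y (graph-depth mode)) 2Y≤X₂) (genCost≲ (graphGen mode)))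
      (≲-+ (constant 2)
      (≲-+ (≲-+ (constant 2) (≲-weaken {X = β * Y} (m≤m+n (β * Y) X₁) (≲-* (≲-const 20) p≲)))
      (≲-+ (constant 3) (≲-* (≲-^ β ≲-n) phase≲)))))) (constant 2)
      where
      phase≲ : (λ n d → 20 * (d * u (vertices L n n d) + q (vertices L n n d)) + d * 44 + 18 + 4) ≲ X₁
      phase≲ = ≲-+ (≲-+ (≲-+
        (≲-* (≲-const 20) (≲-+
          (≲-* ≲-d (at-vertices {u} (Cᵤ ^ 2) X₁ (square {u} {Cᵤ} u≤)))
          (at-vertices {q} (C_q ^ 2) X₁ (square {q} {C_q} q≤))))
        (≲-weaken z≤n (≲-* ≲-d (≲-const 44)))) (constant 18)) (constant 4)

    -- The running time has to be bounded in n alone. The maximum over all admissible d is attained,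
    -- so the bounds for single d carry over.
    time : ℕ → ℕ
    time n = maxUpTo (cost n) (polylog k n)

    exponent : ℚ
    exponent = 1ℚ ℚ.+ 1ℚ ℚ.+ natural β ℚ.- unitFraction (1 + 2 * y)

    time-isO : time isO[n^ exponent ]
    time-isO = bounded (≲-absorb cost≲)
      where
      rearrange : ∀ β y → suc (β * suc (1 + 2 * y) + (1 + 2 * y) * 2) + 1 ≡ suc (1 + 2 * y) * (β + 2)
      rearrange = solve-∀
      bounded : (∃[ C ] ∀ n .{{_ : NonZero n}} d → d ≤ polylog k n → cost n d ^ Y ≤ C * n ^ suc X₂) →
        time isO[n^ exponent ]
      bounded (C , cost≤) = C ^ ℚ.ℚ.denominatorℕ exponent , λ n →
        let d , d≤ , time≡ = maxUpTo-attained (cost n) (polylog k n)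
        in ⇒AtMostPow {time n} {C} exponent (suc X₂) (1 + 2 * y) (exponent-≤ β (1 + 2 * y) (suc X₂) (rearrange β y))
             (subst (λ t → t ^ Y ≤ C * n ^ suc X₂) (sym time≡) (cost≤ n d d≤))

  -- Choice of the exponents and conclusion

  data PositiveView : ℚ → Set where
    positive : ∀ x y-1 .(c : Coprime (suc x) (suc y-1)) → PositiveView (mkℚ (ℤ.+ suc x) y-1 c)

  positiveView : ∀ r → 0ℚ ℚ.< r → PositiveView r
  positiveView (mkℚ (ℤ.+ suc x) y-1 c) _ = positive x y-1 c
  positiveView (mkℚ (ℤ.+ zero) y-1 c) (ℚ.*<* (ℤ.+<+ ()))
  positiveView (mkℚ ℤ.-[1+ x ] y-1 c) (ℚ.*<* ())

  reduction : ∀ {σ τ} mode → Supports σ mode → ∀ {t ε ε′} →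
    PositiveView t → PositiveView ε → PositiveView ε′ → Unbalanced3HSHypothesis →
    ¬ SparseRadiusApproximable σ τ ((ℤ.+ 2) ℚ./ 1 ℚ.- ε) t ((ℤ.+ 2) ℚ./ 1 ℚ.- ε′)
  reduction {σ} {τ} mode supported {t} {ε} {ε′}
    (positive β-1 s _) (positive x q-1 cε) (positive x′ y cε′) hypothesis approximable =
    -- U and V have n vectors each and W has `n ^ β`; δ is half of the unit fraction with the
    -- denominator of ε′.
    hypothesis 1ℚ (natural β) (unitFraction (1 + 2 * y))
      (ℚ.*<* (ℤ.+<+ z<s)) (ℚ.*<* (ℤ.+<+ z<s)) (ℚ.*<* (ℤ.+<+ z<s)) λ k →
      solvable k (approximable (k + 3) 1 (β + 1))
    where
    β : ℕ
    -- The numerator of t: a natural number that is at least 1 and at least t.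
    β = suc β-1
    t≤β : toℚᵘ t ℚᵘ.≤ ℚᵘ.mkℚᵘ (ℤ.+ β) 0
    t≤β = ℚᵘ.*≤* (ℤ.*-monoˡ-≤-nonNeg (ℤ.+ β) (ℤ.+≤+ (s≤s z≤n)))
    solvable : ∀ k →
      (∃[ A ] ∃[ c ] ∃[ p ] ∃[ u ] ∃[ q ] p isO[n^ t ] ×
        u isO[n^ (ℤ.+ 2) ℚ./ 1 ℚ.- ε′ ] × q isO[n^ (ℤ.+ 2) ℚ./ 1 ℚ.- ε′ ] ×
        ApproximatesRadius σ τ ((ℤ.+ 2) ℚ./ 1 ℚ.- ε) (k + 3) 1 (β + 1) A c p u q) →
      Solvable3HS 1ℚ (natural β) (1ℚ ℚ.+ 1ℚ ℚ.+ natural β ℚ.- unitFraction (1 + 2 * y)) k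
    solvable k (A , c , p , u , q , (Cₚ , p≤) , (Cᵤ , u≤) , (C_q , q≤) , AR) =
      program mode A L , wordFactor k L β c , time , time-isO , record
        { halts   = λ n d d≤ I ρ → let t , s , e , t≤ = halting d≤ I ρ in
            t , s , e , ≤-trans t≤ (≤maxUpTo (cost n) (polylog k n) d d≤)
        ; correct = λ n d d≤ I → correctness d≤ I
        }
      where
      open Solver σ τ mode supported x q-1 cε β k A c p u q AR using (L; halting; correctness)
      open Cost mode L β k y (s≤s z≤n) p u q (Cₚ ^ 1) (Cᵤ ^ suc y) (C_q ^ suc y)
        (λ m → AtMostPow⇒ {p m} {Cₚ} t β 0 t≤β (p≤ m))
        (λ m → AtMostPow⇒ {u m} {Cᵤ} ((ℤ.+ 2) ℚ./ 1 ℚ.- ε′) (1 + 2 * y) y (two-minus x′ y cε′) (u≤ m))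
        (λ m → AtMostPow⇒ {q m} {C_q} ((ℤ.+ 2) ℚ./ 1 ℚ.- ε′) (1 + 2 * y) y (two-minus x′ y cε′) (q≤ m))
        using (cost; time; time-isO)

open import Defs
open import Data.Integer.Base using (+_)
open import Data.Product.Base using (_×_; _,_)
open import Data.Rational.Base using (ℚ; 0ℚ; _<_; _-_; _/_)
open import Relation.Nullary.Negation using (¬_)
open Development using (Mode; inserting; deleting; positiveView; reduction)

theorem3p6 : (t ε ε′ : ℚ) → 0ℚ < t → 0ℚ < ε → 0ℚ < ε′ →
    Unbalanced3HSHypothesis →
    ¬ SparseRadiusApproximable fullyDynamic amortized (+ 2 / 1 - ε) t (+ 2 / 1 - ε′) ×
    ¬ SparseRadiusApproximable incremental worstCase (+ 2 / 1 - ε) t (+ 2 / 1 - ε′) ×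
    ¬ SparseRadiusApproximable decremental worstCase (+ 2 / 1 - ε) t (+ 2 / 1 - ε′)
theorem3p6 t ε ε′ 0<t 0<ε 0<ε′ hypothesis =
  reduction inserting fullyDynamic t⁺ ε⁺ ε′⁺ hypothesis ,
  reduction inserting incremental  t⁺ ε⁺ ε′⁺ hypothesis ,
  reduction deleting  decremental  t⁺ ε⁺ ε′⁺ hypothesis
  where
  t⁺  = positiveView t 0<t
  ε⁺  = positiveView ε 0<ε
  ε′⁺ = positiveView ε′ 0<ε′
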